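{- There exist infinitely many quadratic fields $K$ such that for each of them there exist infinitely many Diophantine triples $\{a,b,c\}$ over $K$ for which the induced elliptic curve $E: y^2 = (ax+1)(bx+1)(cx+1)$ has torsion group $E(K)_{\mathrm{tors}} \cong \mathbb{Z}/2\mathbb{Z} \times \mathbb{Z}/12\mathbb{Z}$.
   Context: For a field $K$, a Diophantine triple over $K$ is a set $\{a,b,c\}$ of three distinct nonzero elements of $K$ such that $ab+1$, $ac+1$ and $bc+1$ are all squares of elements of $K$. The elliptic curve induced by the Diophantine triple $\{a,b,c\}$ is $E: y^2 = (ax+1)(bx+1)(cx+1)$, considered over $K$. -}

module Defs where

open import Data.Nat as ℕ using (ℕ; zero; suc; NonZero)
open import Data.Nat.DivMod using (_%_; m%n<n)
open import Data.Integer as ℤ using (ℤ; ∣_∣)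
open import Data.Rational as ℚ using (ℚ; 0ℚ; 1ℚ; 1/_; ≢-nonZero)
open import Data.Rational.Properties using () renaming (_≟_ to _≟ℚ_)
open import Data.Nat.Divisibility using () renaming (_∣_ to _∣ℕ_)
open import Data.Unit using (⊤)
open import Data.Product.Properties using (≡-dec)
open import Data.Fin using (Fin; toℕ; fromℕ<)
open import Data.Product using (Σ; ∃; _×_; _,_; proj₁; proj₂)
open import Data.List using (List)
open import Data.List.Membership.Propositional using (_∈_)
open import Data.Sum using (_⊎_)
import Relation.Nullary
open import Relation.Nullary using (¬_; yes; no)
open import Relation.Binary.PropositionalEquality using (_≡_; _≢_)

-- Quadratic fields.  Every quadratic field is Q(√d) for a unique
-- squarefree integer d ≠ 0, 1; distinct such d give non-isomorphic fields.

SquarefreeInt : ℤ → Set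
SquarefreeInt d = d ≢ ℤ.+ 0 × (∀ (n : ℕ) → (n ℕ.* n) ∣ℕ ∣ d ∣ → n ≡ 1)

QuadraticDiscr : ℤ → Set
QuadraticDiscr d = SquarefreeInt d × d ≢ ℤ.+ 1

-- Elements of Q(√d): p + q√d represented as the pair (p , q).
module QField (d : ℤ) where

  K : Set
  K = ℚ × ℚ

  dℚ : ℚ
  dℚ = d ℚ./ 1

  0K 1K : K
  0K = 0ℚ , 0ℚ
  1K = 1ℚ , 0ℚ

  fromℚ : ℚ → K
  fromℚ p = p , 0ℚ

  infixl 6 _+K_ _-K_
  infixl 7 _*K_

  _+K_ : K → K → K
  (a , b) +K (c , e) = (a ℚ.+ c) , (b ℚ.+ e)

  -K_ : K → K
  -K (a , b) = ℚ.- a , ℚ.- b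

  _-K_ : K → K → K
  x -K y = x +K (-K y)

  _*K_ : K → K → K
  (a , b) *K (c , e) = (a ℚ.* c ℚ.+ dℚ ℚ.* b ℚ.* e) , (a ℚ.* e ℚ.+ b ℚ.* c)

  -- inverse (junk value 0 at 0): (a - b√d) / (a² - d b²)
  invℚ : ℚ → ℚ
  invℚ p with p ≟ℚ 0ℚ
  ... | yes _  = 0ℚ
  ... | no p≢0 = 1/_ p {{≢-nonZero p≢0}}

  invK : K → K
  invK (a , b) = let n = invℚ (a ℚ.* a ℚ.- dℚ ℚ.* b ℚ.* b)
                 in (a ℚ.* n) , (ℚ.- (b ℚ.* n))

  _/K_ : K → K → K
  x /K y = x *K invK y

  _≟K_ : (x y : K) → Relation.Nullary.Dec (x ≡ y)
  _≟K_ = ≡-dec _≟ℚ_ _≟ℚ_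

  IsSquare : K → Set
  IsSquare x = ∃ λ r → r *K r ≡ x

  DiophantineTriple : K → K → K → Set
  DiophantineTriple a b c =
    a ≢ 0K × b ≢ 0K × c ≢ 0K × a ≢ b × a ≢ c × b ≢ c ×
    IsSquare (a *K b +K 1K) × IsSquare (a *K c +K 1K) × IsSquare (b *K c +K 1K)

  _∈₃_ : K → K × K × K → Set
  x ∈₃ (a , b , c) = x ≡ a ⊎ x ≡ b ⊎ x ≡ c

  SameSet : K × K × K → K × K × K → Set
  SameSet t u = (∀ x → x ∈₃ t → x ∈₃ u) × (∀ x → x ∈₃ u → x ∈₃ t)

  -- The induced elliptic curve  y² = (ax+1)(bx+1)(cx+1)
  --                            = A x³ + B x² + C x + D

  data Point : Set where
    O   : Point
    aff : K → K → Point

  module Curve (a b c : K) where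

    A B C D : K
    A = a *K b *K c
    B = a *K b +K a *K c +K b *K c
    C = a +K b +K c
    D = 1K

    OnCurve : Point → Set
    OnCurve O = ⊤
    OnCurve (aff x y) = y *K y ≡ (a *K x +K 1K) *K (b *K x +K 1K) *K (c *K x +K 1K)

    three two : K
    two   = fromℚ (ℤ.+ 2 ℚ./ 1)
    three = fromℚ (ℤ.+ 3 ℚ./ 1)

    -- third intersection with the line of slope λ through (x1,y1), (x2,·),
    -- then reflected: the chord-tangent group law with neutral element O.
    chord : K → K → K → K → Point
    chord λ' x1 y1 x2 =
      let x3 = (λ' *K λ' -K B) /K A -K x1 -K x2
          ν  = y1 -K λ' *K x1
      in aff x3 (-K (λ' *K x3 +K ν))

    _⊕_ : Point → Point → Point
    O ⊕ Q = Q
    P ⊕ O = P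
    aff x1 y1 ⊕ aff x2 y2 with x1 ≟K x2
    ... | no _ = chord ((y2 -K y1) /K (x2 -K x1)) x1 y1 x2
    ... | yes _ with y1 ≟K (-K y2)
    ...   | yes _ = O
    ...   | no _  = chord ((three *K A *K x1 *K x1 +K two *K B *K x1 +K C) /K (two *K y1)) x1 y1 x2

    _·_ : ℕ → Point → Point
    zero  · P = O
    suc n · P = P ⊕ (n · P)

    IsTorsion : Point → Set
    IsTorsion P = ∃ λ n → n ≢ 0 × n · P ≡ O

addMod : (n : ℕ) .{{_ : NonZero n}} → Fin n → Fin n → Fin n
addMod n u v = fromℕ< (m%n<n (toℕ u ℕ.+ toℕ v) n)

Z2×Z12 : Set
Z2×Z12 = Fin 2 × Fin 12

_⊞_ : Z2×Z12 → Z2×Z12 → Z2×Z12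
(u₁ , u₂) ⊞ (v₁ , v₂) = addMod 2 u₁ v₁ , addMod 12 u₂ v₂

{-# OPTIONS --safe #-}
-- Let q² = 2m + 1 with m rational, α² = m (m + 2) and K = ℚ(α).  The triple
-- (α, −1/α, (m² − 1)/α) induces a curve with a point of order 12 and full
-- 2-torsion.  The equations describe a twist of the elliptic curve X₁(2,12); a
-- rational point on the twist, doubled repeatedly, gives infinitely many triples
-- over the same K.
--
-- The curve is put in Legendre form Y² = X (X − 1) (X − κ) with κ not a square,
-- which makes it isomorphic to s² + c² = 1, κ s² + d² = 1 with the everywhere
-- defined addition formulas of sn, cn and dn.  The parameters are chosen such
-- that 3 ramifies in K and divides m exactly once.  At the prime above 3, with
-- uniformizer α, the function s takes valuations 0, 1, 2 or at least 4 on K-points.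
-- Tripling multiplies a small s by a non-zero number divisible by α, so torsion
-- points with s divisible by α⁴ have s = 0, i.e. are 2-torsion.  For points P, Q
-- with s of equal valuation the formula for s (P + Q) s (P − Q) shows that one of
-- P ± Q has s divisible by α⁴.  Since a point G of order 12 yields the valuations
-- 2, 1, 0 at G, 2G, 3G, every torsion point is a 2-torsion point plus a multiple of G.
module Submission where

open import Defs
open import Algebra.Bundles using (AbelianGroup; CommutativeRing)
open import Algebra.Structures using (IsAbelianGroup; IsCommutativeRing)
import Algebra.Properties.CommutativeMonoid.Mult as Mult
import Algebra.Properties.Ring as RingProperties
open import Data.Bool using (Bool; true; false; T; if_then_else_)
open import Data.Empty using (⊥; ⊥-elim)
open import Data.Fin using (Fin; toℕ; fromℕ<)
import Data.Fin.Properties as Finₚ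
open import Data.Integer as ℤ using (ℤ; ∣_∣)
open import Data.Integer.DivMod using (_%ℕ_; _/ℕ_; a≡a%ℕn+[a/ℕn]*n; n%ℕd<d)
import Data.Integer.Properties as ℤₚ
import Data.Integer.Tactic.RingSolver as ℤ-Solver
open import Data.List using (List; []; _∷_)
open import Data.List.Membership.Propositional using (_∈_)
open import Data.List.Relation.Unary.All using (All; []; _∷_)
open import Data.List.Relation.Unary.Any using (here; there)
open import Data.Maybe using (Maybe; just; nothing)
open import Data.Nat as ℕ using (ℕ; zero; suc; NonZero; _<_; _!)
open import Data.Nat.Coprimality as Coprimality using (Coprime; coprime-divisor)
open import Data.Nat.Divisibility as ∣ₙ using (divides) renaming (_∣_ to _∣ₙ_)
open import Data.Nat.DivMod using (_%_; _/_; m%n<n; m≡m%n+[m/n]*n)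
open import Data.Nat.Induction using (<-rec)
import Data.Nat.ListAction as ListAction
open import Data.Nat.Primality using (Prime; euclidsLemma; prime[2]; prime?; prime⇒nonTrivial; prime⇒nonZero; prime⇒irreducible)
open import Data.Nat.Primality.Factorisation using (PrimeFactorisation; factorise)
import Data.Nat.Properties as ℕₚ
open import Data.Nat.Tactic.RingSolver using (solve-∀)
open import Data.Product using (Σ; ∃; _×_; _,_; proj₁; proj₂)
open import Data.Rational as ℚ using (ℚ; 0ℚ; 1ℚ; mkℚ; ↥_; ↧_; ↧ₙ_; toℚᵘ)
import Data.Rational.Properties as ℚₚ
open import Data.Rational.Unnormalised as ℚᵘ using (mkℚᵘ; *≡*)
import Data.Rational.Unnormalised.Properties as ℚᵘₚ
open import Data.Sum using (_⊎_; inj₁; inj₂; [_,_]′)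
open import Data.Unit using (⊤; tt)
open import Data.Vec as Vec using (Vec; []; _∷_)
open import Function using (_∘_)
open import Function.Definitions using (Injective)
open import Level using (0ℓ)
open import Relation.Binary.PropositionalEquality hiding (J)
open import Relation.Nullary using (¬_; Dec; yes; no)
open import Relation.Nullary.Decidable using (recompute; from-yes; _→-dec_; _×-dec_; ¬?)

-- The choice `b = −1/a` makes `ab + 1` zero, so `ac − ab = ac + 1 = m²` and `bc − ab = bc + 1`.
-- Once `bc + 1` is a square, the 2-torsion point with `x = −1/c` can be halved, which gives order
-- 4. With `c = (m² − 1)/a`, tripling the point `(0, 1)` gives `(−1/b, 0)` exactly when
-- `a² = m (m ± 2)`, which gives order 6 and, combined with order 4, order 12. For the plus sign
-- `bc + 1 = (2m + 1)/a²`, whence the condition on `2m + 1`. The upper bound on torsion must hold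
-- for the whole family at once. It rests on one prime where all members look alike: `κ` has
-- valuation -6, and both `−κ π⁶` and `3/π²` are congruent to 1. Everything then comes down to -1
-- being no square in 𝔽₃: it makes `κ` a non-square and `s` integral, it excludes valuation 3, and
-- it keeps `1 + t²`, the leading term of the tripling factor, from vanishing. The prime 2 separates
-- the triples: close to the neutral point of the twist each doubling multiplies the coordinate of
-- `α` by a further 2, so its numerator is unbounded.

-- Abstract fields, and polynomial identities modulo rewrite rules by reflection.

record Field : Set₁ where
  infixl 6 _+_ _-_
  infixl 7 _*_
  infix  8 -_
  infixr 9 _^_
  field
    F        : Set
    _+_ _*_  : F → F → F
    -_       : F → F
    0# 1#    : F
    isCommutativeRing : IsCommutativeRing _≡_ _+_ _*_ -_ 0# 1#
    1≢0      : 1# ≢ 0#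
    _⁻¹      : F → F
    inverseʳ : ∀ x → x ≢ 0# → x * x ⁻¹ ≡ 1#
    _≟_      : (x y : F) → Dec (x ≡ y)

  _-_ : F → F → F
  x - y = x + - y

  -- The separate clauses for 1, here and in `nat`, let `x ^ 2` reduce to `x * x` and `nat 2` to
  -- `1# + 1#`, so both spellings can be mixed freely.
  _^_ : F → ℕ → F
  x ^ zero        = 1#
  x ^ suc zero    = x
  x ^ suc (suc n) = x * x ^ suc n

  nat : ℕ → F
  nat zero          = 0#
  nat (suc zero)    = 1#
  nat (suc (suc n)) = 1# + nat (suc n)

  commutativeRing : CommutativeRing 0ℓ 0ℓ
  commutativeRing = record { isCommutativeRing = isCommutativeRing }

  open CommutativeRing commutativeRing public
    using (+-assoc; +-comm; +-identityˡ; +-identityʳ; -‿inverseʳ; -‿inverseˡ;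
           *-assoc; *-comm; *-identityˡ; *-identityʳ; distribˡ; distribʳ; zeroˡ; zeroʳ)
  open RingProperties (CommutativeRing.ring commutativeRing) public
    using (-‿distribˡ-*; -‿distribʳ-*; -‿+-comm; -‿involutive; -0#≈0#; x∙y⁻¹≈ε⇒x≈y)

-- Equalities of polynomial expressions, modulo hypotheses used as rewrite
-- rules: a rule m := p replaces every multiple of the monomial m.
module Solver (𝔽 : Field) where
  open Field 𝔽
  open ≡-Reasoning

  infixl 6 _:+_ _:-_
  infixl 7 _:*_
  infix  8 :-_
  infixr 9 _:^_
  infix  5.5 _:=_
  infix  3 _given_

  data Expr : Set where
    var       : ℕ → Expr
    con       : ℕ → Expr
    _:+_ _:*_ : Expr → Expr → Expr
    :-_       : Expr → Expr
    _:^_      : Expr → ℕ → Expr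

  _:-_ : Expr → Expr → Expr
  x :- y = x :+ :- y

  record Equation : Set where
    constructor _:=_
    field lhs rhs : Expr

  record Problem : Set where
    constructor _given_
    field
      goal  : Equation
      hyps  : List Equation

  Env : Set
  Env = List F

  lookup : Env → ℕ → F
  lookup []      _       = 1#
  lookup (x ∷ _) zero    = x
  lookup (_ ∷ ρ) (suc i) = lookup ρ i

  ⟦_⟧ : Expr → Env → F
  ⟦ var i ⟧  ρ = lookup ρ i
  ⟦ con n ⟧  ρ = nat n
  ⟦ e :+ f ⟧ ρ = ⟦ e ⟧ ρ + ⟦ f ⟧ ρ
  ⟦ e :* f ⟧ ρ = ⟦ e ⟧ ρ * ⟦ f ⟧ ρ
  ⟦ :- e ⟧   ρ = - ⟦ e ⟧ ρ
  ⟦ e :^ n ⟧ ρ = ⟦ e ⟧ ρ ^ n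

  ⟦_⟧ᵉ : Equation → Env → Set
  ⟦ l := r ⟧ᵉ ρ = ⟦ l ⟧ ρ ≡ ⟦ r ⟧ ρ

  -- The pair (p , n) stands for the coefficient p − n.
  Coef : Set
  Coef = ℕ × ℕ

  Mono : Set
  Mono = List ℕ

  Poly : Set
  Poly = List (Coef × Mono)

  addC mulC : Coef → Coef → Coef
  addC (p , n) (p′ , n′) = p ℕ.+ p′ , n ℕ.+ n′
  mulC (p , n) (p′ , n′) = p ℕ.* p′ ℕ.+ n ℕ.* n′ , p ℕ.* n′ ℕ.+ n ℕ.* p′

  mulM : Mono → Mono → Mono
  mulM []       m        = m
  mulM (i ∷ l)  []       = i ∷ l
  mulM (i ∷ l)  (j ∷ m)  = i ℕ.+ j ∷ mulM l m

  -- Monomials carry no trailing zero exponents.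
  consM : ℕ → Mono → Mono
  consM zero [] = []
  consM i    m  = i ∷ m

  quotM : Mono → Mono → Mono
  quotM []      m       = []
  quotM (i ∷ l) []      = i ∷ l
  quotM (i ∷ l) (j ∷ m) = consM (i ℕ.∸ j) (quotM l m)

  dividesM : Mono → Mono → Bool
  dividesM []      m       = true
  dividesM (i ∷ l) []      = false
  dividesM (i ∷ l) (j ∷ m) = if j ℕ.<ᵇ i then false else dividesM l m

  ltM : Mono → Mono → Bool
  ltM _       []      = false
  ltM []      (_ ∷ _) = true
  ltM (i ∷ l) (j ∷ m) = if i ℕ.<ᵇ j then true else if i ℕ.≡ᵇ j then ltM l m else false

  eqM : Mono → Mono → Bool
  eqM []      []      = true
  eqM []      (_ ∷ _) = false
  eqM (_ ∷ _) []      = false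
  eqM (i ∷ l) (j ∷ m) = if i ℕ.≡ᵇ j then eqM l m else false

  -- Dropping vanishing coefficients makes a polynomial that cancels completely the empty list,
  -- which is what `isZero` tests.
  consC : Coef → Mono → Poly → Poly
  consC (p , n) m q with p ℕ.≡ᵇ n
  ... | true  = q
  ... | false = ((p , n) , m) ∷ q

  mutual
    -- The order `ltM` serves to bring equal monomials together; `add-sound` holds for unsorted
    -- lists as well.
    add : Poly → Poly → Poly
    add []            q = q
    add ((c , m) ∷ p) q = addInto c m p q

    addInto : Coef → Mono → Poly → Poly → Poly
    addInto c m p []              = (c , m) ∷ p
    addInto c m p ((c′ , m′) ∷ q) with eqM m m′
    ... | true  = consC (addC c c′) m (add p q)
    ... | false with ltM m m′
    ...   | true  = (c , m) ∷ add p ((c′ , m′) ∷ q)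
    ...   | false = (c′ , m′) ∷ addInto c m p q

  scale : Coef → Mono → Poly → Poly
  scale c m []              = []
  scale c m ((c′ , m′) ∷ q) = (mulC c c′ , mulM m m′) ∷ scale c m q

  mul : Poly → Poly → Poly
  mul []            q = []
  mul ((c , m) ∷ p) q = add (scale c m q) (mul p q)

  neg : Poly → Poly
  neg []                  = []
  neg (((p , n) , m) ∷ q) = ((n , p) , m) ∷ neg q

  one : Poly
  one = ((1 , 0) , []) ∷ []

  pow : Poly → ℕ → Poly
  pow p zero          = one
  pow p (suc zero)    = p
  pow p (suc (suc n)) = mul p (pow p (suc n))

  unit : ℕ → Mono
  unit zero    = 1 ∷ []
  unit (suc i) = 0 ∷ unit i

  Rule : Set
  Rule = Mono × Poly

  Rules : Set
  Rules = List Rule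

  -- The quotient is multiplied back and compared with `m`, so soundness rests on `eqM` alone and
  -- asks nothing of `dividesM` and `quotM`.
  findRule : Rules → Mono → Maybe (Mono × Poly)
  findRule []             m = nothing
  findRule ((l , r) ∷ rs) m with dividesM l m
  ... | false = findRule rs m
  ... | true with eqM (mulM l (quotM m l)) m
  ...   | true  = just (quotM m l , r)
  ...   | false = findRule rs m

  reduceBy : (Poly → Poly) → Rules → Poly → Poly
  reduceBy again rs []            = []
  reduceBy again rs ((c , m) ∷ p) with findRule rs m
  ... | nothing      = add ((c , m) ∷ []) (reduceBy again rs p)
  ... | just (q , r) = add (again (scale c q r)) (reduceBy again rs p)

  reduce : ℕ → Rules → Poly → Poly
  reduce zero    rs p = p
  reduce (suc k) rs p = reduceBy (reduce k rs) rs p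

  -- Bounds the number of successive rewrites of a monomial.
  fuel : ℕ
  fuel = 100

  -- Reduction after every product, and not once at the end, keeps the intermediate polynomials
  -- small.
  norm : Rules → Expr → Poly
  norm rs (var i)  = reduce fuel rs (((1 , 0) , unit i) ∷ [])
  norm rs (con n)  = consC (n , 0) [] []
  norm rs (e :+ f) = add (norm rs e) (norm rs f)
  norm rs (e :* f) = reduce fuel rs (mul (norm rs e) (norm rs f))
  norm rs (:- e)   = neg (norm rs e)
  norm rs (e :^ n) = reduce fuel rs (pow (norm rs e) n)

  -- Only a left side that normalises to a monomial with coefficient 1 yields a rule. Any other
  -- hypothesis is dropped, which loses strength but not soundness.
  rule : Equation → Rules
  rule (l := r) with norm [] l
  ... | ((1 , 0) , m) ∷ [] = (m , norm [] r) ∷ []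
  ... | _                  = []

  rules : List Equation → Rules
  rules []       = []
  rules (e ∷ es) with rule e
  ... | []    = rules es
  ... | r ∷ _ = r ∷ rules es

  ⟦_⟧ᶜ : Coef → F
  ⟦ p , n ⟧ᶜ = nat p - nat n

  ⟦_⟧ᵐ : Mono → Env → F
  ⟦ []    ⟧ᵐ ρ       = 1#
  ⟦ i ∷ m ⟧ᵐ []      = 1#
  ⟦ i ∷ m ⟧ᵐ (x ∷ ρ) = x ^ i * ⟦ m ⟧ᵐ ρ

  ⟦_⟧ᵖ : Poly → Env → F
  ⟦ []          ⟧ᵖ ρ = 0#
  ⟦ (c , m) ∷ p ⟧ᵖ ρ = ⟦ c ⟧ᶜ * ⟦ m ⟧ᵐ ρ + ⟦ p ⟧ᵖ ρ

  nat-suc : ∀ n → nat (suc n) ≡ 1# + nat n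
  nat-suc zero    = sym (+-identityʳ 1#)
  nat-suc (suc n) = refl

  nat-+ : ∀ m n → nat (m ℕ.+ n) ≡ nat m + nat n
  nat-+ zero    n = sym (+-identityˡ _)
  nat-+ (suc m) n = begin
    nat (suc (m ℕ.+ n))     ≡⟨ nat-suc (m ℕ.+ n) ⟩
    1# + nat (m ℕ.+ n)      ≡⟨ cong (1# +_) (nat-+ m n) ⟩
    1# + (nat m + nat n)    ≡⟨ +-assoc 1# (nat m) (nat n) ⟨
    1# + nat m + nat n      ≡⟨ cong (_+ nat n) (nat-suc m) ⟨
    nat (suc m) + nat n     ∎

  nat-* : ∀ m n → nat (m ℕ.* n) ≡ nat m * nat n
  nat-* zero    n = sym (zeroˡ _)
  nat-* (suc m) n = begin
    nat (n ℕ.+ m ℕ.* n)          ≡⟨ nat-+ n (m ℕ.* n) ⟩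
    nat n + nat (m ℕ.* n)        ≡⟨ cong₂ _+_ (sym (*-identityˡ _)) (nat-* m n) ⟩
    1# * nat n + nat m * nat n   ≡⟨ distribʳ (nat n) 1# (nat m) ⟨
    (1# + nat m) * nat n         ≡⟨ cong (_* nat n) (nat-suc m) ⟨
    nat (suc m) * nat n          ∎

  private
    interchange : ∀ a b c d → (a + b) + (c + d) ≡ (a + c) + (b + d)
    interchange a b c d = begin
      (a + b) + (c + d)  ≡⟨ +-assoc a b (c + d) ⟩
      a + (b + (c + d))  ≡⟨ cong (a +_) (sym (+-assoc b c d)) ⟩
      a + ((b + c) + d)  ≡⟨ cong (λ t → a + (t + d)) (+-comm b c) ⟩
      a + ((c + b) + d)  ≡⟨ cong (a +_) (+-assoc c b d) ⟩
      a + (c + (b + d))  ≡⟨ +-assoc a c (b + d) ⟨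
      (a + c) + (b + d)  ∎

    *-interchange : ∀ a b c d → (a * b) * (c * d) ≡ (a * c) * (b * d)
    *-interchange a b c d = begin
      (a * b) * (c * d)  ≡⟨ *-assoc a b (c * d) ⟩
      a * (b * (c * d))  ≡⟨ cong (a *_) (sym (*-assoc b c d)) ⟩
      a * ((b * c) * d)  ≡⟨ cong (λ t → a * (t * d)) (*-comm b c) ⟩
      a * ((c * b) * d)  ≡⟨ cong (a *_) (*-assoc c b d) ⟩
      a * (c * (b * d))  ≡⟨ *-assoc a c (b * d) ⟨
      (a * c) * (b * d)  ∎

    left-comm : ∀ a b c → a + (b + c) ≡ b + (a + c)
    left-comm a b c = trans (sym (+-assoc a b c)) (trans (cong (_+ c) (+-comm a b)) (+-assoc b a c))

  ^-suc : ∀ x n → x ^ suc n ≡ x * x ^ n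
  ^-suc x zero    = sym (*-identityʳ x)
  ^-suc x (suc n) = refl

  ^-+ : ∀ x i j → x ^ (i ℕ.+ j) ≡ x ^ i * x ^ j
  ^-+ x zero    j = sym (*-identityˡ _)
  ^-+ x (suc i) j = begin
    x ^ suc (i ℕ.+ j)    ≡⟨ ^-suc x (i ℕ.+ j) ⟩
    x * x ^ (i ℕ.+ j)    ≡⟨ cong (x *_) (^-+ x i j) ⟩
    x * (x ^ i * x ^ j)  ≡⟨ *-assoc x _ _ ⟨
    x * x ^ i * x ^ j    ≡⟨ cong (_* x ^ j) (^-suc x i) ⟨
    x ^ suc i * x ^ j    ∎

  addC-sound : ∀ c c′ → ⟦ addC c c′ ⟧ᶜ ≡ ⟦ c ⟧ᶜ + ⟦ c′ ⟧ᶜ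
  addC-sound (p , n) (p′ , n′) = begin
    nat (p ℕ.+ p′) - nat (n ℕ.+ n′)          ≡⟨ cong₂ _-_ (nat-+ p p′) (nat-+ n n′) ⟩
    nat p + nat p′ + - (nat n + nat n′)      ≡⟨ cong (nat p + nat p′ +_) (-‿+-comm (nat n) (nat n′)) ⟨
    nat p + nat p′ + (- nat n + - nat n′)    ≡⟨ interchange _ _ _ _ ⟩
    (nat p - nat n) + (nat p′ - nat n′)      ∎

  mulC-sound : ∀ c c′ → ⟦ mulC c c′ ⟧ᶜ ≡ ⟦ c ⟧ᶜ * ⟦ c′ ⟧ᶜ
  mulC-sound (p , n) (p′ , n′) = begin
    nat (p ℕ.* p′ ℕ.+ n ℕ.* n′) - nat (p ℕ.* n′ ℕ.+ n ℕ.* p′)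
      ≡⟨ cong₂ _-_ (trans (nat-+ (p ℕ.* p′) _) (cong₂ _+_ (nat-* p p′) (nat-* n n′)))
                   (trans (nat-+ (p ℕ.* n′) _) (cong₂ _+_ (nat-* p n′) (nat-* n p′))) ⟩
    (P * P′ + N * N′) + - (P * N′ + N * P′)        ≡⟨ cong ((P * P′ + N * N′) +_) (-‿+-comm _ _) ⟨
    (P * P′ + N * N′) + (- (P * N′) + - (N * P′))  ≡⟨ cong ((P * P′ + N * N′) +_) (+-comm _ _) ⟩
    (P * P′ + N * N′) + (- (N * P′) + - (P * N′))  ≡⟨ interchange _ _ _ _ ⟩
    (P * P′ + - (N * P′)) + (N * N′ + - (P * N′))
      ≡⟨ cong₂ _+_ (cong (P * P′ +_) (-‿distribˡ-* N P′))
                   (trans (+-comm _ _) (cong₂ _+_ (-‿distribʳ-* P N′) (sym (trans (sym (-‿distribˡ-* N (- N′)))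
                     (trans (cong -_ (sym (-‿distribʳ-* N N′))) (-‿involutive _)))))) ⟩
    (P * P′ + - N * P′) + (P * - N′ + - N * - N′)  ≡⟨ cong₂ _+_ (distribʳ P′ P (- N)) (distribʳ (- N′) P (- N)) ⟨
    (P - N) * P′ + (P - N) * - N′                  ≡⟨ distribˡ (P - N) P′ (- N′) ⟨
    (P - N) * (P′ - N′)                            ∎
    where P = nat p ; N = nat n ; P′ = nat p′ ; N′ = nat n′

  mulM-sound : ∀ l m ρ → ⟦ mulM l m ⟧ᵐ ρ ≡ ⟦ l ⟧ᵐ ρ * ⟦ m ⟧ᵐ ρ
  mulM-sound []      m       ρ       = sym (*-identityˡ _)
  mulM-sound (i ∷ l) []      ρ       = sym (*-identityʳ _)
  mulM-sound (i ∷ l) (j ∷ m) []      = sym (*-identityˡ _)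
  mulM-sound (i ∷ l) (j ∷ m) (x ∷ ρ) =
    trans (cong₂ _*_ (^-+ x i j) (mulM-sound l m ρ)) (*-interchange _ _ _ _)

  consC-sound : ∀ c m q ρ → ⟦ consC c m q ⟧ᵖ ρ ≡ ⟦ c ⟧ᶜ * ⟦ m ⟧ᵐ ρ + ⟦ q ⟧ᵖ ρ
  consC-sound (p , n) m q ρ with p ℕ.≡ᵇ n in eq
  ... | false = refl
  ... | true with refl ← ℕₚ.≡ᵇ⇒≡ p n (subst T (sym eq) _) = sym
        (trans (cong (_+ ⟦ q ⟧ᵖ ρ) (trans (cong (_* ⟦ m ⟧ᵐ ρ) (-‿inverseʳ (nat p))) (zeroˡ _)))
                              (+-identityˡ _))

  eqM-sound : ∀ l m → eqM l m ≡ true → l ≡ m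
  eqM-sound []      []      _  = refl
  eqM-sound (i ∷ l) (j ∷ m) eq with i ℕ.≡ᵇ j in i≡ᵇj
  ... | true = cong₂ _∷_ (ℕₚ.≡ᵇ⇒≡ i j (subst T (sym i≡ᵇj) _)) (eqM-sound l m eq)

  mutual
    add-sound : ∀ p q ρ → ⟦ add p q ⟧ᵖ ρ ≡ ⟦ p ⟧ᵖ ρ + ⟦ q ⟧ᵖ ρ
    add-sound []            q ρ = sym (+-identityˡ _)
    add-sound ((c , m) ∷ p) q ρ = addInto-sound c m p q ρ

    addInto-sound : ∀ c m p q ρ →
      ⟦ addInto c m p q ⟧ᵖ ρ ≡ ⟦ c ⟧ᶜ * ⟦ m ⟧ᵐ ρ + ⟦ p ⟧ᵖ ρ + ⟦ q ⟧ᵖ ρ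
    addInto-sound c m p []              ρ = sym (+-identityʳ _)
    addInto-sound c m p ((c′ , m′) ∷ q) ρ with eqM m m′ in eq
    ... | true with refl ← eqM-sound m m′ eq = begin
      ⟦ consC (addC c c′) m (add p q) ⟧ᵖ ρ                    ≡⟨ consC-sound (addC c c′) m (add p q) ρ ⟩
      ⟦ addC c c′ ⟧ᶜ * M + ⟦ add p q ⟧ᵖ ρ                     ≡⟨
            cong₂ _+_ (cong (_* M) (addC-sound c c′)) (add-sound p q ρ) ⟩
      (⟦ c ⟧ᶜ + ⟦ c′ ⟧ᶜ) * M + (⟦ p ⟧ᵖ ρ + ⟦ q ⟧ᵖ ρ)          ≡⟨
            cong (_+ (⟦ p ⟧ᵖ ρ + ⟦ q ⟧ᵖ ρ)) (distribʳ M ⟦ c ⟧ᶜ ⟦ c′ ⟧ᶜ) ⟩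
      (⟦ c ⟧ᶜ * M + ⟦ c′ ⟧ᶜ * M) + (⟦ p ⟧ᵖ ρ + ⟦ q ⟧ᵖ ρ)      ≡⟨ interchange _ _ _ _ ⟩
      (⟦ c ⟧ᶜ * M + ⟦ p ⟧ᵖ ρ) + (⟦ c′ ⟧ᶜ * M + ⟦ q ⟧ᵖ ρ)      ∎
      where M = ⟦ m ⟧ᵐ ρ
    ... | false with ltM m m′
    ...   | true  = trans (cong (⟦ c ⟧ᶜ * ⟦ m ⟧ᵐ ρ +_) (add-sound p _ ρ)) (sym (+-assoc _ _ _))
    ...   | false = trans (cong (⟦ c′ ⟧ᶜ * ⟦ m′ ⟧ᵐ ρ +_) (addInto-sound c m p q ρ)) (left-comm _ _ _)

  scale-sound : ∀ c m q ρ → ⟦ scale c m q ⟧ᵖ ρ ≡ ⟦ c ⟧ᶜ * ⟦ m ⟧ᵐ ρ * ⟦ q ⟧ᵖ ρ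
  scale-sound c m []              ρ = sym (zeroʳ _)
  scale-sound c m ((c′ , m′) ∷ q) ρ = trans
    (cong₂ _+_ (trans (cong₂ _*_ (mulC-sound c c′) (mulM-sound m m′ ρ)) (*-interchange _ _ _ _))
          (scale-sound c m q ρ))
    (sym (distribˡ _ _ _))

  mul-sound : ∀ p q ρ → ⟦ mul p q ⟧ᵖ ρ ≡ ⟦ p ⟧ᵖ ρ * ⟦ q ⟧ᵖ ρ
  mul-sound []            q ρ = sym (zeroˡ _)
  mul-sound ((c , m) ∷ p) q ρ = trans (add-sound (scale c m q) (mul p q) ρ)
    (trans (cong₂ _+_ (scale-sound c m q ρ) (mul-sound p q ρ)) (sym (distribʳ _ _ _)))

  neg-sound : ∀ p ρ → ⟦ neg p ⟧ᵖ ρ ≡ - ⟦ p ⟧ᵖ ρ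
  neg-sound []                  ρ = sym -0#≈0#
  neg-sound (((p , n) , m) ∷ q) ρ = begin
    (nat n - nat p) * M + ⟦ neg q ⟧ᵖ ρ   ≡⟨ cong₂ _+_ (cong (_* M) flip) (neg-sound q ρ) ⟩
    - (nat p - nat n) * M + - ⟦ q ⟧ᵖ ρ   ≡⟨ cong (_+ - ⟦ q ⟧ᵖ ρ) (-‿distribˡ-* _ M) ⟨
    - ((nat p - nat n) * M) + - ⟦ q ⟧ᵖ ρ ≡⟨ -‿+-comm _ _ ⟩
    - ((nat p - nat n) * M + ⟦ q ⟧ᵖ ρ)   ∎
    where
      M = ⟦ m ⟧ᵐ ρ
      flip : nat n - nat p ≡ - (nat p - nat n)
      flip = trans (+-comm _ _) (trans (cong (- nat p +_) (sym (-‿involutive _))) (-‿+-comm _ _))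

  one-sound : ∀ ρ → ⟦ one ⟧ᵖ ρ ≡ 1#
  one-sound ρ = trans (+-identityʳ _) (trans (*-identityʳ _) (trans (cong (1# +_) -0#≈0#) (+-identityʳ 1#)))

  pow-sound : ∀ p n ρ → ⟦ pow p n ⟧ᵖ ρ ≡ ⟦ p ⟧ᵖ ρ ^ n
  pow-sound p zero          ρ = one-sound ρ
  pow-sound p (suc zero)    ρ = refl
  pow-sound p (suc (suc n)) ρ = trans (mul-sound p (pow p (suc n)) ρ) (cong (⟦ p ⟧ᵖ ρ *_) (pow-sound p (suc n) ρ))

  unit-sound : ∀ i ρ → ⟦ unit i ⟧ᵐ ρ ≡ lookup ρ i
  unit-sound zero    []      = refl
  unit-sound zero    (x ∷ ρ) = *-identityʳ x
  unit-sound (suc i) []      = refl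
  unit-sound (suc i) (x ∷ ρ) = trans (*-identityˡ _) (unit-sound i ρ)

  Sound : Env → Rule → Set
  Sound ρ (l , r) = ⟦ l ⟧ᵐ ρ ≡ ⟦ r ⟧ᵖ ρ

  findRule-sound : ∀ {ρ rs} → All (Sound ρ) rs → ∀ m {q r} → findRule rs m ≡ just (q , r) →
                   ⟦ m ⟧ᵐ ρ ≡ ⟦ q ⟧ᵐ ρ * ⟦ r ⟧ᵖ ρ
  findRule-sound {ρ} {(l , r) ∷ rs} (h ∷ hs) m eq with dividesM l m
  ... | false = findRule-sound hs m eq
  ... | true with eqM (mulM l (quotM m l)) m in l*q≡ᵇm
  findRule-sound (_ ∷ hs) m eq | true | false = findRule-sound hs m eq
  findRule-sound {ρ} {(l , r) ∷ _} (h ∷ _) m refl | true | true = begin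
    ⟦ m ⟧ᵐ ρ                        ≡⟨ cong (λ m → ⟦ m ⟧ᵐ ρ) (eqM-sound (mulM l (quotM m l)) m l*q≡ᵇm) ⟨
    ⟦ mulM l (quotM m l) ⟧ᵐ ρ       ≡⟨ mulM-sound l (quotM m l) ρ ⟩
    ⟦ l ⟧ᵐ ρ * ⟦ quotM m l ⟧ᵐ ρ     ≡⟨ *-comm _ _ ⟩
    ⟦ quotM m l ⟧ᵐ ρ * ⟦ l ⟧ᵐ ρ     ≡⟨ cong (⟦ quotM m l ⟧ᵐ ρ *_) h ⟩
    ⟦ quotM m l ⟧ᵐ ρ * ⟦ r ⟧ᵖ ρ     ∎

  reduceBy-sound : ∀ {ρ rs again} → (∀ p → ⟦ again p ⟧ᵖ ρ ≡ ⟦ p ⟧ᵖ ρ) → All (Sound ρ) rs →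
                   ∀ p → ⟦ reduceBy again rs p ⟧ᵖ ρ ≡ ⟦ p ⟧ᵖ ρ
  reduceBy-sound ih hs [] = refl
  reduceBy-sound {ρ} {rs} {again} ih hs ((c , m) ∷ p) with findRule rs m in eq
  ... | nothing      = trans (add-sound ((c , m) ∷ []) (reduceBy again rs p) ρ)
                             (cong₂ _+_ (+-identityʳ _) (reduceBy-sound ih hs p))
  ... | just (q , r) = begin
    ⟦ add (again (scale c q r)) (reduceBy again rs p) ⟧ᵖ ρ
      ≡⟨ add-sound (again (scale c q r)) _ ρ ⟩
    ⟦ again (scale c q r) ⟧ᵖ ρ + ⟦ reduceBy again rs p ⟧ᵖ ρ
      ≡⟨ cong₂ _+_ (ih (scale c q r)) (reduceBy-sound ih hs p) ⟩
    ⟦ scale c q r ⟧ᵖ ρ + ⟦ p ⟧ᵖ ρ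
      ≡⟨ cong (_+ ⟦ p ⟧ᵖ ρ) (trans (scale-sound c q r ρ) (trans (*-assoc _ _ _)
           (cong (⟦ c ⟧ᶜ *_) (sym (findRule-sound hs m eq))))) ⟩
    ⟦ c ⟧ᶜ * ⟦ m ⟧ᵐ ρ + ⟦ p ⟧ᵖ ρ ∎

  reduce-sound : ∀ k {ρ rs} → All (Sound ρ) rs → ∀ p → ⟦ reduce k rs p ⟧ᵖ ρ ≡ ⟦ p ⟧ᵖ ρ
  reduce-sound zero    hs p = refl
  reduce-sound (suc k) hs p = reduceBy-sound (reduce-sound k hs) hs p

  norm-sound : ∀ {ρ rs} → All (Sound ρ) rs → ∀ e → ⟦ norm rs e ⟧ᵖ ρ ≡ ⟦ e ⟧ ρ
  norm-sound {ρ} hs (var i) = trans (reduce-sound fuel hs (((1 , 0) , unit i) ∷ []))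
    (trans (+-identityʳ _) (trans (cong₂ _*_ (trans (cong (1# +_) -0#≈0#) (+-identityʳ 1#)) (unit-sound i ρ))
          (*-identityˡ _)))
  norm-sound {ρ} hs (con n) = trans (consC-sound (n , 0) [] [] ρ)
    (trans (+-identityʳ _) (trans (*-identityʳ _) (trans (cong (nat n +_) -0#≈0#) (+-identityʳ _))))
  norm-sound {ρ} {rs} hs (e :+ f) = trans (add-sound (norm rs e) (norm rs f) ρ)
        (cong₂ _+_ (norm-sound hs e) (norm-sound hs f))
  norm-sound {ρ} {rs} hs (e :* f) = trans (reduce-sound fuel hs (mul (norm rs e) (norm rs f)))
    (trans (mul-sound (norm rs e) (norm rs f) ρ) (cong₂ _*_ (norm-sound hs e) (norm-sound hs f)))
  norm-sound {ρ} {rs} hs (:- e)   = trans (neg-sound (norm rs e) ρ) (cong -_ (norm-sound hs e))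
  norm-sound {ρ} {rs} hs (e :^ n) = trans (reduce-sound fuel hs (pow (norm rs e) n))
    (trans (pow-sound (norm rs e) n ρ) (cong (_^ n) (norm-sound hs e)))

  rule-sound : ∀ {ρ} e → ⟦ e ⟧ᵉ ρ → All (Sound ρ) (rule e)
  rule-sound {ρ} (l := r) h with norm [] l | norm-sound {ρ} {[]} [] l
  ... | []                                       | _  = []
  ... | ((0 , _) , m) ∷ _                        | _  = []
  ... | ((suc (suc _) , _) , m) ∷ _              | _  = []
  ... | ((1 , suc _) , m) ∷ _                    | _  = []
  ... | ((1 , 0) , m) ∷ _ ∷ _                    | _  = []
  ... | ((1 , 0) , m) ∷ []                       | eq = (begin
    ⟦ m ⟧ᵐ ρ                              ≡⟨ *-identityˡ _ ⟨
    1# * ⟦ m ⟧ᵐ ρ                         ≡⟨ cong (_* ⟦ m ⟧ᵐ ρ) (trans (cong (1# +_) -0#≈0#) (+-identityʳ 1#)) ⟨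
    (1# - 0#) * ⟦ m ⟧ᵐ ρ                  ≡⟨ +-identityʳ _ ⟨
    (1# - 0#) * ⟦ m ⟧ᵐ ρ + 0#             ≡⟨ eq ⟩
    ⟦ l ⟧ ρ                               ≡⟨ h ⟩
    ⟦ r ⟧ ρ                               ≡⟨ norm-sound [] r ⟨
    ⟦ norm [] r ⟧ᵖ ρ                      ∎) ∷ []

  rules-sound : ∀ {ρ es} → All (λ e → ⟦ e ⟧ᵉ ρ) es → All (Sound ρ) (rules es)
  rules-sound []                   = []
  rules-sound {es = e ∷ _} (h ∷ hs) with rule e | rule-sound e h
  ... | []    | _     = rules-sound hs
  ... | _ ∷ _ | s ∷ _ = s ∷ rules-sound hs

  isZero : Poly → Bool
  isZero []      = true
  isZero (_ ∷ _) = false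

  isZero-sound : ∀ p ρ → T (isZero p) → ⟦ p ⟧ᵖ ρ ≡ 0#
  isZero-sound [] ρ _ = refl

  Exprs : ℕ → Set → Set
  Exprs zero    A = A
  Exprs (suc n) A = Expr → Exprs n A

  applyVars : ∀ {A} n → ℕ → Exprs n A → A
  applyVars zero    i a = a
  applyVars (suc n) i f = applyVars n (suc i) (f (var i))

  module _ {n} (ρ : Vec F n) where

    -- The implicit argument computes to `⊤` once the normal form of the difference is empty, so
    -- type checking performs the whole calculation.
    solveMod : (f : Exprs n Problem) → let open Problem (applyVars n 0 f) in
               All (λ e → ⟦ e ⟧ᵉ (Vec.toList ρ)) hyps →
               {_ : T (isZero (norm (rules hyps) (Equation.lhs goal :- Equation.rhs goal)))} →
               ⟦ goal ⟧ᵉ (Vec.toList ρ)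
    solveMod f hs {z} = x∙y⁻¹≈ε⇒x≈y _ _ (trans (sym (norm-sound (rules-sound hs) (lhs :- rhs)))
                                             (isZero-sound _ (Vec.toList ρ) z))
      where
      open Problem (applyVars n 0 f)
      open Equation goal

    solve : (f : Exprs n Equation) → let open Equation (applyVars n 0 f) in
            {_ : T (isZero (norm [] (lhs :- rhs)))} → ⟦ applyVars n 0 f ⟧ᵉ (Vec.toList ρ)
    solve f {z} = x∙y⁻¹≈ε⇒x≈y _ _ (trans (sym (norm-sound [] (lhs :- rhs))) (isZero-sound _ (Vec.toList ρ) z))
      where open Equation (applyVars n 0 f)

module FieldProperties (𝔽 : Field) where
  open Field 𝔽
  open Solver 𝔽 using (solve; solveMod; con; _:+_; _:*_; :-_; _:-_; _:^_; _:=_; _given_)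

  inverseˡ : ∀ x → x ≢ 0# → x ⁻¹ * x ≡ 1#
  inverseˡ x x≢0 = trans (*-comm _ x) (inverseʳ x x≢0)

  fraction-≡ : ∀ {n₁ n₂ d₁ d₂ i₁ i₂} → d₁ * i₁ ≡ 1# → d₂ * i₂ ≡ 1# → n₁ * d₂ ≡ n₂ * d₁ → n₁ * i₁ ≡ n₂ * i₂
  fraction-≡ {n₁} {n₂} {d₁} {d₂} {i₁} {i₂} h₁ h₂ eq =
    trans (solveMod (n₁ ∷ d₂ ∷ i₁ ∷ i₂ ∷ []) (λ n₁ d₂ i₁ i₂ → n₁ :* i₁ := (n₁ :* d₂) :* (i₁ :* i₂)
          given (d₂ :* i₂ := con 1 ∷ [])) (h₂ ∷ []))
    (trans (cong (_* (i₁ * i₂)) eq)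
      (solveMod (n₂ ∷ d₁ ∷ i₁ ∷ i₂ ∷ []) (λ n₂ d₁ i₁ i₂ → (n₂ :* d₁) :* (i₁ :* i₂) := n₂ :* i₂
            given (d₁ :* i₁ := con 1 ∷ [])) (h₁ ∷ [])))

  divide : ∀ {n x d i} → d * i ≡ 1# → n ≡ x * d → n * i ≡ x
  divide {n} {x} {d} {i} h eq = trans (cong (_* i) eq) (solveMod (x ∷ d ∷ i ∷ []) (λ x d i → x :* d :* i := x
        given (d :* i := con 1 ∷ [])) (h ∷ []))

  *-cancelˡ : ∀ {x y z} → x ≢ 0# → x * y ≡ x * z → y ≡ z
  *-cancelˡ {x} {y} {z} x≢0 eq = trans (sym (divide (inverseʳ x x≢0) (*-comm x y)))
    (trans (cong (_* x ⁻¹) eq) (divide (inverseʳ x x≢0) (*-comm x z)))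

  *-zero : ∀ {x y} → x * y ≡ 0# → x ≢ 0# → y ≡ 0#
  *-zero {x} {y} xy≡0 x≢0 = *-cancelˡ x≢0 (trans xy≡0 (sym (zeroʳ x)))

  *-≢0 : ∀ {x y} → x ≢ 0# → y ≢ 0# → x * y ≢ 0#
  *-≢0 x≢0 y≢0 xy≡0 = y≢0 (*-zero xy≡0 x≢0)

  ≢0-factor : ∀ {x y} → x * y ≡ 1# → x ≢ 0#
  ≢0-factor {x} {y} xy≡1 refl = 1≢0 (trans (sym xy≡1) (zeroˡ y))

  -‿≡0 : ∀ {x y} → x - y ≡ 0# → x ≡ y
  -‿≡0 {x} {y} = x∙y⁻¹≈ε⇒x≈y x y

  ≡⇒-≡0 : ∀ {x y} → x ≡ y → x - y ≡ 0#
  ≡⇒-≡0 {x} refl = -‿inverseʳ x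

  square-≡ : ∀ {x y} → x ^ 2 ≡ y ^ 2 → x ≡ y ⊎ x ≡ - y
  square-≡ {x} {y} eq with x ≟ y
  ... | yes x≡y = inj₁ x≡y
  ... | no  x≢y = inj₂ (-‿≡0 (trans (solve (x ∷ y ∷ []) (λ x y → x :- :- y := x :+ y)) (*-zero
    (solveMod (x ∷ y ∷ []) (λ x y → (x :- y) :* (x :+ y) := con 0 given (x :^ 2 := y :^ 2 ∷ [])) (eq ∷ []))
          (λ z → x≢y (-‿≡0 z)))))

-- The group law on an intersection of two quadrics.

-- The elliptic curve s² + c² = 1, κ s² + d² = 1 with the addition formulas of
-- the Jacobian functions sn, cn, dn; they are complete because κ is no square.
module JacobiGroup (𝔽 : Field) (κ : Field.F 𝔽) (κ-nonsquare : ∀ x → Field._^_ 𝔽 x 2 ≢ κ) where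
  open Field 𝔽
  open Solver 𝔽 using (Exprs; Equation; Problem; applyVars; norm; rules; isZero; ⟦_⟧ᵉ; solve;
        solveMod; con; _:+_; _:*_; :-_; _:-_; _:^_; _:=_; _given_)
  open FieldProperties 𝔽
  open ≡-Reasoning

  -- The two equations are irrelevant, so that equality of points is equality of coordinates
  -- (`J-≡`); `c²` and `d²` get them back because equality in `F` is decidable.
  record J : Set where
    constructor jac
    field
      s c d : F
      .pythagoras-c : c ^ 2 ≡ 1# - s ^ 2
      .pythagoras-d : d ^ 2 ≡ 1# - κ * s ^ 2

  open J public

  c² : ∀ P → c P ^ 2 ≡ 1# - s P ^ 2
  c² (jac s c d eq _) = recompute (_ ≟ _) eq

  d² : ∀ P → d P ^ 2 ≡ 1# - κ * s P ^ 2
  d² (jac s c d _ eq) = recompute (_ ≟ _) eq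

  -- Every `c²` and `d²` is rewritten in terms of `s`, so an identity between functions of three
  -- points is compared on monomials of degree at most 1 in each `c` and `d`.
  by-coordinates : ∀ P Q R (f : Exprs 10 Equation)
    (let g = λ κ s₁ c₁ d₁ s₂ c₂ d₂ s₃ c₃ d₃ → f κ s₁ c₁ d₁ s₂ c₂ d₂ s₃ c₃ d₃ given
               c₁ :^ 2 := con 1 :- s₁ :^ 2 ∷ d₁ :^ 2 := con 1 :- κ :* s₁ :^ 2 ∷
               c₂ :^ 2 := con 1 :- s₂ :^ 2 ∷ d₂ :^ 2 := con 1 :- κ :* s₂ :^ 2 ∷
               c₃ :^ 2 := con 1 :- s₃ :^ 2 ∷ d₃ :^ 2 := con 1 :- κ :* s₃ :^ 2 ∷ []) →
    {_ : T (isZero (norm (rules (Problem.hyps (applyVars 10 0 g)))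
          (Equation.lhs (applyVars 10 0 f) :- Equation.rhs (applyVars 10 0 f))))} →
    ⟦ applyVars 10 0 f ⟧ᵉ (κ ∷ s P ∷ c P ∷ d P ∷ s Q ∷ c Q ∷ d Q ∷ s R ∷ c R ∷ d R ∷ [])
  by-coordinates P Q R f {z} = solveMod (κ ∷ s P ∷ c P ∷ d P ∷ s Q ∷ c Q ∷ d Q ∷ s R ∷ c R ∷ d R ∷ [])
    (λ κ s₁ c₁ d₁ s₂ c₂ d₂ s₃ c₃ d₃ → f κ s₁ c₁ d₁ s₂ c₂ d₂ s₃ c₃ d₃ given
       c₁ :^ 2 := con 1 :- s₁ :^ 2 ∷ d₁ :^ 2 := con 1 :- κ :* s₁ :^ 2 ∷
       c₂ :^ 2 := con 1 :- s₂ :^ 2 ∷ d₂ :^ 2 := con 1 :- κ :* s₂ :^ 2 ∷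
       c₃ :^ 2 := con 1 :- s₃ :^ 2 ∷ d₃ :^ 2 := con 1 :- κ :* s₃ :^ 2 ∷ [])
    (c² P ∷ d² P ∷ c² Q ∷ d² Q ∷ c² R ∷ d² R ∷ []) {z}

  J-≡ : ∀ {P Q} → s P ≡ s Q → c P ≡ c Q → d P ≡ d Q → P ≡ Q
  J-≡ {jac _ _ _ _ _} {jac _ _ _ _ _} refl refl refl = refl

  private
    κx²≢1 : ∀ x → κ * x ^ 2 ≢ 1#
    κx²≢1 x eq = κ-nonsquare (x ⁻¹) (begin
      (x ⁻¹) ^ 2                  ≡⟨ *-identityˡ _ ⟨
      1# * (x ⁻¹) ^ 2             ≡⟨ cong (_* (x ⁻¹) ^ 2) eq ⟨
      κ * x ^ 2 * (x ⁻¹) ^ 2      ≡⟨ solveMod (κ ∷ x ∷ x ⁻¹ ∷ []) (λ κ x y → κ :* x :^ 2 :* y :^ 2 := κ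
            given (x :* y := con 1 ∷ [])) (inverseʳ x x≢0 ∷ []) ⟩
      κ                           ∎)
      where
      x≢0 : x ≢ 0#
      x≢0 refl = 1≢0 (trans (sym eq) (solve (κ ∷ []) (λ κ → κ :* con 0 :^ 2 := con 0)))

  Δ ns nc nd : J → J → F
  Δ  P Q = 1# - κ * s P ^ 2 * s Q ^ 2
  ns P Q = s P * c Q * d Q + s Q * c P * d P
  nc P Q = c P * c Q - s P * s Q * d P * d Q
  nd P Q = d P * d Q - κ * s P * s Q * c P * c Q

  Δ≢0 : ∀ P Q → Δ P Q ≢ 0#
  Δ≢0 P Q Δ≡0 = κx²≢1 (s P * s Q) (sym (-‿≡0 (trans
    (solve (κ ∷ s P ∷ s Q ∷ []) (λ κ x y → con 1 :- κ :* (x :* y) :^ 2 := con 1 :- κ :* x :^ 2 :* y :^ 2)) Δ≡0)))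

  d≢0 : ∀ P → d P ≢ 0#
  d≢0 P d≡0 = κx²≢1 (s P) (sym (-‿≡0 (trans (sym (d² P)) (trans (cong (_^ 2) d≡0) (zeroˡ 0#)))))

  Δ⁻¹ : J → J → F
  Δ⁻¹ P Q = Δ P Q ⁻¹

  Δ-inverse : ∀ P Q → Δ P Q * Δ⁻¹ P Q ≡ 1#
  Δ-inverse P Q = inverseʳ (Δ P Q) (Δ≢0 P Q)

  abstract
    nc² : ∀ P Q → nc P Q ^ 2 ≡ Δ P Q ^ 2 - ns P Q ^ 2
    nc² P Q = by-coordinates P Q P (λ κ s₁ c₁ d₁ s₂ c₂ d₂ _ _ _ → (c₁ :* c₂ :- s₁ :* s₂ :* d₁ :* d₂) :^ 2 :=
          (con 1 :- κ :* s₁ :^ 2 :* s₂ :^ 2) :^ 2 :- (s₁ :* c₂ :* d₂ :+ s₂ :* c₁ :* d₁) :^ 2)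

    nd² : ∀ P Q → nd P Q ^ 2 ≡ Δ P Q ^ 2 - κ * ns P Q ^ 2
    nd² P Q = by-coordinates P Q P (λ κ s₁ c₁ d₁ s₂ c₂ d₂ _ _ _ → (d₁ :* d₂ :- κ :* s₁ :* s₂ :* c₁ :* c₂) :^ 2
          := (con 1 :- κ :* s₁ :^ 2 :* s₂ :^ 2) :^ 2 :- κ :* (s₁ :* c₂ :* d₂ :+ s₂ :* c₁ :* d₁) :^ 2)

    scaled : ∀ {x y δ i} k → δ * i ≡ 1# → x ^ 2 ≡ δ ^ 2 - k * y ^ 2 → (x * i) ^ 2 ≡ 1# - k * (y * i) ^ 2
    scaled {x} {y} {δ} {i} k h eq = solveMod (k ∷ x ∷ y ∷ δ ∷ i ∷ []) (λ k x y δ i → (x :* i) :^ 2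
          := con 1 :- k :* (y :* i) :^ 2 given (x :^ 2 := δ :^ 2 :- k :* y :^ 2 ∷ δ :* i := con 1 ∷ []))
          (eq ∷ h ∷ [])

  infixl 7 _∙_
  _∙_ : J → J → J
  P ∙ Q = jac (ns P Q * Δ⁻¹ P Q) (nc P Q * Δ⁻¹ P Q) (nd P Q * Δ⁻¹ P Q)
    (trans (scaled 1# (Δ-inverse P Q) (trans (nc² P Q) (cong (λ t → Δ P Q ^ 2 - t) (sym (*-identityˡ _)))))
           (cong (λ t → 1# - t) (*-identityˡ _)))
    (scaled κ (Δ-inverse P Q) (nd² P Q))

  ε : J
  ε = jac 0# 1# 1# (solve (κ ∷ []) (λ κ → con 1 :^ 2 := con 1 :- con 0 :^ 2))
        (solve (κ ∷ []) (λ κ → con 1 :^ 2 := con 1 :- κ :* con 0 :^ 2))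

  inv : J → J
  inv P = jac (- s P) (c P) (d P)
    (trans (c² P) (solve (s P ∷ []) (λ x → con 1 :- x :^ 2 := con 1 :- (:- x) :^ 2)))
    (trans (d² P) (solve (κ ∷ s P ∷ []) (λ κ x → con 1 :- κ :* x :^ 2 := con 1 :- κ :* (:- x) :^ 2)))

  ∙-comm : ∀ P Q → P ∙ Q ≡ Q ∙ P
  ∙-comm P Q = J-≡
    (cong₂ _*_ (+-comm _ _) Δ≡)
    (cong₂ _*_ (solve (c P ∷ c Q ∷ d P ∷ d Q ∷ s P ∷ s Q ∷ []) (λ c₁ c₂ d₁ d₂ s₁ s₂ →
          c₁ :* c₂ :- s₁ :* s₂ :* d₁ :* d₂ := c₂ :* c₁ :- s₂ :* s₁ :* d₂ :* d₁)) Δ≡)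
    (cong₂ _*_ (solve (κ ∷ c P ∷ c Q ∷ d P ∷ d Q ∷ s P ∷ s Q ∷ []) (λ κ c₁ c₂ d₁ d₂ s₁ s₂ →
          d₁ :* d₂ :- κ :* s₁ :* s₂ :* c₁ :* c₂ := d₂ :* d₁ :- κ :* s₂ :* s₁ :* c₂ :* c₁)) Δ≡)
    where
    Δ≡ : Δ⁻¹ P Q ≡ Δ⁻¹ Q P
    Δ≡ = cong _⁻¹ (solve (κ ∷ s P ∷ s Q ∷ []) (λ κ s₁ s₂ → con 1 :- κ :* s₁ :^ 2 :* s₂ :^ 2
          := con 1 :- κ :* s₂ :^ 2 :* s₁ :^ 2))

  ∙-by : ∀ P Q {R} → ns P Q ≡ s R * Δ P Q → nc P Q ≡ c R * Δ P Q → nd P Q ≡ d R * Δ P Q → P ∙ Q ≡ R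
  ∙-by P Q ps pc pd = J-≡ (divide (Δ-inverse P Q) ps) (divide (Δ-inverse P Q) pc) (divide (Δ-inverse P Q) pd)

  ∙-identityˡ : ∀ P → ε ∙ P ≡ P
  ∙-identityˡ P = ∙-by ε P
    (solve (κ ∷ s P ∷ c P ∷ d P ∷ []) (λ κ s₁ c₁ d₁ → con 0 :* c₁ :* d₁ :+ s₁ :* con 1 :* con 1
          := s₁ :* (con 1 :- κ :* con 0 :^ 2 :* s₁ :^ 2)))
    (solve (κ ∷ s P ∷ c P ∷ d P ∷ []) (λ κ s₁ c₁ d₁ → con 1 :* c₁ :- con 0 :* s₁ :* con 1 :* d₁
          := c₁ :* (con 1 :- κ :* con 0 :^ 2 :* s₁ :^ 2)))
    (solve (κ ∷ s P ∷ c P ∷ d P ∷ []) (λ κ s₁ c₁ d₁ → con 1 :* d₁ :- κ :* con 0 :* s₁ :* con 1 :* c₁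
          := d₁ :* (con 1 :- κ :* con 0 :^ 2 :* s₁ :^ 2)))

  ∙-inverseˡ : ∀ P → inv P ∙ P ≡ ε
  ∙-inverseˡ P = ∙-by (inv P) P
    (solve (κ ∷ s P ∷ c P ∷ d P ∷ []) (λ κ s₁ c₁ d₁ → :- s₁ :* c₁ :* d₁ :+ s₁ :* c₁ :* d₁
          := con 0 :* (con 1 :- κ :* (:- s₁) :^ 2 :* s₁ :^ 2)))
    (by-coordinates P P P (λ κ s₁ c₁ d₁ _ _ _ _ _ _ → c₁ :* c₁ :- :- s₁ :* s₁ :* d₁ :* d₁
          := con 1 :* (con 1 :- κ :* (:- s₁) :^ 2 :* s₁ :^ 2)))
    (by-coordinates P P P (λ κ s₁ c₁ d₁ _ _ _ _ _ _ → d₁ :* d₁ :- κ :* :- s₁ :* s₁ :* c₁ :* c₁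
          := con 1 :* (con 1 :- κ :* (:- s₁) :^ 2 :* s₁ :^ 2)))

  private
    module Assoc (P Q R : J) where
      s₁ = s P ; c₁ = c P ; d₁ = d P
      s₂ = s Q ; c₂ = c Q ; d₂ = d Q
      s₃ = s R ; c₃ = c R ; d₃ = d R

      -- (P ∙ Q) ∙ R with the inner denominator cleared.
      Δ₃ S₃ C₃ D₃ : J → J → J → F
      Δ₃ P Q R = Δ P Q ^ 2 - κ * ns P Q ^ 2 * s R ^ 2
      S₃ P Q R = ns P Q * Δ P Q * c R * d R + s R * nc P Q * nd P Q
      C₃ P Q R = nc P Q * Δ P Q * c R - ns P Q * s R * nd P Q * d R
      D₃ P Q R = nd P Q * Δ P Q * d R - κ * ns P Q * s R * nc P Q * c R

      den : ∀ P Q R → Δ₃ P Q R * (Δ⁻¹ P Q ^ 2 * Δ⁻¹ (P ∙ Q) R) ≡ 1#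
      den P Q R = trans
        (solveMod (κ ∷ ns P Q ∷ Δ P Q ∷ Δ⁻¹ P Q ∷ Δ⁻¹ (P ∙ Q) R ∷ s R ∷ []) (λ κ n δ i j x →
              (δ :^ 2 :- κ :* n :^ 2 :* x :^ 2) :* (i :^ 2 :* j) := (con 1 :- κ :* (n :* i) :^ 2 :* x :^ 2) :* j
              given (δ :* i := con 1 ∷ [])) (Δ-inverse P Q ∷ []))
        (Δ-inverse (P ∙ Q) R)

      s-lhs : ∀ P Q R → s ((P ∙ Q) ∙ R) ≡ S₃ P Q R * (Δ⁻¹ P Q ^ 2 * Δ⁻¹ (P ∙ Q) R)
      s-lhs P Q R = solveMod (κ ∷ ns P Q ∷ nc P Q ∷ nd P Q ∷ Δ P Q ∷ Δ⁻¹ P Q ∷ Δ⁻¹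
            (P ∙ Q) R ∷ s R ∷ c R ∷ d R ∷ []) (λ κ n a b δ i j x y z →
            (n :* i :* y :* z :+ x :* (a :* i) :* (b :* i)) :* j :=
            (n :* δ :* y :* z :+ x :* a :* b) :* (i :^ 2 :* j) given (δ :* i := con 1 ∷ []))
            (Δ-inverse P Q ∷ [])

      c-lhs : ∀ P Q R → c ((P ∙ Q) ∙ R) ≡ C₃ P Q R * (Δ⁻¹ P Q ^ 2 * Δ⁻¹ (P ∙ Q) R)
      c-lhs P Q R = solveMod (κ ∷ ns P Q ∷ nc P Q ∷ nd P Q ∷ Δ P Q ∷ Δ⁻¹ P Q ∷ Δ⁻¹
            (P ∙ Q) R ∷ s R ∷ c R ∷ d R ∷ []) (λ κ n a b δ i j x y z →
            (a :* i :* y :- n :* i :* x :* (b :* i) :* z) :* j :=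
            (a :* δ :* y :- n :* x :* b :* z) :* (i :^ 2 :* j) given (δ :* i := con 1 ∷ []))
            (Δ-inverse P Q ∷ [])

      d-lhs : ∀ P Q R → d ((P ∙ Q) ∙ R) ≡ D₃ P Q R * (Δ⁻¹ P Q ^ 2 * Δ⁻¹ (P ∙ Q) R)
      d-lhs P Q R = solveMod (κ ∷ ns P Q ∷ nc P Q ∷ nd P Q ∷ Δ P Q ∷ Δ⁻¹ P Q ∷ Δ⁻¹
            (P ∙ Q) R ∷ s R ∷ c R ∷ d R ∷ []) (λ κ n a b δ i j x y z →
            (b :* i :* z :- κ :* (n :* i) :* x :* (a :* i) :* y) :* j :=
            (b :* δ :* z :- κ :* n :* x :* a :* y) :* (i :^ 2 :* j) given (δ :* i := con 1 ∷ []))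
            (Δ-inverse P Q ∷ [])

      s-eq : S₃ P Q R * Δ₃ R Q P ≡ S₃ R Q P * Δ₃ P Q R
      s-eq = by-coordinates P Q R (λ κ s₁ c₁ d₁ s₂ c₂ d₂ s₃ c₃ d₃ →
            let δ = con 1 :- κ :* s₁ :^ 2 :* s₂ :^ 2
                n = s₁ :* c₂ :* d₂ :+ s₂ :* c₁ :* d₁
                a = c₁ :* c₂ :- s₁ :* s₂ :* d₁ :* d₂
                b = d₁ :* d₂ :- κ :* s₁ :* s₂ :* c₁ :* c₂
                δ′ = con 1 :- κ :* s₃ :^ 2 :* s₂ :^ 2
                n′ = s₃ :* c₂ :* d₂ :+ s₂ :* c₃ :* d₃
                a′ = c₃ :* c₂ :- s₃ :* s₂ :* d₃ :* d₂
                b′ = d₃ :* d₂ :- κ :* s₃ :* s₂ :* c₃ :* c₂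
            in (n :* δ :* c₃ :* d₃ :+ s₃ :* a :* b) :* (δ′ :^ 2 :- κ :* n′ :^ 2 :* s₁ :^ 2) :=
            (n′ :* δ′ :* c₁ :* d₁ :+ s₁ :* a′ :* b′) :* (δ :^ 2 :- κ :* n :^ 2 :* s₃ :^ 2))

      c-eq : C₃ P Q R * Δ₃ R Q P ≡ C₃ R Q P * Δ₃ P Q R
      c-eq = by-coordinates P Q R (λ κ s₁ c₁ d₁ s₂ c₂ d₂ s₃ c₃ d₃ →
            let δ = con 1 :- κ :* s₁ :^ 2 :* s₂ :^ 2
                n = s₁ :* c₂ :* d₂ :+ s₂ :* c₁ :* d₁
                a = c₁ :* c₂ :- s₁ :* s₂ :* d₁ :* d₂
                b = d₁ :* d₂ :- κ :* s₁ :* s₂ :* c₁ :* c₂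
                δ′ = con 1 :- κ :* s₃ :^ 2 :* s₂ :^ 2
                n′ = s₃ :* c₂ :* d₂ :+ s₂ :* c₃ :* d₃
                a′ = c₃ :* c₂ :- s₃ :* s₂ :* d₃ :* d₂
                b′ = d₃ :* d₂ :- κ :* s₃ :* s₂ :* c₃ :* c₂
            in (a :* δ :* c₃ :- n :* s₃ :* b :* d₃) :* (δ′ :^ 2 :- κ :* n′ :^ 2 :* s₁ :^ 2) :=
            (a′ :* δ′ :* c₁ :- n′ :* s₁ :* b′ :* d₁) :* (δ :^ 2 :- κ :* n :^ 2 :* s₃ :^ 2))

      d-eq : D₃ P Q R * Δ₃ R Q P ≡ D₃ R Q P * Δ₃ P Q R
      d-eq = by-coordinates P Q R (λ κ s₁ c₁ d₁ s₂ c₂ d₂ s₃ c₃ d₃ →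
            let δ = con 1 :- κ :* s₁ :^ 2 :* s₂ :^ 2
                n = s₁ :* c₂ :* d₂ :+ s₂ :* c₁ :* d₁
                a = c₁ :* c₂ :- s₁ :* s₂ :* d₁ :* d₂
                b = d₁ :* d₂ :- κ :* s₁ :* s₂ :* c₁ :* c₂
                δ′ = con 1 :- κ :* s₃ :^ 2 :* s₂ :^ 2
                n′ = s₃ :* c₂ :* d₂ :+ s₂ :* c₃ :* d₃
                a′ = c₃ :* c₂ :- s₃ :* s₂ :* d₃ :* d₂
                b′ = d₃ :* d₂ :- κ :* s₃ :* s₂ :* c₃ :* c₂
            in (b :* δ :* d₃ :- κ :* n :* s₃ :* a :* c₃) :* (δ′ :^ 2 :- κ :* n′ :^ 2 :* s₁ :^ 2) :=
            (b′ :* δ′ :* d₁ :- κ :* n′ :* s₁ :* a′ :* c₁) :* (δ :^ 2 :- κ :* n :^ 2 :* s₃ :^ 2))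

      -- Up to commutativity this is associativity, but both sides have the shape `(P ∙ Q) ∙ R`, so
      -- one set of cleared denominators serves for both.
      rotate : (P ∙ Q) ∙ R ≡ (R ∙ Q) ∙ P
      rotate = J-≡
        (trans (s-lhs P Q R) (trans (fraction-≡ (den P Q R) (den R Q P) s-eq) (sym (s-lhs R Q P))))
        (trans (c-lhs P Q R) (trans (fraction-≡ (den P Q R) (den R Q P) c-eq) (sym (c-lhs R Q P))))
        (trans (d-lhs P Q R) (trans (fraction-≡ (den P Q R) (den R Q P) d-eq) (sym (d-lhs R Q P))))

  ∙-assoc : ∀ P Q R → (P ∙ Q) ∙ R ≡ P ∙ (Q ∙ R)
  ∙-assoc P Q R = begin
    (P ∙ Q) ∙ R  ≡⟨ Assoc.rotate P Q R ⟩
    (R ∙ Q) ∙ P  ≡⟨ ∙-comm (R ∙ Q) P ⟩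
    P ∙ (R ∙ Q)  ≡⟨ cong (P ∙_) (∙-comm R Q) ⟩
    P ∙ (Q ∙ R)  ∎

  isAbelianGroup : IsAbelianGroup _≡_ _∙_ ε inv
  isAbelianGroup = record
    { isGroup = record
      { isMonoid = record
        { isSemigroup = record
          { isMagma = record { isEquivalence = isEquivalence ; ∙-cong = cong₂ _∙_ }
          ; assoc   = ∙-assoc }
        ; identity = ∙-identityˡ , (λ P → trans (∙-comm P ε) (∙-identityˡ P)) }
      ; inverse = ∙-inverseˡ , (λ P → trans (∙-comm P (inv P)) (∙-inverseˡ P))
      ; ⁻¹-cong = cong inv }
    ; comm = ∙-comm }

  abelianGroup : AbelianGroup 0ℓ 0ℓ
  abelianGroup = record { isAbelianGroup = isAbelianGroup }

  -- Here and in `d-unique`: `c (P ∙ Q)` and `d (P ∙ Q)` solve a linear system of determinant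
  -- `Δ P Q`, and `Δ` never vanishes. This is Cramer's rule, used to recognise a sum without
  -- handling its fractions.
  c-unique : ∀ P Q {x y} → x + s P * s Q * y ≡ c P * c Q → y + κ * s P * s Q * x ≡ d P * d Q → x ≡ c (P ∙ Q)
  c-unique P Q {x} {y} h₁ h₂ = sym (divide (Δ-inverse P Q) (trans
    (cong₂ (λ u v → u - v) (sym h₁)
          (trans (solve (s P ∷ s Q ∷ d P ∷ d Q ∷ []) (λ a b u v → a :* b :* u :* v := a :* b :* (u :* v)))
          (cong (s P * s Q *_) (sym h₂))))
    (solve (κ ∷ x ∷ y ∷ s P ∷ s Q ∷ []) (λ κ x y a b → x :+ a :* b :* y :- a :* b :* (y :+ κ :* a :* b :* x)
          := x :* (con 1 :- κ :* a :^ 2 :* b :^ 2)))))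

  d-unique : ∀ P Q {x y} → x + s P * s Q * y ≡ c P * c Q → y + κ * s P * s Q * x ≡ d P * d Q → y ≡ d (P ∙ Q)
  d-unique P Q {x} {y} h₁ h₂ = sym (divide (Δ-inverse P Q) (trans
    (cong₂ (λ u v → u - v) (sym h₂)
          (trans (solve (κ ∷ s P ∷ s Q ∷ c P ∷ c Q ∷ []) (λ κ a b u v → κ :* a :* b :* u :* v
          := κ :* a :* b :* (u :* v))) (cong (κ * s P * s Q *_) (sym h₁))))
    (solve (κ ∷ x ∷ y ∷ s P ∷ s Q ∷ [])
          (λ κ x y a b → y :+ κ :* a :* b :* x :- κ :* a :* b :* (x :+ a :* b :* y)
          := y :* (con 1 :- κ :* a :^ 2 :* b :^ 2)))))

  -- Given the `c` coordinates, this determines `s (P ∙ Q)` whenever `s Q` is non-zero, since `d P`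
  -- is never zero.
  c-recover : ∀ P Q → c P ≡ c Q * c (P ∙ Q) + s Q * d P * s (P ∙ Q)
  c-recover P Q = trans
    (sym (divide (Δ-inverse P Q) (sym
          (by-coordinates P Q P (λ κ s₁ c₁ d₁ s₂ c₂ d₂ _ _ _ → c₁ :* (con 1 :- κ :* s₁ :^ 2 :* s₂ :^ 2)
          := c₂ :* (c₁ :* c₂ :- s₁ :* s₂ :* d₁ :* d₂) :+ s₂ :* d₁ :* (s₁ :* c₂ :* d₂ :+ s₂ :* c₁ :* d₁))))))
    (solve (c Q ∷ s Q ∷ d P ∷ nc P Q ∷ ns P Q ∷ Δ⁻¹ P Q ∷ []) (λ x y z a b i → (x :* a :+ y :* z :* b) :* i
          := x :* (a :* i) :+ y :* z :* (b :* i)))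

  -- The classical formula for `sn (u + v) sn (u − v)`: the product of the two numerators is itself
  -- divisible by `Δ`, so only one factor `Δ` survives.
  sum-difference : ∀ P Q → s (P ∙ Q) * s (P ∙ inv Q) * Δ P Q ≡ s P ^ 2 - s Q ^ 2
  sum-difference P Q = begin
    s (P ∙ Q) * s (P ∙ inv Q) * Δ P Q
      ≡⟨ cong (λ t → s (P ∙ Q) * (ns P (inv Q) * t) * Δ P Q) (cong _⁻¹ Δ≡) ⟩
    ns P Q * Δ⁻¹ P Q * (ns P (inv Q) * Δ⁻¹ P Q) * Δ P Q
      ≡⟨ solveMod (ns P Q ∷ ns P (inv Q) ∷ Δ⁻¹ P Q ∷ Δ P Q ∷ []) (λ n m i δ → n :* i :* (m :* i) :* δ
            := n :* m :* i given (δ :* i := con 1 ∷ [])) (Δ-inverse P Q ∷ []) ⟩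
    ns P Q * ns P (inv Q) * Δ⁻¹ P Q
      ≡⟨ divide (Δ-inverse P Q) (by-coordinates P Q P (λ κ s₁ c₁ d₁ s₂ c₂ d₂ _ _ _ →
            (s₁ :* c₂ :* d₂ :+ s₂ :* c₁ :* d₁) :* (s₁ :* c₂ :* d₂ :+ :- s₂ :* c₁ :* d₁) :=
            (s₁ :^ 2 :- s₂ :^ 2) :* (con 1 :- κ :* s₁ :^ 2 :* s₂ :^ 2))) ⟩
    s P ^ 2 - s Q ^ 2 ∎
    where
    Δ≡ : Δ P (inv Q) ≡ Δ P Q
    Δ≡ = solve (κ ∷ s P ∷ s Q ∷ []) (λ κ x y → con 1 :- κ :* x :^ 2 :* (:- y) :^ 2 := con 1 :- κ :* x :^ 2 :* y :^ 2)

  -- The tripling formula of `sn`, obtained from the cleared form of `(P ∙ P) ∙ P` by eliminating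
  -- `c` and `d`.
  triple : ∀ P → s (P ∙ (P ∙ P)) *
        (1# - nat 6 * κ * s P ^ 4 + nat 4 * κ * (1# + κ) * s P ^ 6 - nat 3 * κ ^ 2 * s P ^ 8)
               ≡ s P * (nat 3 - nat 4 * (1# + κ) * s P ^ 2 + nat 6 * κ * s P ^ 4 - κ ^ 2 * s P ^ 8)
  triple P = trans (cong (λ Q → s Q * den₃) (∙-comm P (P ∙ P))) (trans (cong (_* den₃) (Assoc.s-lhs P P P P P P))
    (trans (cong₂ (λ u v → u * (Δ⁻¹ P P ^ 2 * Δ⁻¹ (P ∙ P) P) * v) num-eq den-eq)
      (solveMod (s P ∷ num₃ ∷ Δ⁻¹ P P ^ 2 * Δ⁻¹ (P ∙ P) P ∷ Assoc.Δ₃ P P P P P P ∷ [])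
            (λ x m i e → x :* m :* i :* e := x :* m given (e :* i := con 1 ∷ []))
            (Assoc.den P P P P P P ∷ []))))
    where
    den₃ num₃ : F
    den₃ = 1# - nat 6 * κ * s P ^ 4 + nat 4 * κ * (1# + κ) * s P ^ 6 - nat 3 * κ ^ 2 * s P ^ 8
    num₃ = nat 3 - nat 4 * (1# + κ) * s P ^ 2 + nat 6 * κ * s P ^ 4 - κ ^ 2 * s P ^ 8
    num-eq : Assoc.S₃ P P P P P P ≡ s P * num₃
    num-eq = by-coordinates P P P (λ κ x y z _ _ _ _ _ _ →
          (x :* y :* z :+ x :* y :* z) :* (con 1 :- κ :* x :^ 2 :* x :^ 2) :* y :* z :+ x :*
          (y :* y :- x :* x :* z :* z) :* (z :* z :- κ :* x :* x :* y :* y)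
          := x :* (con 3 :- con 4 :* (con 1 :+ κ) :* x :^ 2 :+ con 6 :* κ :* x :^ 4 :- κ :^ 2 :* x :^ 8))
    den-eq : den₃ ≡ Assoc.Δ₃ P P P P P P
    den-eq = by-coordinates P P P (λ κ x y z _ _ _ _ _ _ →
          con 1 :- con 6 :* κ :* x :^ 4 :+ con 4 :* κ :* (con 1 :+ κ) :* x :^ 6 :- con 3 :* κ :^ 2 :* x :^ 8 :=
          (con 1 :- κ :* x :^ 2 :* x :^ 2) :^ 2 :- κ :* (x :* y :* z :+ x :* y :* z) :^ 2 :* x :^ 2)

-- The Legendre form, and lines that meet it in three points.

-- The projection of JacobiGroup from one of its 2-torsion points is the
-- Legendre curve Y² = X (X − 1) (X − κ).
module Legendre (𝔽 : Field) (κ : Field.F 𝔽) (κ-nonsquare : ∀ x → Field._^_ 𝔽 x 2 ≢ κ)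
                (2≢0 : Field.nat 𝔽 2 ≢ Field.0# 𝔽) where
  open Field 𝔽
  open Solver 𝔽 using (solve; solveMod; con; _:+_; _:*_; :-_; _:-_; _:^_; _:=_; _given_)
  open FieldProperties 𝔽
  open JacobiGroup 𝔽 κ κ-nonsquare
  open ≡-Reasoning

  cubic : F → F
  cubic X = X ^ 3 - (1# + κ) * X ^ 2 + κ * X

  -- The inverse of the projection is `(2 Y / δ , C / δ , D / δ)`. As `κ` is no square,
  -- `δ X = κ − X²` never vanishes, so the formula holds at every affine point.
  δ C D : F → F
  δ X = κ - X ^ 2
  C X = nat 2 * X - X ^ 2 - κ
  D X = nat 2 * κ * X - X ^ 2 - κ

  δ≢0 : ∀ X → δ X ≢ 0#
  δ≢0 X δ≡0 = κ-nonsquare X (sym (-‿≡0 δ≡0))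

  δ⁻¹ : F → F
  δ⁻¹ X = δ X ⁻¹

  δ-inverse : ∀ X → δ X * δ⁻¹ X ≡ 1#
  δ-inverse X = inverseʳ (δ X) (δ≢0 X)

  abstract
    φ-c² : ∀ X Y → Y ^ 2 ≡ cubic X → (C X * δ⁻¹ X) ^ 2 ≡ 1# - (nat 2 * Y * δ⁻¹ X) ^ 2
    φ-c² X Y eq = trans (scaled 1# (δ-inverse X)
          (solveMod (κ ∷ X ∷ Y ∷ []) (λ κ X Y → (con 2 :* X :- X :^ 2 :- κ) :^ 2 :=
          (κ :- X :^ 2) :^ 2 :- con 1 :* (con 2 :* Y) :^ 2
          given (Y :^ 2 := X :^ 3 :- (con 1 :+ κ) :* X :^ 2 :+ κ :* X ∷ [])) (eq ∷ [])))
          (cong (λ t → 1# - t) (*-identityˡ _))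

    φ-d² : ∀ X Y → Y ^ 2 ≡ cubic X → (D X * δ⁻¹ X) ^ 2 ≡ 1# - κ * (nat 2 * Y * δ⁻¹ X) ^ 2
    φ-d² X Y eq = scaled κ (δ-inverse X)
          (solveMod (κ ∷ X ∷ Y ∷ []) (λ κ X Y → (con 2 :* κ :* X :- X :^ 2 :- κ) :^ 2 :=
          (κ :- X :^ 2) :^ 2 :- κ :* (con 2 :* Y) :^ 2
          given (Y :^ 2 := X :^ 3 :- (con 1 :+ κ) :* X :^ 2 :+ κ :* X ∷ [])) (eq ∷ []))

  φ : ∀ X Y → .(Y ^ 2 ≡ cubic X) → J
  φ X Y eq = jac (nat 2 * Y * δ⁻¹ X) (C X * δ⁻¹ X) (D X * δ⁻¹ X) (φ-c² X Y eq) (φ-d² X Y eq)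

  φ-cong : ∀ {X Y X′ Y′} .{p : Y ^ 2 ≡ cubic X} .{q : Y′ ^ 2 ≡ cubic X′} → X ≡ X′ → Y ≡ Y′ → φ X Y p ≡ φ X′ Y′ q
  φ-cong refl refl = refl

  φ-neg : ∀ {X Y} .{p : Y ^ 2 ≡ cubic X} .{q : (- Y) ^ 2 ≡ cubic X} → φ X (- Y) q ≡ inv (φ X Y p)
  φ-neg {X} {Y} = J-≡ (solve (Y ∷ δ⁻¹ X ∷ []) (λ Y i → con 2 :* :- Y :* i := :- (con 2 :* Y :* i))) refl refl

  κ≢0 : κ ≢ 0#
  κ≢0 κ≡0 = κ-nonsquare 0# (trans (zeroˡ 0#) (sym κ≡0))

  κ≢1 : κ - 1# ≢ 0#
  κ≢1 κ-1≡0 = κ-nonsquare 1# (trans (*-identityˡ 1#) (sym (-‿≡0 κ-1≡0)))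

  private
    times-δ : ∀ X {u} → u * δ⁻¹ X * δ X ≡ u
    times-δ X {u} = solveMod (u ∷ δ X ∷ δ⁻¹ X ∷ []) (λ u e i → u :* i :* e := u given (e :* i := con 1 ∷ []))
          (δ-inverse X ∷ [])

    double≡0 : ∀ {x} → nat 2 * x ≡ 0# → x ≡ 0#
    double≡0 eq = *-zero eq 2≢0

  -- The value `c = 1` forces `X = κ` and `d = 1` forces `X = 1`, while `κ` differs from 0 and 1.
  φ≢ε : ∀ {X Y} .{p : Y ^ 2 ≡ cubic X} → φ X Y p ≢ ε
  φ≢ε {X} {Y} eq = *-≢0 κ≢0 κ≢1 (begin
    κ * (κ - 1#)   ≡⟨ cong (λ t → κ * (t - 1#)) X≡κ ⟨
    κ * (X - 1#)   ≡⟨ double≡0 (trans (solve (κ ∷ X ∷ []) (λ κ X → con 2 :* (κ :* (X :- con 1)) :=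
          (con 2 :* κ :* X :- X :^ 2 :- κ) :- (κ :- X :^ 2))) (≡⇒-≡0 D≡δ)) ⟩
    0#             ∎)
    where
    C≡δ : C X ≡ δ X
    C≡δ = trans (sym (times-δ X)) (trans (cong (_* δ X) (cong c eq)) (*-identityˡ _))
    D≡δ : D X ≡ δ X
    D≡δ = trans (sym (times-δ X)) (trans (cong (_* δ X) (cong d eq)) (*-identityˡ _))
    X≡κ : X ≡ κ
    X≡κ = -‿≡0 (double≡0 (trans (solve (κ ∷ X ∷ []) (λ κ X → con 2 :* (X :- κ) :=
          (con 2 :* X :- X :^ 2 :- κ) :- (κ :- X :^ 2))) (≡⇒-≡0 C≡δ)))

  -- `slope` is linear in `X`, with leading coefficient the difference of the `c` and `d`
  -- coordinates, so these determine `X` unless they agree; they agree only for `X = 0`. Then `s`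
  -- determines `Y`.
  φ-injective : ∀ {X Y X′ Y′} .{p : Y ^ 2 ≡ cubic X} .{q : Y′ ^ 2 ≡ cubic X′} →
                φ X Y p ≡ φ X′ Y′ q → X ≡ X′ × Y ≡ Y′
  φ-injective {X} {Y} {X′} {Y′} eq = X≡X′ , Y≡Y′
    where
    slope : ∀ X → (C X * δ⁻¹ X + 1#) * (κ - X) ≡ (D X * δ⁻¹ X + 1#) * (1# - X)
    slope X = solveMod (κ ∷ X ∷ δ⁻¹ X ∷ []) (λ κ X i → ((con 2 :* X :- X :^ 2 :- κ) :* i :+ con 1) :* (κ :- X)
          := ((con 2 :* κ :* X :- X :^ 2 :- κ) :* i :+ con 1) :* (con 1 :- X)
          given (X :^ 2 :* i := κ :* i :- con 1 ∷ [])) (X²δ⁻¹ ∷ [])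
      where
      X²δ⁻¹ : X ^ 2 * δ⁻¹ X ≡ κ * δ⁻¹ X - 1#
      X²δ⁻¹ = trans (solve (κ ∷ X ∷ δ⁻¹ X ∷ []) (λ κ X i → X :^ 2 :* i := κ :* i :- (κ :- X :^ 2) :* i))
            (cong (λ t → κ * δ⁻¹ X - t) (δ-inverse X))
    u v : F
    u = C X′ * δ⁻¹ X′
    v = D X′ * δ⁻¹ X′
    slope′ : (u + 1#) * (κ - X) ≡ (v + 1#) * (1# - X)
    slope′ = subst₂ (λ u v → (u + 1#) * (κ - X) ≡ (v + 1#) * (1# - X)) (cong c eq) (cong d eq) (slope X)
    difference : (u - v) * (X - X′) ≡ 0#
    difference = begin
      (u - v) * (X - X′)
        ≡⟨ solve (κ ∷ u ∷ v ∷ X ∷ X′ ∷ []) (λ κ u v x y → (u :- v) :* (x :- y) :=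
              ((u :+ con 1) :* (κ :- y) :- (v :+ con 1) :* (con 1 :- y)) :-
              ((u :+ con 1) :* (κ :- x) :- (v :+ con 1) :* (con 1 :- x))) ⟩
      ((u + 1#) * (κ - X′) - (v + 1#) * (1# - X′)) - ((u + 1#) * (κ - X) - (v + 1#) * (1# - X))
        ≡⟨ cong₂ _-_ (≡⇒-≡0 (slope X′)) (≡⇒-≡0 slope′) ⟩
      0# - 0#
        ≡⟨ -‿inverseʳ 0# ⟩
      0# ∎
    vanish : ∀ X → C X * δ⁻¹ X ≡ D X * δ⁻¹ X → X ≡ 0#
    vanish X eq = *-zero {κ - 1#} (double≡0 (begin
      nat 2 * ((κ - 1#) * X)            ≡⟨ solve (κ ∷ X ∷ []) (λ κ X → con 2 :* ((κ :- con 1) :* X) :=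
            (con 2 :* κ :* X :- X :^ 2 :- κ) :- (con 2 :* X :- X :^ 2 :- κ)) ⟩
      D X - C X                         ≡⟨ cong₂ _-_ (times-δ X) (times-δ X) ⟨
      D X * δ⁻¹ X * δ X - C X * δ⁻¹ X * δ X ≡⟨ ≡⇒-≡0 (cong (_* δ X) (sym eq)) ⟩
      0#                                ∎)) κ≢1
    X≡X′ : X ≡ X′
    X≡X′ = by-cases (u ≟ v)
      where
      by-cases : Dec (u ≡ v) → X ≡ X′
      by-cases (no  u≢v) = -‿≡0 (*-zero difference (λ u-v≡0 → u≢v (-‿≡0 u-v≡0)))
      by-cases (yes u≡v) = trans (vanish X (trans (cong c eq) (trans u≡v (sym (cong d eq))))) (sym (vanish X′ u≡v))
    Y≡Y′ : Y ≡ Y′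
    Y≡Y′ = *-cancelˡ 2≢0 (begin
      nat 2 * Y                      ≡⟨ times-δ X ⟨
      nat 2 * Y * δ⁻¹ X * δ X        ≡⟨ cong (_* δ X) (cong s eq) ⟩
      nat 2 * Y′ * δ⁻¹ X′ * δ X      ≡⟨ cong (λ t → nat 2 * Y′ * δ⁻¹ X′ * δ t) X≡X′ ⟩
      nat 2 * Y′ * δ⁻¹ X′ * δ X′     ≡⟨ times-δ X′ ⟩
      nat 2 * Y′                     ∎)

  -- X₁, X₂, X₃ are the abscissas of the intersection with the line Y = l X + n.
  record Collinear (l n X₁ X₂ X₃ : F) : Set where
    field
      e₁ : X₁ + X₂ + X₃ ≡ l ^ 2 + 1# + κ
      e₂ : X₁ * X₂ + X₁ * X₃ + X₂ * X₃ ≡ κ - nat 2 * l * n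
      e₃ : X₁ * X₂ * X₃ ≡ n ^ 2

  rotate : ∀ {l n X₁ X₂ X₃} → Collinear l n X₁ X₂ X₃ → Collinear l n X₂ X₃ X₁
  rotate {X₁ = X₁} {X₂} {X₃} col = record
    { e₁ = trans (solve (X₁ ∷ X₂ ∷ X₃ ∷ []) (λ x y z → y :+ z :+ x := x :+ y :+ z)) e₁
    ; e₂ = trans (solve (X₁ ∷ X₂ ∷ X₃ ∷ []) (λ x y z → y :* z :+ y :* x :+ z :* x := x :* y :+ x :* z :+ y :* z)) e₂
    ; e₃ = trans (solve (X₁ ∷ X₂ ∷ X₃ ∷ []) (λ x y z → y :* z :* x := x :* y :* z)) e₃ }
    where open Collinear col

  swap : ∀ {l n X₁ X₂ X₃} → Collinear l n X₁ X₂ X₃ → Collinear l n X₂ X₁ X₃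
  swap {X₁ = X₁} {X₂} {X₃} col = record
    { e₁ = trans (solve (X₁ ∷ X₂ ∷ X₃ ∷ []) (λ x y z → y :+ x :+ z := x :+ y :+ z)) e₁
    ; e₂ = trans (solve (X₁ ∷ X₂ ∷ X₃ ∷ []) (λ x y z → y :* x :+ y :* z :+ x :* z := x :* y :+ x :* z :+ y :* z)) e₂
    ; e₃ = trans (solve (X₁ ∷ X₂ ∷ X₃ ∷ []) (λ x y z → y :* x :* z := x :* y :* z)) e₃ }
    where open Collinear col

  module _ {l n X₁ X₂ X₃ : F} (col : Collinear l n X₁ X₂ X₃) where
    open Collinear col

    private
      l² : l ^ 2 ≡ X₁ + X₂ + X₃ - 1# - κ
      l² = trans (solve (κ ∷ l ∷ []) (λ κ l → l :^ 2 := l :^ 2 :+ con 1 :+ κ :- con 1 :- κ))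
            (cong (λ t → t - 1# - κ) (sym e₁))
      2ln : nat 2 * l * n ≡ κ - (X₁ * X₂ + X₁ * X₃ + X₂ * X₃)
      2ln = trans (solve (κ ∷ nat 2 * l * n ∷ []) (λ κ x → x := κ :- (κ :- x))) (cong (λ t → κ - t) (sym e₂))
      -- The discriminant relation 4 l² n² = (2 l n)².
      κ² : κ ^ 2 ≡ nat 2 * κ * (X₁ * X₂ + X₁ * X₃ + X₂ * X₃) - (X₁ * X₂ + X₁ * X₃ + X₂ * X₃) ^ 2
                 + nat 4 * (X₁ + X₂ + X₃ - 1# - κ) * (X₁ * X₂ * X₃)
      κ² = begin
        κ ^ 2                                               ≡⟨
              solve (κ ∷ e ∷ []) (λ κ e → κ :^ 2 := con 2 :* κ :* e :- e :^ 2 :+ (κ :- e) :^ 2) ⟩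
        nat 2 * κ * e - e ^ 2 + (κ - e) ^ 2                 ≡⟨ cong (λ t → nat 2 * κ * e - e ^ 2 + t ^ 2) 2ln ⟨
        nat 2 * κ * e - e ^ 2 + (nat 2 * l * n) ^ 2         ≡⟨
              solve (κ ∷ e ∷ l ∷ n ∷ []) (λ κ e l n → con 2 :* κ :* e :- e :^ 2 :+ (con 2 :* l :* n) :^ 2
              := con 2 :* κ :* e :- e :^ 2 :+ con 4 :* l :^ 2 :* n :^ 2) ⟩
        nat 2 * κ * e - e ^ 2 + nat 4 * l ^ 2 * n ^ 2       ≡⟨
              cong₂ (λ u v → nat 2 * κ * e - e ^ 2 + nat 4 * u * v) l² (sym e₃) ⟩
        nat 2 * κ * e - e ^ 2 + nat 4 * (X₁ + X₂ + X₃ - 1# - κ) * (X₁ * X₂ * X₃) ∎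
        where e = X₁ * X₂ + X₁ * X₃ + X₂ * X₃

      4YY : nat 4 * (l * X₁ + n) * (l * X₂ + n) ≡
            nat 4 * (X₁ + X₂ + X₃ - 1# - κ) * (X₁ * X₂) + nat 2 * (κ - (X₁ * X₂ + X₁ * X₃ + X₂ * X₃)) *
                  (X₁ + X₂) + nat 4 * (X₁ * X₂ * X₃)
      4YY = trans
        (solve (l ∷ n ∷ X₁ ∷ X₂ ∷ []) (λ l n x y → con 4 :* (l :* x :+ n) :* (l :* y :+ n)
              := con 4 :* l :^ 2 :* (x :* y) :+ con 2 :* (con 2 :* l :* n) :* (x :+ y) :+ con 4 :* n :^ 2))
        (trans (cong₂ (λ u v → nat 4 * u * (X₁ * X₂) + nat 2 * v * (X₁ + X₂) + nat 4 * n ^ 2) l² 2ln)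
               (cong (λ t → nat 4 * (X₁ + X₂ + X₃ - 1# - κ) * (X₁ * X₂) + nat 2 *
                     (κ - (X₁ * X₂ + X₁ * X₃ + X₂ * X₃)) * (X₁ + X₂) + nat 4 * t) (sym e₃)))

    -- Since `c` and `d` depend on `X` alone, they agree at the third point of the line and at its
    -- negative, the sum. This lemma and `collinear-D` are the hypotheses of `c-unique` with
    -- denominators cleared; the line is eliminated through `l²`, `2ln`, `e₃` and `κ²`.
    collinear-C : C X₃ * (δ X₁ * δ X₂) + nat 4 * (l * X₁ + n) * (l * X₂ + n) * D X₃ ≡ C X₁ * C X₂ * δ X₃
    collinear-C = trans (cong (λ t → C X₃ * (δ X₁ * δ X₂) + t * D X₃) 4YY)
      (solveMod (κ ∷ X₁ ∷ X₂ ∷ X₃ ∷ []) (λ κ x y z →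
            (con 2 :* z :- z :^ 2 :- κ) :* ((κ :- x :^ 2) :* (κ :- y :^ 2)) :+
            (con 4 :* (x :+ y :+ z :- con 1 :- κ) :* (x :* y) :+ con 2 :* (κ :- (x :* y :+ x :* z :+ y :* z)) :*
            (x :+ y) :+ con 4 :* (x :* y :* z)) :* (con 2 :* κ :* z :- z :^ 2 :- κ) :=
            (con 2 :* x :- x :^ 2 :- κ) :* (con 2 :* y :- y :^ 2 :- κ) :* (κ :- z :^ 2)
            given (κ :^ 2 := con 2 :* κ :* (x :* y :+ x :* z :+ y :* z) :- (x :* y :+ x :* z :+ y :* z) :^ 2
            :+ con 4 :* (x :+ y :+ z :- con 1 :- κ) :* (x :* y :* z) ∷ [])) (κ² ∷ []))

    collinear-D : D X₃ * (δ X₁ * δ X₂) + κ * (nat 4 * (l * X₁ + n) * (l * X₂ + n)) * C X₃ ≡ D X₁ * D X₂ * δ X₃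
    collinear-D = trans (cong (λ t → D X₃ * (δ X₁ * δ X₂) + κ * t * C X₃) 4YY)
      (solveMod (κ ∷ X₁ ∷ X₂ ∷ X₃ ∷ []) (λ κ x y z →
            (con 2 :* κ :* z :- z :^ 2 :- κ) :* ((κ :- x :^ 2) :* (κ :- y :^ 2)) :+ κ :*
            (con 4 :* (x :+ y :+ z :- con 1 :- κ) :* (x :* y) :+ con 2 :* (κ :- (x :* y :+ x :* z :+ y :* z)) :*
            (x :+ y) :+ con 4 :* (x :* y :* z)) :* (con 2 :* z :- z :^ 2 :- κ) :=
            (con 2 :* κ :* x :- x :^ 2 :- κ) :* (con 2 :* κ :* y :- y :^ 2 :- κ) :* (κ :- z :^ 2)
            given (κ :^ 2 := con 2 :* κ :* (x :* y :+ x :* z :+ y :* z) :- (x :* y :+ x :* z :+ y :* z) :^ 2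
            :+ con 4 :* (x :+ y :+ z :- con 1 :- κ) :* (x :* y :* z) ∷ [])) (κ² ∷ []))

    on-curve : (l * X₃ + n) ^ 2 ≡ cubic X₃
    on-curve = sym (-‿≡0 (trans
      (solve (κ ∷ l ∷ n ∷ X₃ ∷ []) (λ κ l n z → z :^ 3 :- (con 1 :+ κ) :* z :^ 2 :+ κ :* z :- (l :* z :+ n) :^ 2
            := z :^ 3 :- (l :^ 2 :+ con 1 :+ κ) :* z :^ 2 :+ (κ :- con 2 :* l :* n) :* z :- n :^ 2))
      (trans (cong₂ (λ u v → X₃ ^ 3 - u * X₃ ^ 2 + v * X₃ - n ^ 2) (sym e₁) (sym e₂))
      (trans (cong (λ t → X₃ ^ 3 - (X₁ + X₂ + X₃) * X₃ ^ 2 + (X₁ * X₂ + X₁ * X₃ + X₂ * X₃) * X₃ - t) (sym e₃))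
        (solve (X₁ ∷ X₂ ∷ X₃ ∷ []) (λ x y z →
              z :^ 3 :- (x :+ y :+ z) :* z :^ 2 :+ (x :* y :+ x :* z :+ y :* z) :* z :- x :* y :* z
              := con 0))))))

  module _ {l n X₁ X₂ X₃ Y₁ Y₂ : F} (col : Collinear l n X₁ X₂ X₃) (line₁ : Y₁ ≡ l * X₁ + n)
        (line₂ : Y₂ ≡ l * X₂ + n) where

    φ-C : C X₃ * δ⁻¹ X₃ + nat 2 * Y₁ * δ⁻¹ X₁ * (nat 2 * Y₂ * δ⁻¹ X₂) * (D X₃ * δ⁻¹ X₃) ≡
          C X₁ * δ⁻¹ X₁ * (C X₂ * δ⁻¹ X₂)
    φ-C = begin
      C X₃ * i₃ + nat 2 * Y₁ * i₁ * (nat 2 * Y₂ * i₂) * (D X₃ * i₃)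
        ≡⟨ solveMod (κ ∷ i₁ ∷ i₂ ∷ i₃ ∷ δ X₁ ∷ δ X₂ ∷ C X₃ ∷ D X₃ ∷ Y₁ ∷ Y₂ ∷ []) (λ κ i j k d e x y z w →
              x :* k :+ con 2 :* z :* i :* (con 2 :* w :* j) :* (y :* k) :=
              (x :* (d :* e) :+ con 4 :* z :* w :* y) :* (i :* j :* k)
              given (d :* i := con 1 ∷ e :* j := con 1 ∷ [])) (δ-inverse X₁ ∷ δ-inverse X₂ ∷ []) ⟩
      (C X₃ * (δ X₁ * δ X₂) + nat 4 * Y₁ * Y₂ * D X₃) * (i₁ * i₂ * i₃)
        ≡⟨ cong (_* (i₁ * i₂ * i₃)) (trans
              (cong₂ (λ u v → C X₃ * (δ X₁ * δ X₂) + nat 4 * u * v * D X₃) line₁ line₂) (collinear-C col)) ⟩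
      C X₁ * C X₂ * δ X₃ * (i₁ * i₂ * i₃)
        ≡⟨ solveMod (i₁ ∷ i₂ ∷ i₃ ∷ δ X₃ ∷ C X₁ ∷ C X₂ ∷ []) (λ i j k d x y → x :* y :* d :* (i :* j :* k)
              := x :* i :* (y :* j) given (d :* k := con 1 ∷ [])) (δ-inverse X₃ ∷ []) ⟩
      C X₁ * i₁ * (C X₂ * i₂) ∎
      where i₁ = δ⁻¹ X₁ ; i₂ = δ⁻¹ X₂ ; i₃ = δ⁻¹ X₃

    φ-D : D X₃ * δ⁻¹ X₃ + κ * (nat 2 * Y₁ * δ⁻¹ X₁) * (nat 2 * Y₂ * δ⁻¹ X₂) * (C X₃ * δ⁻¹ X₃) ≡
          D X₁ * δ⁻¹ X₁ * (D X₂ * δ⁻¹ X₂)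
    φ-D = begin
      D X₃ * i₃ + κ * (nat 2 * Y₁ * i₁) * (nat 2 * Y₂ * i₂) * (C X₃ * i₃)
        ≡⟨ solveMod (κ ∷ i₁ ∷ i₂ ∷ i₃ ∷ δ X₁ ∷ δ X₂ ∷ D X₃ ∷ C X₃ ∷ Y₁ ∷ Y₂ ∷ []) (λ κ i j k d e x y z w →
              x :* k :+ κ :* (con 2 :* z :* i) :* (con 2 :* w :* j) :* (y :* k) :=
              (x :* (d :* e) :+ κ :* (con 4 :* z :* w) :* y) :* (i :* j :* k)
              given (d :* i := con 1 ∷ e :* j := con 1 ∷ [])) (δ-inverse X₁ ∷ δ-inverse X₂ ∷ []) ⟩
      (D X₃ * (δ X₁ * δ X₂) + κ * (nat 4 * Y₁ * Y₂) * C X₃) * (i₁ * i₂ * i₃)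
        ≡⟨ cong (_* (i₁ * i₂ * i₃)) (trans
              (cong₂ (λ u v → D X₃ * (δ X₁ * δ X₂) + κ * (nat 4 * u * v) * C X₃) line₁ line₂) (collinear-D col))
              ⟩
      D X₁ * D X₂ * δ X₃ * (i₁ * i₂ * i₃)
        ≡⟨ solveMod (i₁ ∷ i₂ ∷ i₃ ∷ δ X₃ ∷ D X₁ ∷ D X₂ ∷ []) (λ i j k d x y → x :* y :* d :* (i :* j :* k)
              := x :* i :* (y :* j) given (d :* k := con 1 ∷ [])) (δ-inverse X₃ ∷ []) ⟩
      D X₁ * i₁ * (D X₂ * i₂) ∎
      where i₁ = δ⁻¹ X₁ ; i₂ = δ⁻¹ X₂ ; i₃ = δ⁻¹ X₃

  -- The coordinates `c` and `d` come from the linear system. For `s` the line is read cyclically,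
  -- each point being the negative of the sum of the other two, and a factor `s` of one summand is
  -- cancelled. If both summands are 2-torsion there is none to cancel, and the last hypothesis
  -- steps in.
  φ-line : ∀ {l n X₁ X₂ X₃ Y₁ Y₂ Y₃} (p₁ : Y₁ ^ 2 ≡ cubic X₁) (p₂ : Y₂ ^ 2 ≡ cubic X₂) (p₃ : Y₃ ^ 2 ≡ cubic X₃) →
           Collinear l n X₁ X₂ X₃ → Y₁ ≡ l * X₁ + n → Y₂ ≡ l * X₂ + n → - Y₃ ≡ l * X₃ + n →
           (Y₁ ≡ 0# → Y₂ ≡ 0# → Y₃ ≡ 0#) →
           φ X₃ Y₃ p₃ ≡ φ X₁ Y₁ p₁ ∙ φ X₂ Y₂ p₂
  φ-line {l} {n} {X₁} {X₂} {X₃} {Y₁} {Y₂} {Y₃} p₁ p₂ p₃ col line₁ line₂ line₃ 2-torsion = J-≡ s-eq c-eq d-eq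
    where
    P₁ P₂ P₃ : J
    P₁ = φ X₁ Y₁ p₁
    P₂ = φ X₂ Y₂ p₂
    P₃ = φ X₃ Y₃ p₃
    c-eq : c P₃ ≡ c (P₁ ∙ P₂)
    c-eq = c-unique P₁ P₂ (φ-C col line₁ line₂) (φ-D col line₁ line₂)
    d-eq : d P₃ ≡ d (P₁ ∙ P₂)
    d-eq = d-unique P₁ P₂ (φ-C col line₁ line₂) (φ-D col line₁ line₂)

    recover : ∀ P Q R → c P ≡ c Q * c R + s Q * d P * s R → c P ≡ c Q * c (P ∙ Q) + s Q * d P * s (P ∙ Q) →
              c R ≡ c (P ∙ Q) → s Q ≢ 0# → s R ≡ s (P ∙ Q)
    recover P Q R h h′ c≡ s≢0 = *-cancelˡ (*-≢0 s≢0 (d≢0 P)) (begin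
      s Q * d P * s R            ≡⟨ solve (s Q * d P * s R ∷ c Q * c R ∷ []) (λ x y → x := (y :+ x) :- y) ⟩
      c Q * c R + s Q * d P * s R - c Q * c R   ≡⟨ cong₂ _-_ (trans (sym h) h′) (cong (c Q *_) c≡) ⟩
      c Q * c (P ∙ Q) + s Q * d P * s (P ∙ Q) - c Q * c (P ∙ Q)   ≡⟨
            (solve (s Q * d P * s (P ∙ Q) ∷ c Q * c (P ∙ Q) ∷ []) (λ x y → x := (y :+ x) :- y)) ⟨
      s Q * d P * s (P ∙ Q) ∎)

    c₁-eq : c P₁ ≡ c P₂ * c P₃ + s P₂ * d P₁ * s P₃
    c₁-eq = begin
      c P₁ ≡⟨ solve (c P₁ ∷ s P₂ ∷ d P₁ ∷ Y₃ ∷ δ⁻¹ X₃ ∷ []) (λ a x b y i → a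
            := a :+ x :* (con 2 :* :- y :* i) :* b :+ x :* b :* (con 2 :* y :* i)) ⟩
      c P₁ + s P₂ * (nat 2 * - Y₃ * δ⁻¹ X₃) * d P₁ + s P₂ * d P₁ * s P₃
            ≡⟨ cong (_+ s P₂ * d P₁ * s P₃) (φ-C (rotate col) line₂ line₃) ⟩
      c P₂ * c P₃ + s P₂ * d P₁ * s P₃ ∎

    c₂-eq : c P₂ ≡ c P₁ * c P₃ + s P₁ * d P₂ * s P₃
    c₂-eq = begin
      c P₂ ≡⟨ solve (c P₂ ∷ s P₁ ∷ d P₂ ∷ Y₃ ∷ δ⁻¹ X₃ ∷ []) (λ a x b y i → a
            := a :+ x :* (con 2 :* :- y :* i) :* b :+ x :* b :* (con 2 :* y :* i)) ⟩
      c P₂ + s P₁ * (nat 2 * - Y₃ * δ⁻¹ X₃) * d P₂ + s P₁ * d P₂ * s P₃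
            ≡⟨ cong (_+ s P₁ * d P₂ * s P₃) (φ-C (rotate (swap col)) line₁ line₃) ⟩
      c P₁ * c P₃ + s P₁ * d P₂ * s P₃ ∎

    s≡0⇒Y≡0 : ∀ {X Y} → nat 2 * Y * δ⁻¹ X ≡ 0# → Y ≡ 0#
    s≡0⇒Y≡0 {X} {Y} eq = double≡0 (trans (sym (times-δ X)) (trans (cong (_* δ X) eq) (zeroˡ _)))

    s-eq : s P₃ ≡ s (P₁ ∙ P₂)
    s-eq = by-cases (s P₁ ≟ 0#) (s P₂ ≟ 0#)
      where
      by-cases : Dec (s P₁ ≡ 0#) → Dec (s P₂ ≡ 0#) → s P₃ ≡ s (P₁ ∙ P₂)
      by-cases _ (no s₂≢0) = recover P₁ P₂ P₃ c₁-eq (c-recover P₁ P₂) c-eq s₂≢0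
      by-cases (no s₁≢0) _ = trans
        (recover P₂ P₁ P₃ c₂-eq (c-recover P₂ P₁) (trans c-eq (cong c (∙-comm P₁ P₂))) s₁≢0) (cong s (∙-comm P₂ P₁))
      by-cases (yes s₁≡0) (yes s₂≡0) = begin
        nat 2 * Y₃ * δ⁻¹ X₃   ≡⟨ cong (λ t → nat 2 * t * δ⁻¹ X₃) (2-torsion (s≡0⇒Y≡0 s₁≡0) (s≡0⇒Y≡0 s₂≡0)) ⟩
        nat 2 * 0# * δ⁻¹ X₃   ≡⟨ solve (δ⁻¹ X₃ ∷ c P₁ ∷ d P₁ ∷ c P₂ ∷ d P₂ ∷ Δ⁻¹ P₁ P₂ ∷ [])
              (λ x a b e f i → con 2 :* con 0 :* x := (con 0 :* e :* f :+ con 0 :* a :* b) :* i) ⟩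
        (0# * c P₂ * d P₂ + 0# * c P₁ * d P₁) * Δ⁻¹ P₁ P₂
          ≡⟨ cong₂ (λ x y → (x * c P₂ * d P₂ + y * c P₁ * d P₁) * Δ⁻¹ P₁ P₂) s₁≡0 s₂≡0 ⟨
        ns P₁ P₂ * Δ⁻¹ P₁ P₂ ∎

  -- Both abscissas are roots of `cubic X − (l X + n)²`. The difference of the two root equations,
  -- divided by `X₂ − X₁`, is `e₂`; the root equation at `X₁` then gives `e₃`.
  chord-collinear : ∀ {l X₁ X₂ Y₁ Y₂} → Y₁ ^ 2 ≡ cubic X₁ → Y₂ ^ 2 ≡ cubic X₂ → X₂ - X₁ ≢ 0# → l * (X₂ - X₁) ≡
        Y₂ - Y₁ →
                    Collinear l (Y₁ - l * X₁) X₁ X₂ (l ^ 2 + 1# + κ - X₁ - X₂)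
  chord-collinear {l} {X₁} {X₂} {Y₁} {Y₂} p₁ p₂ X₁≢X₂ slope = record
    { e₁ = solve (κ ∷ l ∷ X₁ ∷ X₂ ∷ []) (λ κ l x y → x :+ y :+ (l :^ 2 :+ con 1 :+ κ :- x :- y)
          := l :^ 2 :+ con 1 :+ κ)
    ; e₂ = e₂
    ; e₃ = -‿≡0 (begin
        X₁ * X₂ * (l ^ 2 + 1# + κ - X₁ - X₂) - n ^ 2
          ≡⟨ solve (κ ∷ l ∷ X₁ ∷ X₂ ∷ n ∷ [])
                (λ κ l x y n → x :* y :* (l :^ 2 :+ con 1 :+ κ :- x :- y) :- n :^ 2
                := x :^ 3 :- (con 1 :+ κ) :* x :^ 2 :+ κ :* x :- (l :* x :+ n) :^ 2 :+
                (x :* y :+ x :* (l :^ 2 :+ con 1 :+ κ :- x :- y) :+ y :* (l :^ 2 :+ con 1 :+ κ :- x :- y) :-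
                (κ :- con 2 :* l :* n)) :* x) ⟩
        cubic X₁ - (l * X₁ + n) ^ 2 + (X₁ * X₂ + X₁ * X₃ + X₂ * X₃ - (κ - nat 2 * l * n)) * X₁
          ≡⟨ cong₂ (λ u v → u + v * X₁) (≡⇒-≡0 root₁) (≡⇒-≡0 e₂) ⟩
        0# + 0# * X₁
          ≡⟨ solve (X₁ ∷ []) (λ x → con 0 :+ con 0 :* x := con 0) ⟩
        0# ∎) }
    where
    n = Y₁ - l * X₁
    X₃ = l ^ 2 + 1# + κ - X₁ - X₂
    root₁ : cubic X₁ ≡ (l * X₁ + n) ^ 2
    root₁ = trans (sym p₁) (solve (l ∷ X₁ ∷ Y₁ ∷ []) (λ l x y → y :^ 2 := (l :* x :+ (y :- l :* x)) :^ 2))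
    root₂ : cubic X₂ ≡ (l * X₂ + n) ^ 2
    root₂ = trans (sym p₂) (trans (cong (_^ 2)
          (trans (solve (Y₁ ∷ Y₂ ∷ []) (λ a b → b := (b :- a) :+ a)) (cong (_+ Y₁) (sym slope))))
      (solve (l ∷ X₁ ∷ X₂ ∷ Y₁ ∷ []) (λ l x z y → (l :* (z :- x) :+ y) :^ 2 := (l :* z :+ (y :- l :* x)) :^ 2)))
    e₂ : X₁ * X₂ + X₁ * X₃ + X₂ * X₃ ≡ κ - nat 2 * l * n
    e₂ = sym (-‿≡0 (*-zero (begin
      (X₂ - X₁) * (κ - nat 2 * l * n - (X₁ * X₂ + X₁ * X₃ + X₂ * X₃))
        ≡⟨ solve (κ ∷ l ∷ X₁ ∷ X₂ ∷ n ∷ []) (λ κ l x y n →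
              (y :- x) :* (κ :- con 2 :* l :* n :-
              (x :* y :+ x :* (l :^ 2 :+ con 1 :+ κ :- x :- y) :+ y :* (l :^ 2 :+ con 1 :+ κ :- x :- y))) :=
              (y :^ 3 :- (con 1 :+ κ) :* y :^ 2 :+ κ :* y :- (l :* y :+ n) :^ 2) :-
              (x :^ 3 :- (con 1 :+ κ) :* x :^ 2 :+ κ :* x :- (l :* x :+ n) :^ 2)) ⟩
      (cubic X₂ - (l * X₂ + n) ^ 2) - (cubic X₁ - (l * X₁ + n) ^ 2)
        ≡⟨ cong₂ _-_ (≡⇒-≡0 root₂) (≡⇒-≡0 root₁) ⟩
      0# - 0#   ≡⟨ -‿inverseʳ 0# ⟩
      0# ∎) X₁≢X₂))

  -- The slope condition says that the derivative of `cubic X − (l X + n)²` vanishes too, which is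
  -- `e₂` for a double root.
  tangent-collinear : ∀ {l X Y} → Y ^ 2 ≡ cubic X → l * (nat 2 * Y) ≡ nat 3 * X ^ 2 - nat 2 * (1# + κ) * X + κ →
                      Collinear l (Y - l * X) X X (l ^ 2 + 1# + κ - X - X)
  tangent-collinear {l} {X} {Y} p slope = record
    { e₁ = solve (κ ∷ l ∷ X ∷ []) (λ κ l x → x :+ x :+ (l :^ 2 :+ con 1 :+ κ :- x :- x) := l :^ 2 :+ con 1 :+ κ)
    ; e₂ = sym (begin
        κ - nat 2 * l * (Y - l * X)
          ≡⟨ solve (κ ∷ l ∷ X ∷ Y ∷ []) (λ κ l x y → κ :- con 2 :* l :* (y :- l :* x)
                := κ :- l :* (con 2 :* y) :+ con 2 :* l :^ 2 :* x) ⟩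
        κ - l * (nat 2 * Y) + nat 2 * l ^ 2 * X
          ≡⟨ cong (λ t → κ - t + nat 2 * l ^ 2 * X) slope ⟩
        κ - (nat 3 * X ^ 2 - nat 2 * (1# + κ) * X + κ) + nat 2 * l ^ 2 * X
          ≡⟨ solve (κ ∷ l ∷ X ∷ []) (λ κ l x →
                κ :- (con 3 :* x :^ 2 :- con 2 :* (con 1 :+ κ) :* x :+ κ) :+ con 2 :* l :^ 2 :* x
                := x :* x :+ x :* (l :^ 2 :+ con 1 :+ κ :- x :- x) :+ x :* (l :^ 2 :+ con 1 :+ κ :- x :- x)) ⟩
        X * X + X * (l ^ 2 + 1# + κ - X - X) + X * (l ^ 2 + 1# + κ - X - X) ∎)
    ; e₃ = sym (begin
        (Y - l * X) ^ 2
          ≡⟨ solveMod (κ ∷ l ∷ X ∷ Y ∷ []) (λ κ l x y → (y :- l :* x) :^ 2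
                := x :^ 3 :- (con 1 :+ κ) :* x :^ 2 :+ κ :* x :- l :* (con 2 :* y) :* x :+ l :^ 2 :* x :^ 2
                given (y :^ 2 := x :^ 3 :- (con 1 :+ κ) :* x :^ 2 :+ κ :* x ∷ [])) (p ∷ []) ⟩
        cubic X - l * (nat 2 * Y) * X + l ^ 2 * X ^ 2
          ≡⟨ cong (λ t → cubic X - t * X + l ^ 2 * X ^ 2) slope ⟩
        cubic X - (nat 3 * X ^ 2 - nat 2 * (1# + κ) * X + κ) * X + l ^ 2 * X ^ 2
          ≡⟨ solve (κ ∷ l ∷ X ∷ []) (λ κ l x →
                x :^ 3 :- (con 1 :+ κ) :* x :^ 2 :+ κ :* x :-
                (con 3 :* x :^ 2 :- con 2 :* (con 1 :+ κ) :* x :+ κ) :* x :+ l :^ 2 :* x :^ 2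
                := x :* x :* (l :^ 2 :+ con 1 :+ κ :- x :- x)) ⟩
        X * X * (l ^ 2 + 1# + κ - X - X) ∎) }

-- The chord-tangent law and its injective homomorphism into the Jacobi form.

-- The induced curve and its chord-tangent law over an arbitrary field.
module ChordTangent (𝔽 : Field) (a b c : Field.F 𝔽) where
  open Field 𝔽

  A B C : F
  A = a * b * c
  B = a * b + a * c + b * c
  C = a + b + c

  data Point : Set where
    ∞   : Point
    aff : F → F → Point

  OnCurve : Point → Set
  OnCurve ∞         = ⊤
  OnCurve (aff x y) = y * y ≡ (a * x + 1#) * (b * x + 1#) * (c * x + 1#)

  chord : F → F → F → F → Point
  chord l x₁ y₁ x₂ =
    let x₃ = (l * l - B) * A ⁻¹ - x₁ - x₂
        n  = y₁ - l * x₁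
    in aff x₃ (- (l * x₃ + n))

  -- The two decisions are arguments, so that `addAffine-sum` can match on them directly.
  addAffine : ∀ x₁ y₁ x₂ y₂ → Dec (x₁ ≡ x₂) → Dec (y₁ ≡ - y₂) → Point
  addAffine x₁ y₁ x₂ y₂ (no _)  _       = chord ((y₂ - y₁) * (x₂ - x₁) ⁻¹) x₁ y₁ x₂
  addAffine x₁ y₁ x₂ y₂ (yes _) (yes _) = ∞
  addAffine x₁ y₁ x₂ y₂ (yes _) (no _)  =
    chord ((nat 3 * A * x₁ * x₁ + nat 2 * B * x₁ + C) * (nat 2 * y₁) ⁻¹) x₁ y₁ x₂

  infixl 6 _⊕_
  _⊕_ : Point → Point → Point
  ∞         ⊕ Q         = Q
  aff x₁ y₁ ⊕ ∞         = aff x₁ y₁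
  aff x₁ y₁ ⊕ aff x₂ y₂ = addAffine x₁ y₁ x₂ y₂ (x₁ ≟ x₂) (y₁ ≟ (- y₂))

  infixl 8 _·ᴾ_
  _·ᴾ_ : ℕ → Point → Point
  zero  ·ᴾ P = ∞
  suc n ·ᴾ P = P ⊕ (n ·ᴾ P)

-- For i = 1/m with m² = ac − ab, the substitution X = (abc x + ac) i²,
-- Y = abc y i³ turns y² = (ax+1)(bx+1)(cx+1) into Legendre form.
module Uniformization (𝔽 : Field) (a b c i κ : Field.F 𝔽)
    (κ-nonsquare : ∀ x → Field._^_ 𝔽 x 2 ≢ κ)
    (2≢0 : Field.nat 𝔽 2 ≢ Field.0# 𝔽)
    (abc≢0 : Field._*_ 𝔽 (Field._*_ 𝔽 a b) c ≢ Field.0# 𝔽)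
    (scale : Field._*_ 𝔽 (Field._^_ 𝔽 i 2) (Field._-_ 𝔽 (Field._*_ 𝔽 a c) (Field._*_ 𝔽 a b)) ≡ Field.1# 𝔽)
    (κ-def : κ ≡ Field._*_ 𝔽 (Field._^_ 𝔽 i 2) (Field._-_ 𝔽 (Field._*_ 𝔽 a c) (Field._*_ 𝔽 b c))) where
  open Field 𝔽
  open Solver 𝔽 using (solve; solveMod; con; _:+_; _:*_; :-_; _:-_; _:^_; _:=_; _given_)
  open FieldProperties 𝔽
  open JacobiGroup 𝔽 κ κ-nonsquare using (J; _∙_; ε; inv; ∙-comm; ∙-identityˡ; ∙-inverseˡ)
  open Legendre 𝔽 κ κ-nonsquare 2≢0 hiding (C)
  open ChordTangent 𝔽 a b c
  open ≡-Reasoning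

  toX toY : F → F
  toX x = (A * x + a * c) * i ^ 2
  toY y = A * y * i ^ 3

  private
    i²ac : i ^ 2 * (a * c) ≡ 1# + i ^ 2 * (a * b)
    i²ac = trans (solve (a ∷ b ∷ c ∷ i ∷ []) (λ a b c i → i :^ 2 :* (a :* c)
          := i :^ 2 :* (a :* c :- a :* b) :+ i :^ 2 :* (a :* b))) (cong (_+ i ^ 2 * (a * b)) scale)

    i≢0 : i ≢ 0#
    i≢0 refl = 1≢0 (trans (sym scale) (solve (a * c - a * b ∷ []) (λ x → con 0 :^ 2 :* x := con 0)))

    A*x₃ : ∀ l x₁ x₂ → A * ((l * l - B) * A ⁻¹ - x₁ - x₂) ≡ l * l - B - A * x₁ - A * x₂
    A*x₃ l x₁ x₂ = solveMod (A ∷ B ∷ l ∷ x₁ ∷ x₂ ∷ A ⁻¹ ∷ [])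
          (λ A e l x y j → A :* ((l :* l :- e) :* j :- x :- y) := l :* l :- e :- A :* x :- A :* y
          given (A :* j := con 1 ∷ [])) (inverseʳ A abc≢0 ∷ [])

  abstract
    -- Multiplied by `b c`, `a c` and `a b`, the three linear factors become `abc x + bc`,
    -- `abc x + ac` and `abc x + ab`; scaled by `i²` these are `X − κ`, `X` and `X − 1`.
    toLegendre : ∀ {x y} → OnCurve (aff x y) → toY y ^ 2 ≡ cubic (toX x)
    toLegendre {x} {y} on = trans (solveMod (a ∷ b ∷ c ∷ i ∷ x ∷ y ∷ []) (λ a b c i x y →
          (a :* b :* c :* y :* i :^ 3) :^ 2 :=
          ((a :* b :* c) :^ 2 :* ((a :* x :+ con 1) :* (b :* x :+ con 1) :* (c :* x :+ con 1))) :* i :^ 6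
          given (y :* y := (a :* x :+ con 1) :* (b :* x :+ con 1) :* (c :* x :+ con 1) ∷ [])) (on ∷ []))
      (solveMod (a ∷ b ∷ c ∷ i ∷ x ∷ κ ∷ []) (λ a b c i x κ →
            let X = (a :* b :* c :* x :+ a :* c) :* i :^ 2
            in ((a :* b :* c) :^ 2 :* ((a :* x :+ con 1) :* (b :* x :+ con 1) :* (c :* x :+ con 1))) :* i :^ 6
            := X :^ 3 :- (con 1 :+ κ) :* X :^ 2 :+ κ :* X
            given (i :^ 2 :* (a :* c) := con 1 :+ i :^ 2 :* (a :* b) ∷ κ := i :^ 2 :* (a :* c :- b :* c) ∷ []))
            (i²ac ∷ κ-def ∷ []))

    fromLegendre : ∀ {x y} → toY y ^ 2 ≡ cubic (toX x) → OnCurve (aff x y)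
    fromLegendre {x} {y} on = *-cancelˡ (*-≢0 (*-≢0 abc≢0 abc≢0) (i≢0′)) (begin
      A * A * i ^ 6 * (y * y)
        ≡⟨ solve (A ∷ y ∷ i ∷ []) (λ A y i → A :* A :* i :^ 6 :* (y :* y) := (A :* y :* i :^ 3) :^ 2) ⟩
      toY y ^ 2
        ≡⟨ on ⟩
      cubic (toX x)
        ≡⟨ solveMod (a ∷ b ∷ c ∷ i ∷ x ∷ κ ∷ []) (λ a b c i x κ →
              let X = (a :* b :* c :* x :+ a :* c) :* i :^ 2
              in X :^ 3 :- (con 1 :+ κ) :* X :^ 2 :+ κ :* X
              := a :* b :* c :* (a :* b :* c) :* i :^ 6 :*
              ((a :* x :+ con 1) :* (b :* x :+ con 1) :* (c :* x :+ con 1))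
              given (i :^ 2 :* (a :* c) := con 1 :+ i :^ 2 :* (a :* b) ∷ κ
              := i :^ 2 :* (a :* c :- b :* c) ∷ [])) (i²ac ∷ κ-def ∷ []) ⟩
      A * A * i ^ 6 * ((a * x + 1#) * (b * x + 1#) * (c * x + 1#)) ∎)
      where
      i≢0′ : i ^ 6 ≢ 0#
      i≢0′ = *-≢0 i≢0 (*-≢0 i≢0 (*-≢0 i≢0 (*-≢0 i≢0 (*-≢0 i≢0 i≢0))))

  Φ : ∀ P → .(OnCurve P) → J
  Φ ∞         _  = ε
  Φ (aff x y) on = φ (toX x) (toY y) (toLegendre on)

  Φ-injective : ∀ P Q .(p : OnCurve P) .(q : OnCurve Q) → Φ P p ≡ Φ Q q → P ≡ Q
  Φ-injective ∞           ∞           _ _ _  = refl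
  Φ-injective ∞           (aff x y)   _ q eq = ⊥-elim (φ≢ε {p = toLegendre q} (sym eq))
  Φ-injective (aff x y)   ∞           p _ eq = ⊥-elim (φ≢ε {p = toLegendre p} eq)
  Φ-injective (aff x y)   (aff x′ y′) p q eq = cong₂ aff x≡x′ y≡y′
    where
    X≡X′ : toX x ≡ toX x′
    X≡X′ = proj₁ (φ-injective {p = toLegendre p} {q = toLegendre q} eq)
    Y≡Y′ : toY y ≡ toY y′
    Y≡Y′ = proj₂ (φ-injective {p = toLegendre p} {q = toLegendre q} eq)
    x≡x′ : x ≡ x′
    x≡x′ = *-cancelˡ (*-≢0 abc≢0 (*-≢0 i≢0 i≢0)) (begin
      A * (i * i) * x          ≡⟨ solve (A ∷ a * c ∷ i ∷ x ∷ []) (λ A e i x → A :* (i :* i) :* x :=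
            (A :* x :+ e) :* i :^ 2 :- e :* i :^ 2) ⟩
      toX x - a * c * i ^ 2    ≡⟨ cong (_- a * c * i ^ 2) X≡X′ ⟩
      toX x′ - a * c * i ^ 2   ≡⟨ (solve (A ∷ a * c ∷ i ∷ x′ ∷ []) (λ A e i x → A :* (i :* i) :* x :=
            (A :* x :+ e) :* i :^ 2 :- e :* i :^ 2)) ⟨
      A * (i * i) * x′         ∎)
    y≡y′ : y ≡ y′
    y≡y′ = *-cancelˡ (*-≢0 abc≢0 (*-≢0 i≢0 (*-≢0 i≢0 i≢0))) (begin
      A * (i * (i * i)) * y    ≡⟨ solve (A ∷ i ∷ y ∷ []) (λ A i y → A :* (i :* (i :* i)) :* y := A :* y :* i :^ 3) ⟩
      toY y                    ≡⟨ Y≡Y′ ⟩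
      toY y′                   ≡⟨ (solve (A ∷ i ∷ y′ ∷ []) (λ A i y → A :* (i :* (i :* i)) :* y
            := A :* y :* i :^ 3)) ⟨
      A * (i * (i * i)) * y′   ∎)

  IsSum : (P Q R : Point) → .(OnCurve P) → .(OnCurve Q) → Set
  IsSum P Q R p q = Σ (OnCurve R) λ r → Φ R r ≡ Φ P p ∙ Φ Q q

  -- As `X` carries `i²` and `Y` carries `i³`, the slope `l` turns into `l i`. The last hypothesis
  -- makes the line horizontal when both points are 2-torsion, as `φ-line` demands.
  chord-sum : ∀ l x₁ y₁ x₂ y₂ (p : OnCurve (aff x₁ y₁)) (q : OnCurve (aff x₂ y₂)) →
              Collinear (l * i) (toY y₁ - l * i * toX x₁) (toX x₁) (toX x₂) ((l * i) ^ 2 + 1# + κ - toX x₁ - toX x₂) →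
              l * (x₂ - x₁) ≡ y₂ - y₁ → (y₁ ≡ 0# → y₂ ≡ 0# → l ≡ 0#) →
              IsSum (aff x₁ y₁) (aff x₂ y₂) (chord l x₁ y₁ x₂) p q
  chord-sum l x₁ y₁ x₂ y₂ p q col slope vertical = on₃ , φ-line (toLegendre p) (toLegendre q) (toLegendre on₃)
      (subst (Collinear (l * i) N X₁ X₂) (sym X₃≡) col) line₁ line₂ line₃ 2-torsion
    where
    X₁ X₂ Y₁ Y₂ N x₃ y₃ : F
    X₁ = toX x₁
    X₂ = toX x₂
    Y₁ = toY y₁
    Y₂ = toY y₂
    N  = Y₁ - l * i * X₁
    x₃ = (l * l - B) * A ⁻¹ - x₁ - x₂
    y₃ = - (l * x₃ + (y₁ - l * x₁))
    X₃≡ : toX x₃ ≡ (l * i) ^ 2 + 1# + κ - X₁ - X₂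
    X₃≡ = trans (cong (λ t → (t + a * c) * i ^ 2) (A*x₃ l x₁ x₂))
      (solveMod (a ∷ b ∷ c ∷ i ∷ κ ∷ l ∷ x₁ ∷ x₂ ∷ []) (λ a b c i κ l x y →
            (l :* l :- (a :* b :+ a :* c :+ b :* c) :- a :* b :* c :* x :- a :* b :* c :* y :+ a :* c) :* i :^ 2
            := (l :* i) :^ 2 :+ con 1 :+ κ :- (a :* b :* c :* x :+ a :* c) :* i :^ 2 :-
            (a :* b :* c :* y :+ a :* c) :* i :^ 2
            given (i :^ 2 :* (a :* c) := con 1 :+ i :^ 2 :* (a :* b) ∷ κ := i :^ 2 :* (a :* c :- b :* c) ∷ []))
            (i²ac ∷ κ-def ∷ []))
    line₁ : Y₁ ≡ l * i * X₁ + N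
    line₁ = solve (l * i * X₁ ∷ Y₁ ∷ []) (λ x y → y := x :+ (y :- x))
    line₂ : Y₂ ≡ l * i * X₂ + N
    line₂ = begin
      A * y₂ * i ^ 3                                ≡⟨
            solve (A ∷ i ∷ y₁ ∷ y₂ ∷ []) (λ A i z y → A :* y :* i :^ 3
            := A :* z :* i :^ 3 :+ A :* (y :- z) :* i :^ 3) ⟩
      A * y₁ * i ^ 3 + A * (y₂ - y₁) * i ^ 3        ≡⟨ cong (λ t → A * y₁ * i ^ 3 + A * t * i ^ 3) slope ⟨
      A * y₁ * i ^ 3 + A * (l * (x₂ - x₁)) * i ^ 3  ≡⟨
            solve (A ∷ i ∷ l ∷ a * c ∷ x₁ ∷ x₂ ∷ y₁ ∷ [])
            (λ A i l e x y z → A :* z :* i :^ 3 :+ A :* (l :* (y :- x)) :* i :^ 3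
            := l :* i :* ((A :* y :+ e) :* i :^ 2) :+ (A :* z :* i :^ 3 :- l :* i :* ((A :* x :+ e) :* i :^ 2)))
            ⟩
      l * i * X₂ + N                                ∎
    line₃ : - toY y₃ ≡ l * i * toX x₃ + N
    line₃ = solve (A ∷ i ∷ l ∷ a * c ∷ x₁ ∷ x₃ ∷ y₁ ∷ [])
          (λ A i l e x y z → :- (A :* :- (l :* y :+ (z :- l :* x)) :* i :^ 3)
          := l :* i :* ((A :* y :+ e) :* i :^ 2) :+ (A :* z :* i :^ 3 :- l :* i :* ((A :* x :+ e) :* i :^ 2)))
    on₃ : OnCurve (aff x₃ y₃)
    on₃ = fromLegendre (begin
      toY y₃ ^ 2                   ≡⟨ solve (toY y₃ ∷ []) (λ y → y :^ 2 := (:- y) :^ 2) ⟩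
      (- toY y₃) ^ 2               ≡⟨ cong (_^ 2) line₃ ⟩
      (l * i * toX x₃ + N) ^ 2     ≡⟨ on-curve (subst (Collinear (l * i) N X₁ X₂) (sym X₃≡) col) ⟩
      cubic (toX x₃)               ∎)
    toY≡0 : ∀ {y} → toY y ≡ 0# → y ≡ 0#
    toY≡0 {y} eq = *-zero (trans (solve (A ∷ i ∷ y ∷ []) (λ A i y → A :* (i :* (i :* i)) :* y
          := A :* y :* i :^ 3)) eq) (*-≢0 abc≢0 (*-≢0 i≢0 (*-≢0 i≢0 i≢0)))
    2-torsion : Y₁ ≡ 0# → Y₂ ≡ 0# → toY y₃ ≡ 0#
    2-torsion Y₁≡0 Y₂≡0 = begin
      A * - (l * x₃ + (y₁ - l * x₁)) * i ^ 3     ≡⟨ cong₂ (λ l y → A * - (l * x₃ + (y - l * x₁)) * i ^ 3)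
            (vertical (toY≡0 Y₁≡0) (toY≡0 Y₂≡0)) (toY≡0 Y₁≡0) ⟩
      A * - (0# * x₃ + (0# - 0# * x₁)) * i ^ 3   ≡⟨
            solve (A ∷ i ∷ x₁ ∷ x₃ ∷ []) (λ A i x y → A :* :- (con 0 :* y :+ (con 0 :- con 0 :* x)) :* i :^ 3
            := con 0) ⟩
      0#                                         ∎

  addAffine-sum : ∀ x₁ y₁ x₂ y₂ x? y? (p : OnCurve (aff x₁ y₁)) (q : OnCurve (aff x₂ y₂)) →
                  IsSum (aff x₁ y₁) (aff x₂ y₂) (addAffine x₁ y₁ x₂ y₂ x? y?) p q
  addAffine-sum x₁ y₁ x₂ y₂ (no x₁≢x₂) _ p q = chord-sum l x₁ y₁ x₂ y₂ p q
      (chord-collinear (toLegendre p) (toLegendre q) X₁≢X₂ slope′) slope vertical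
    where
    x₂-x₁≢0 : x₂ - x₁ ≢ 0#
    x₂-x₁≢0 eq = x₁≢x₂ (sym (-‿≡0 eq))
    l : F
    l = (y₂ - y₁) * (x₂ - x₁) ⁻¹
    slope : l * (x₂ - x₁) ≡ y₂ - y₁
    slope = solveMod (x₂ - x₁ ∷ y₂ - y₁ ∷ (x₂ - x₁) ⁻¹ ∷ []) (λ x y j → y :* j :* x := y
          given (x :* j := con 1 ∷ [])) (inverseʳ _ x₂-x₁≢0 ∷ [])
    slope′ : l * i * (toX x₂ - toX x₁) ≡ toY y₂ - toY y₁
    slope′ = begin
      l * i * (toX x₂ - toX x₁)      ≡⟨
            solve (A ∷ a * c ∷ i ∷ l ∷ x₁ ∷ x₂ ∷ [])
            (λ A e i l x y → l :* i :* ((A :* y :+ e) :* i :^ 2 :- (A :* x :+ e) :* i :^ 2)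
            := A :* (l :* (y :- x)) :* i :^ 3) ⟩
      A * (l * (x₂ - x₁)) * i ^ 3    ≡⟨ cong (λ t → A * t * i ^ 3) slope ⟩
      A * (y₂ - y₁) * i ^ 3          ≡⟨ solve (A ∷ i ∷ y₁ ∷ y₂ ∷ []) (λ A i z y → A :* (y :- z) :* i :^ 3
            := A :* y :* i :^ 3 :- A :* z :* i :^ 3) ⟩
      toY y₂ - toY y₁                ∎
    X₁≢X₂ : toX x₂ - toX x₁ ≢ 0#
    X₁≢X₂ eq = x₂-x₁≢0 (*-zero (trans
          (solve (A ∷ a * c ∷ i ∷ x₁ ∷ x₂ ∷ []) (λ A e i x y → A :* (i :* i) :* (y :- x) :=
          (A :* y :+ e) :* i :^ 2 :- (A :* x :+ e) :* i :^ 2)) eq)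
      (*-≢0 abc≢0 (*-≢0 i≢0 i≢0)))
    vertical : y₁ ≡ 0# → y₂ ≡ 0# → l ≡ 0#
    vertical y₁≡0 y₂≡0 = trans (cong₂ (λ u v → (u - v) * (x₂ - x₁) ⁻¹) y₂≡0 y₁≡0)
          (solve ((x₂ - x₁) ⁻¹ ∷ []) (λ j → (con 0 :- con 0) :* j := con 0))
  addAffine-sum x₁ y₁ .x₁ y₂ (yes refl) (yes refl) p q = tt , (begin
    ε                                   ≡⟨ ∙-inverseˡ (Φ (aff x₁ y₂) q) ⟨
    inv (Φ (aff x₁ y₂) q) ∙ Φ (aff x₁ y₂) q
      ≡⟨ cong (_∙ Φ (aff x₁ y₂) q) (trans
            (φ-cong {p = toLegendre p} {q = subst (λ Y → Y ^ 2 ≡ cubic (toX x₁)) toY-neg (toLegendre p)} refl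
            toY-neg) (φ-neg {p = toLegendre q} {q = subst (λ Y → Y ^ 2 ≡ cubic (toX x₁)) toY-neg
            (toLegendre p)})) ⟨
    Φ (aff x₁ (- y₂)) p ∙ Φ (aff x₁ y₂) q ∎)
    where
    toY-neg : toY (- y₂) ≡ - toY y₂
    toY-neg = solve (A ∷ i ∷ y₂ ∷ []) (λ A i y → A :* :- y :* i :^ 3 := :- (A :* y :* i :^ 3))
  addAffine-sum x₁ y₁ .x₁ y₂ (yes refl) (no y₁≢-y₂) p q = chord-sum l x₁ y₁ x₁ y₂ p q
      (tangent-collinear (toLegendre p) slope) slope₀ vertical
    where
    y₁≡y₂ : y₁ ≡ y₂
    y₁≡y₂ = by-cases (square-≡ (trans p (sym q)))
      where
      by-cases : y₁ ≡ y₂ ⊎ y₁ ≡ - y₂ → y₁ ≡ y₂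
      by-cases (inj₁ eq) = eq
      by-cases (inj₂ eq) = ⊥-elim (y₁≢-y₂ eq)
    y₁≢0 : y₁ ≢ 0#
    y₁≢0 y₁≡0 = y₁≢-y₂ (trans y₁≡0 (trans (sym -0#≈0#) (cong -_ (trans (sym y₁≡0) y₁≡y₂))))
    l : F
    l = (nat 3 * A * x₁ * x₁ + nat 2 * B * x₁ + C) * (nat 2 * y₁) ⁻¹
    slope₀ : l * (x₁ - x₁) ≡ y₂ - y₁
    slope₀ = trans (solve (l ∷ x₁ ∷ []) (λ l x → l :* (x :- x) := con 0)) (sym (≡⇒-≡0 (sym y₁≡y₂)))
    slope : l * i * (nat 2 * toY y₁) ≡ nat 3 * toX x₁ ^ 2 - nat 2 * (1# + κ) * toX x₁ + κ
    slope = trans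
      (solve (A ∷ i ∷ nat 3 * A * x₁ * x₁ + nat 2 * B * x₁ + C ∷ (nat 2 * y₁) ⁻¹ ∷ nat 2 * y₁ ∷ y₁ ∷ [])
            (λ A i w j z y → w :* j :* i :* (con 2 :* (A :* y :* i :^ 3))
            := w :* A :* (j :* (con 2 :* y)) :* i :^ 4))
      (trans (cong (λ t → (nat 3 * A * x₁ * x₁ + nat 2 * B * x₁ + C) * A * t * i ^ 4)
            (trans (*-comm _ _) (inverseʳ _ (*-≢0 2≢0 y₁≢0))))
      (solveMod (a ∷ b ∷ c ∷ i ∷ κ ∷ x₁ ∷ []) (λ a b c i κ x →
            let X = (a :* b :* c :* x :+ a :* c) :* i :^ 2
            in (con 3 :* (a :* b :* c) :* x :* x :+ con 2 :* (a :* b :+ a :* c :+ b :* c) :* x :+ (a :+ b :+ c))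
            :* (a :* b :* c) :* con 1 :* i :^ 4 := con 3 :* X :^ 2 :- con 2 :* (con 1 :+ κ) :* X :+ κ
            given (i :^ 2 :* (a :* c) := con 1 :+ i :^ 2 :* (a :* b) ∷ κ := i :^ 2 :* (a :* c :- b :* c) ∷ []))
            (i²ac ∷ κ-def ∷ [])))
    vertical : y₁ ≡ 0# → y₂ ≡ 0# → l ≡ 0#
    vertical y₁≡0 _ = ⊥-elim (y₁≢0 y₁≡0)

  ⊕-sum : ∀ P Q (p : OnCurve P) (q : OnCurve Q) → IsSum P Q (P ⊕ Q) p q
  ⊕-sum ∞           Q           p q = q , sym (∙-identityˡ (Φ Q q))
  ⊕-sum (aff x₁ y₁) ∞           p q = p , trans (sym (∙-identityˡ (Φ (aff x₁ y₁) p))) (∙-comm ε (Φ (aff x₁ y₁) p))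
  ⊕-sum (aff x₁ y₁) (aff x₂ y₂) p q = addAffine-sum x₁ y₁ x₂ y₂ (x₁ ≟ x₂) (y₁ ≟ (- y₂)) p q

  module _ {m : F} (m*i≡1 : m * i ≡ 1#) where

    point : F → F → Point
    point X Y = aff ((X * m ^ 2 - a * c) * A ⁻¹) (Y * m ^ 3 * A ⁻¹)

    private
      toX-point : ∀ X → toX ((X * m ^ 2 - a * c) * A ⁻¹) ≡ X
      toX-point X = solveMod (A ∷ A ⁻¹ ∷ a * c ∷ i ∷ m ∷ X ∷ []) (λ A j e i m X →
            (A :* ((X :* m :^ 2 :- e) :* j) :+ e) :* i :^ 2 := X given (A :* j := con 1 ∷ m :* i := con 1 ∷ []))
            (inverseʳ A abc≢0 ∷ m*i≡1 ∷ [])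

      toY-point : ∀ Y → toY (Y * m ^ 3 * A ⁻¹) ≡ Y
      toY-point Y = solveMod (A ∷ A ⁻¹ ∷ i ∷ m ∷ Y ∷ []) (λ A j i m Y → A :* (Y :* m :^ 3 :* j) :* i :^ 3 := Y
            given (A :* j := con 1 ∷ m :* i := con 1 ∷ [])) (inverseʳ A abc≢0 ∷ m*i≡1 ∷ [])

    point-on : ∀ {X Y} → Y ^ 2 ≡ cubic X → OnCurve (point X Y)
    point-on {X} {Y} on = fromLegendre (subst₂ (λ X Y → Y ^ 2 ≡ cubic X) (sym (toX-point X)) (sym (toY-point Y)) on)

    Φ-point : ∀ {X Y} (on : Y ^ 2 ≡ cubic X) → Φ (point X Y) (point-on on) ≡ φ X Y on
    Φ-point {X} {Y} on = φ-cong {p = toLegendre (point-on on)} {q = on} (toX-point X) (toY-point Y)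

-- Valuation rings with residue field 𝔽₃.

module Subring (𝔽 : Field) (O : Field.F 𝔽 → Set) (O-1 : O (Field.1# 𝔽))
    (O-+ : ∀ {x y} → O x → O y → O (Field._+_ 𝔽 x y))
    (O-* : ∀ {x y} → O x → O y → O (Field._*_ 𝔽 x y))
    (O-neg : ∀ {x} → O x → O (Field.-_ 𝔽 x)) where
  open Field 𝔽
  open Solver 𝔽 using (Expr; Exprs; applyVars; ⟦_⟧; lookup; var; con; _:+_; _:*_; :-_; _:^_)

  O-0 : O 0#
  O-0 = subst O (-‿inverseʳ 1#) (O-+ O-1 (O-neg O-1))

  O-nat : ∀ n → O (nat n)
  O-nat zero          = O-0
  O-nat (suc zero)    = O-1
  O-nat (suc (suc n)) = O-+ O-1 (O-nat (suc n))

  O-^ : ∀ {x} n → O x → O (x ^ n)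
  O-^ zero          Ox = O-1
  O-^ (suc zero)    Ox = Ox
  O-^ (suc (suc n)) Ox = O-* Ox (O-^ (suc n) Ox)

  O-lookup : ∀ {ρ} → All O ρ → ∀ i → O (lookup ρ i)
  O-lookup []       i       = O-1
  O-lookup (p ∷ ps) zero    = p
  O-lookup (p ∷ ps) (suc i) = O-lookup ps i

  O-eval : ∀ {ρ} → All O ρ → ∀ e → O (⟦ e ⟧ ρ)
  O-eval ps (var i)  = O-lookup ps i
  O-eval ps (con n)  = O-nat n
  O-eval ps (e :+ f) = O-+ (O-eval ps e) (O-eval ps f)
  O-eval ps (e :* f) = O-* (O-eval ps e) (O-eval ps f)
  O-eval ps (:- e)   = O-neg (O-eval ps e)
  O-eval ps (e :^ n) = O-^ n (O-eval ps e)

  -- Integrality is read off from the polynomial expression of an element, which leaves only the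
  -- variables to be checked.
  integral : ∀ {n} (ρ : Vec F n) (f : Exprs n Expr) → All O (Vec.toList ρ) → O (⟦ applyVars n 0 f ⟧ (Vec.toList ρ))
  integral {n} ρ f ps = O-eval ps (applyVars n 0 f)

-- A valuation ring O with maximal ideal πO and residue field of three elements.
record ValuationRing (𝔽 : Field) : Set₁ where
  open Field 𝔽
  field
    O          : F → Set
    π          : F
    O-1        : O 1#
    O-π        : O π
    O-+        : ∀ {x y} → O x → O y → O (x + y)
    O-*        : ∀ {x y} → O x → O y → O (x * y)
    O-neg      : ∀ {x} → O x → O (- x)
    valuation  : ∀ x → O x ⊎ ∃ λ y → O y × x * (π * y) ≡ 1#
    residue    : ∀ {x} → O x → ∃ λ y → O y × (x ≡ π * y ⊎ x ≡ 1# + π * y ⊎ x ≡ - 1# + π * y)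
    π≢0        : π ≢ 0#
    π-nonunit  : ∀ {y} → O y → π * y ≢ 1#

module ValuationRingProperties {𝔽 : Field} (𝕆 : ValuationRing 𝔽) where
  open Field 𝔽
  open Solver 𝔽 using (solve; solveMod; con; _:+_; _:*_; :-_; _:-_; _:^_; _:=_; _given_)
  open FieldProperties 𝔽
  open ValuationRing 𝕆

  M Unit : F → Set
  M x    = ∃ λ y → O y × x ≡ π * y
  Unit x = O x × ∃ λ y → O y × x * y ≡ 1#

  open Subring 𝔽 O O-1 O-+ O-* O-neg public

  M⇒O : ∀ {x} → M x → O x
  M⇒O (y , Oy , refl) = O-* O-π Oy

  M-π* : ∀ {y} → O y → M (π * y)
  M-π* Oy = _ , Oy , refl

  M-+ : ∀ {x y} → M x → M y → M (x + y)
  M-+ (u , Ou , refl) (v , Ov , refl) = u + v , O-+ Ou Ov , sym (distribˡ π u v)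

  M-* : ∀ {x y} → O x → M y → M (x * y)
  M-* {x} Ox (v , Ov , refl) = x * v , O-* Ox Ov , (solve (x ∷ v ∷ π ∷ []) (λ x v π → x :* (π :* v) := π :* (x :* v)))

  M-neg : ∀ {x} → M x → M (- x)
  M-neg (u , Ou , refl) = - u , O-neg Ou , -‿distribʳ-* π u

  ¬M-1 : ¬ M 1#
  ¬M-1 (y , Oy , eq) = π-nonunit Oy (sym eq)

  ¬M-unit : ∀ {x} → Unit x → ¬ M x
  ¬M-unit {x} (_ , y , Oy , xy≡1) Mx = ¬M-1 (subst M (trans (*-comm y x) xy≡1) (M-* Oy Mx))

  M-0 : M 0#
  M-0 = 0# , O-0 , sym (zeroʳ π)

  cancel-π : ∀ n {x y} → π ^ n * x ≡ π ^ n * y → x ≡ y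
  cancel-π n = *-cancelˡ (π^≢0 n)
    where
    π^≢0 : ∀ n → π ^ n ≢ 0#
    π^≢0 zero          = 1≢0
    π^≢0 (suc zero)    = π≢0
    π^≢0 (suc (suc n)) = *-≢0 π≢0 (π^≢0 (suc n))

  -- Residue 0 means `M`. For residue ±1, a non-integral inverse would put `x` into `M`, and with it
  -- 1.
  M-or-unit : ∀ {x} → O x → M x ⊎ Unit x
  M-or-unit {x} Ox = by-residue (residue Ox)
    where
    unit : (M x → M 1#) → Unit x
    unit x∉M = by-valuation (valuation (x ⁻¹))
      where
      x≢0 : x ≢ 0#
      x≢0 x≡0 = ¬M-1 (x∉M (subst M (sym x≡0) M-0))
      by-valuation : O (x ⁻¹) ⊎ (∃ λ y → O y × x ⁻¹ * (π * y) ≡ 1#) → Unit x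
      by-valuation (inj₁ Ox⁻¹) = Ox , x ⁻¹ , Ox⁻¹ , inverseʳ x x≢0
      by-valuation (inj₂ (y , Oy , eq)) = ⊥-elim (¬M-1 (x∉M (y , Oy , trans
        (solveMod (x ∷ π * y ∷ x ⁻¹ ∷ []) (λ x y i → x := x :* (i :* y) given (i :* y := con 1 ∷ [])) (eq ∷ []))
        (solveMod (x ∷ π * y ∷ x ⁻¹ ∷ []) (λ x y i → x :* (i :* y) := y given (x :* i := con 1 ∷ []))
              (inverseʳ x x≢0 ∷ [])))))
    by-residue : (∃ λ y → O y × (x ≡ π * y ⊎ x ≡ 1# + π * y ⊎ x ≡ - 1# + π * y)) → M x ⊎ Unit x
    by-residue (y , Oy , inj₁ x≡)        = inj₁ (y , Oy , x≡)
    by-residue (y , Oy , inj₂ (inj₁ x≡)) = inj₂ (unit λ Mx → subst M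
      (trans (cong (_- π * y) x≡) (solve (π ∷ y ∷ []) (λ π y → con 1 :+ π :* y :- π :* y := con 1)))
            (M-+ Mx (M-neg (M-π* Oy))))
    by-residue (y , Oy , inj₂ (inj₂ x≡)) = inj₂ (unit λ Mx → subst M
      (trans (cong (λ t → π * y - t) x≡) (solve (π ∷ y ∷ []) (λ π y → π :* y :- (:- con 1 :+ π :* y) := con 1)))
            (M-+ (M-π* Oy) (M-neg Mx)))

  -- In 𝔽₃ the only non-zero square is 1.
  M-square : ∀ {x} → Unit x → M (x ^ 2 - 1#)
  M-square {x} Ux@(Ox , _) = by-residue (residue Ox)
    where
    by-residue : (∃ λ y → O y × (x ≡ π * y ⊎ x ≡ 1# + π * y ⊎ x ≡ - 1# + π * y)) → M (x ^ 2 - 1#)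
    by-residue (y , Oy , inj₁ x≡)        = ⊥-elim (¬M-unit Ux (y , Oy , x≡))
    by-residue (y , Oy , inj₂ (inj₁ x≡)) = y * (nat 2 + π * y) ,
          (integral (π ∷ y ∷ []) (λ π y → y :* (con 2 :+ π :* y)) (O-π ∷ Oy ∷ [])) ,
      trans (cong (λ t → t ^ 2 - 1#) x≡) (solve (π ∷ y ∷ []) (λ π y → (con 1 :+ π :* y) :^ 2 :- con 1
            := π :* (y :* (con 2 :+ π :* y))))
    by-residue (y , Oy , inj₂ (inj₂ x≡)) = y * (π * y - nat 2) ,
          (integral (π ∷ y ∷ []) (λ π y → y :* (π :* y :- con 2)) (O-π ∷ Oy ∷ [])) ,
      trans (cong (λ t → t ^ 2 - 1#) x≡) (solve (π ∷ y ∷ []) (λ π y → (:- con 1 :+ π :* y) :^ 2 :- con 1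
            := π :* (y :* (π :* y :- con 2))))

  unit-* : ∀ {x y} → Unit x → Unit y → Unit (x * y)
  unit-* {x} {y} (Ox , u , Ou , xu≡1) (Oy , v , Ov , yv≡1) = O-* Ox Oy , u * v , O-* Ou Ov ,
    (solveMod (x ∷ y ∷ u ∷ v ∷ []) (λ x y u v → x :* y :* (u :* v) := con 1
          given (x :* u := con 1 ∷ y :* v := con 1 ∷ [])) (xu≡1 ∷ yv≡1 ∷ []))

  unit-near-1 : ∀ {x} → M (x - 1#) → Unit x
  unit-near-1 {x} Mx-1 = [ (λ Mx →
        ⊥-elim (¬M-1 (subst M (solve (x ∷ []) (λ x → x :- (x :- con 1) := con 1)) (M-+ Mx (M-neg Mx-1))))) ,
        (λ Ux → Ux) ]′
    (M-or-unit (subst O (solve (x ∷ []) (λ x → x :- con 1 :+ con 1 := x)) (O-+ (M⇒O Mx-1) O-1)))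

  unit-inverse : ∀ {x y} → Unit x → x * y ≡ 1# → Unit y
  unit-inverse {x} {y} (Ox , z , Oz , xz≡1) xy≡1 =
    subst O (*-cancelˡ (≢0-factor xy≡1) (trans xz≡1 (sym xy≡1))) Oz , x , Ox , trans (*-comm y x) xy≡1

  unit≢0 : ∀ {x} → Unit x → x ≢ 0#
  unit≢0 (_ , _ , _ , xy≡1) = ≢0-factor xy≡1

  O-root : ∀ {x} → O (x ^ 2) → O x
  O-root {x} Ox² = [ (λ Ox → Ox) , (λ (y , Oy , eq) → ⊥-elim (¬M-1 (π * x ^ 2 * y ^ 2 ,
      (integral (π ∷ x ^ 2 ∷ y ∷ []) (λ π z y → π :* z :* y :^ 2) (O-π ∷ Ox² ∷ Oy ∷ [])) ,
      trans (sym (trans (cong (_^ 2) eq) (*-identityʳ 1#)))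
            (solve (π ∷ x ∷ y ∷ []) (λ π x y → (x :* (π :* y)) :^ 2 := π :* (π :* x :^ 2 :* y :^ 2)))))) ]′
            (valuation x)

  module _ (M-3 : M (nat 3)) where

    ¬M-2 : ¬ M (nat 2)
    ¬M-2 M-2 = ¬M-1 (subst M (solve (π ∷ []) (λ π → con 3 :- con 2 := con 1)) (M-+ M-3 (M-neg M-2)))

    -- The residue field is 𝔽₃, in which −1 is no square.
    ¬M-square+1 : ∀ {x} → O x → ¬ M (x ^ 2 + 1#)
    ¬M-square+1 {x} Ox Mx²+1 = [
      (λ Mx → ¬M-1 (subst M (solve (x ∷ []) (λ x → x :^ 2 :+ con 1 :- x :* x := con 1))
            (M-+ Mx²+1 (M-neg (M-* Ox Mx))))) ,
      (λ Ux → ¬M-2 (subst M (solve (x ∷ []) (λ x → x :^ 2 :+ con 1 :- (x :^ 2 :- con 1) := con 2))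
            (M-+ Mx²+1 (M-neg (M-square Ux))))) ]′ (M-or-unit Ox)

module NonSquare {𝔽 : Field} (𝕆 : ValuationRing 𝔽) where
  open Field 𝔽
  open Solver 𝔽 using (solve; solveMod; con; _:+_; _:*_; :-_; _:-_; _:^_; _:=_; _given_)
  open ValuationRing 𝕆
  open ValuationRingProperties 𝕆

  -- For a square root `x` of `κ`, the square of `x π³` would be `−k`, congruent to the non-square
  -- -1.
  nonsquare : ∀ {κ k} → M (nat 3) → κ * π ^ 6 ≡ - k → M (k - 1#) → ∀ x → x ^ 2 ≢ κ
  nonsquare {κ} {k} M-3 κπ⁶ Mk-1 x x²≡κ = ¬M-square+1 M-3
        (O-root (subst O (sym square) (O-neg (proj₁ (unit-near-1 Mk-1)))))
    (subst M (trans (solve (k ∷ []) (λ k → :- (k :- con 1) := :- k :+ con 1)) (cong (_+ 1#) (sym square)))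
          (M-neg Mk-1))
    where
    square : (x * π ^ 3) ^ 2 ≡ - k
    square = trans (solve (x ∷ π ∷ []) (λ x π → (x :* π :^ 3) :^ 2 := x :^ 2 :* π :^ 6))
          (trans (cong (_* π ^ 6) x²≡κ) κπ⁶)

-- Valuations of `s`, and torsion points of the Jacobi form.

module Torsion {𝔽 : Field} (𝕆 : ValuationRing 𝔽) (κ k e : Field.F 𝔽)
    (κπ⁶ : Field._*_ 𝔽 κ (Field._^_ 𝔽 (ValuationRing.π 𝕆) 6) ≡ Field.-_ 𝔽 k)
    (Mk-1 : ValuationRingProperties.M 𝕆 (Field._-_ 𝔽 k (Field.1# 𝔽)))
    (3≡π²e : Field.nat 𝔽 3 ≡ Field._*_ 𝔽 (Field._^_ 𝔽 (ValuationRing.π 𝕆) 2) e)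
    (Me-1 : ValuationRingProperties.M 𝕆 (Field._-_ 𝔽 e (Field.1# 𝔽)))
    (κ-nonsquare : ∀ x → Field._^_ 𝔽 x 2 ≢ κ) where
  open Field 𝔽
  open Solver 𝔽 using (solve; solveMod; con; _:+_; _:*_; :-_; _:-_; _:^_; _:=_; _given_)
  open FieldProperties 𝔽
  open ValuationRing 𝕆
  open ValuationRingProperties 𝕆
  open JacobiGroup 𝔽 κ κ-nonsquare
  open ≡-Reasoning

  private
    Uk : Unit k
    Uk = unit-near-1 Mk-1

    Ok : O k
    Ok = proj₁ Uk

    Oe : O e
    Oe = proj₁ (unit-near-1 Me-1)

    M-3 : M (nat 3)
    M-3 = π * e , O-* O-π Oe , trans 3≡π²e (solve (π ∷ e ∷ []) (λ π e → π :^ 2 :* e := π :* (π :* e)))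

  Deep : J → Set
  Deep P = ∃ λ t → O t × s P ≡ π ^ 4 * t

  Level : ℕ → J → Set
  Level n P = ∃ λ t → Unit t × s P ≡ π ^ n * t

  -- s has valuation 0, 1, 2 or at least 4: on the reduction, 3 would require
  -- d² = −1 in the residue field.
  data Depth (P : J) : Set where
    level : ∀ n → n ℕ.≤ 2 → Level n P → Depth P
    deep  : Deep P → Depth P

  -- If `1/s` were in `M`, then `(c/s)² = 1/s² − 1` would be congruent to -1.
  O-s : ∀ P → O (s P)
  O-s P = [ (λ Os → Os) , (λ (y , Oy , eq) →
        ⊥-elim (¬M-square+1 M-3 (O-root
        (subst O (sym (z² eq)) (integral (π ∷ y ∷ []) (λ π y → (π :* y) :^ 2 :- con 1) (O-π ∷ Oy ∷ []))))
      (subst M (trans (solve (π ∷ y ∷ []) (λ π y → π :* y :* (π :* y) := (π :* y) :^ 2 :- con 1 :+ con 1))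
            (cong (_+ 1#) (sym (z² eq)))) (M-* (O-* O-π Oy) (M-π* Oy))))) ]′ (valuation (s P))
    where
    z² : ∀ {y} → s P * (π * y) ≡ 1# → (c P * (π * y)) ^ 2 ≡ (π * y) ^ 2 - 1#
    z² {y} eq = trans (solveMod (s P ∷ c P ∷ π * y ∷ []) (λ x c z → (c :* z) :^ 2 := z :^ 2 :- (x :* z) :^ 2
          given (c :^ 2 := con 1 :- x :^ 2 ∷ [])) (c² P ∷ []))
      (cong (λ t → (π * y) ^ 2 - t) (trans (cong (_^ 2) eq) (*-identityʳ 1#)))

  depth : ∀ P → Depth P
  depth P = step₀ (M-or-unit (O-s P))
    where
    step₃ : ∀ {t} → O t → s P ≡ π ^ 3 * t → M t ⊎ Unit t → Depth P
    step₃ Ot eq (inj₁ (u , Ou , refl)) = deep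
          (u , Ou , trans eq (solve (π ∷ u ∷ []) (λ π u → π :^ 3 :* (π :* u) := π :^ 4 :* u)))
    step₃ {t} Ot eq (inj₂ Ut) = ⊥-elim
          (¬M-square+1 M-3 (O-root (subst O (sym d²≡)
          (integral (k ∷ t ∷ []) (λ k t → con 1 :+ k :* t :^ 2) (Ok ∷ Ot ∷ []))))
      (subst M (trans (solve (k ∷ t ∷ []) (λ k t → (k :- con 1) :* t :^ 2 :+ (t :^ 2 :- con 1) :+ con 3
            := con 1 :+ k :* t :^ 2 :+ con 1)) (cong (_+ 1#) (sym d²≡)))
        (M-+ (M-+ (subst M (*-comm (t ^ 2) (k - 1#)) (M-* (O-^ 2 Ot) Mk-1)) (M-square Ut)) M-3)))
      where
      d²≡ : d P ^ 2 ≡ 1# + k * t ^ 2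
      d²≡ = begin
        d P ^ 2                         ≡⟨ d² P ⟩
        1# - κ * s P ^ 2                ≡⟨ cong (λ u → 1# - κ * u ^ 2) eq ⟩
        1# - κ * (π ^ 3 * t) ^ 2        ≡⟨
              solveMod (κ ∷ π ∷ t ∷ k ∷ []) (λ κ π t k → con 1 :- κ :* (π :^ 3 :* t) :^ 2
              := con 1 :+ k :* t :^ 2 given (κ :* π :^ 6 := :- k ∷ [])) (κπ⁶ ∷ []) ⟩
        1# + k * t ^ 2                  ∎
    step₂ : ∀ {t} → O t → s P ≡ π ^ 2 * t → M t ⊎ Unit t → Depth P
    step₂ Ot eq (inj₁ (u , Ou , refl)) = step₃ Ou
          (trans eq (solve (π ∷ u ∷ []) (λ π u → π :^ 2 :* (π :* u) := π :^ 3 :* u))) (M-or-unit Ou)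
    step₂ Ot eq (inj₂ Ut) = level 2 ℕₚ.≤-refl (_ , Ut , eq)
    step₁ : ∀ {t} → O t → s P ≡ π * t → M t ⊎ Unit t → Depth P
    step₁ Ot eq (inj₁ (u , Ou , refl)) = step₂ Ou
          (trans eq (solve (π ∷ u ∷ []) (λ π u → π :* (π :* u) := π :^ 2 :* u))) (M-or-unit Ou)
    step₁ Ot eq (inj₂ Ut) = level 1 (ℕ.s≤s ℕ.z≤n) (_ , Ut , eq)
    step₀ : M (s P) ⊎ Unit (s P) → Depth P
    step₀ (inj₁ (u , Ou , eq)) = step₁ Ou eq (M-or-unit Ou)
    step₀ (inj₂ Us) = level 0 ℕ.z≤n (_ , Us , sym (*-identityˡ (s P)))

  open AbelianGroup abelianGroup using (commutativeMonoid; identityʳ; identityˡ; assoc; comm)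
  open Mult commutativeMonoid public using (×-homo-+; ×-assocˡ; ×-distrib-+) renaming (_×_ to infixl 8 _·_)

  cube : J → J
  cube P = P ∙ (P ∙ P)

  -- On deep points s ↦ s (3 P) is multiplication by a non-zero element of M,
  -- so that the points 3ⁱ P are pairwise distinct.
  cube-deep : ∀ P → Deep P → ∃ λ g → M g × g ≢ 0# × s (cube P) ≡ s P * g
  cube-deep P (t , Ot , eq) = g , M-g , g≢0 , s-cube
    where
    -- With `s = π⁴ t` and `κ = −k/π⁶` the denominator of `triple` becomes `D` and the numerator
    -- factor becomes `π² w`; one factor `π²` comes out of `3 = π² e`, the other out of `κ s²`.
    w r D x : F
    x = s P
    r = nat 6 * k * π ^ 9 * t ^ 4 - nat 4 * k * π ^ 17 * t ^ 6 + nat 4 * k ^ 2 * π ^ 11 * t ^ 6 - nat 3 * k ^ 2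
          * π ^ 19 * t ^ 8
    D = 1# + π * r
    w = e + nat 4 * k * t ^ 2 + π * (- (nat 4 * π ^ 5 * t ^ 2) - nat 6 * k * π ^ 7 * t ^ 4 - k ^ 2 * π ^ 17 * t ^ 8)

    Or : O r
    Or = integral (k ∷ π ∷ t ∷ []) (λ k π t →
          con 6 :* k :* π :^ 9 :* t :^ 4 :- con 4 :* k :* π :^ 17 :* t :^ 6 :+ con 4 :* k :^ 2 :* π :^ 11 :* t
          :^ 6 :- con 3 :* k :^ 2 :* π :^ 19 :* t :^ 8) (Ok ∷ O-π ∷ Ot ∷ [])

    UD : Unit D
    UD = unit-near-1 (r , Or , (solve (π * r ∷ []) (λ y → con 1 :+ y :- con 1 := y)))

    D⁻¹ : F
    D⁻¹ = D ⁻¹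

    D-inverse : D * D⁻¹ ≡ 1#
    D-inverse = inverseʳ D (unit≢0 UD)

    OD⁻¹ : O D⁻¹
    OD⁻¹ = proj₁ (unit-inverse UD D-inverse)

    Ow : O w
    Ow = integral (e ∷ k ∷ π ∷ t ∷ [])
          (λ e k π t → e :+ con 4 :* k :* t :^ 2 :+ π :*
          (:- (con 4 :* π :^ 5 :* t :^ 2) :- con 6 :* k :* π :^ 7 :* t :^ 4 :- k :^ 2 :* π :^ 17 :* t :^ 8))
          (Oe ∷ Ok ∷ O-π ∷ Ot ∷ [])

    -- Modulo `π` all of `e`, `k` and 4 are 1, so `w` is `1 + t²` there.
    ¬Mw : ¬ M w
    ¬Mw Mw = ¬M-square+1 M-3 Ot (subst M
      (solve (e ∷ k ∷ π ∷ t ∷ π * (- (nat 4 * π ^ 5 * t ^ 2) - nat 6 * k * π ^ 7 * t ^ 4 - k ^ 2 * π ^ 17 * t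
            ^ 8) ∷ []) (λ e k π t z → e :+ con 4 :* k :* t :^ 2 :+ z :+ :-
            (z :+ (e :- con 1) :+ con 4 :* t :^ 2 :* (k :- con 1) :+ t :^ 2 :* con 3) := t :^ 2 :+ con 1))
      (M-+ Mw (M-neg (M-+ (M-+ (M-+ (M-π*
            (integral (k ∷ π ∷ t ∷ []) (λ k π t →
            :- (con 4 :* π :^ 5 :* t :^ 2) :- con 6 :* k :* π :^ 7 :* t :^ 4 :- k :^ 2 :* π :^ 17 :* t :^ 8)
            (Ok ∷ O-π ∷ Ot ∷ [])))
        Me-1) (M-* (integral (t ∷ []) (λ t → con 4 :* t :^ 2) (Ot ∷ [])) Mk-1)) (M-* (O-^ 2 Ot) M-3)))))

    w≢0 : w ≢ 0#
    w≢0 w≡0 = ¬Mw (subst M (sym w≡0) M-0)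

    g : F
    g = π * (π * w * D⁻¹)

    M-g : M g
    M-g = M-π* (O-* (O-* O-π Ow) OD⁻¹)

    g≢0 : g ≢ 0#
    g≢0 = *-≢0 π≢0 (*-≢0 (*-≢0 π≢0 w≢0) (≢0-factor (trans (*-comm D⁻¹ D) D-inverse)))

    den-eq : 1# - nat 6 * κ * x ^ 4 + nat 4 * κ * (1# + κ) * x ^ 6 - nat 3 * κ ^ 2 * x ^ 8 ≡ D
    den-eq = trans (cong (λ x → 1# - nat 6 * κ * x ^ 4 + nat 4 * κ * (1# + κ) * x ^ 6 - nat 3 * κ ^ 2 * x ^ 8) eq)
      (solveMod (κ ∷ π ∷ k ∷ t ∷ []) (λ κ π k t →
            con 1 :- con 6 :* κ :* (π :^ 4 :* t) :^ 4 :+ con 4 :* κ :* (con 1 :+ κ) :* (π :^ 4 :* t) :^ 6 :- con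
            3 :* κ :^ 2 :* (π :^ 4 :* t) :^ 8
            := con 1 :+ π :* (con 6 :* k :* π :^ 9 :* t :^ 4 :- con 4 :* k :* π :^ 17 :* t :^ 6 :+ con 4 :* k
            :^ 2 :* π :^ 11 :* t :^ 6 :- con 3 :* k :^ 2 :* π :^ 19 :* t :^ 8) given (κ :* π :^ 6 := :- k ∷ []))
            (κπ⁶ ∷ []))

    num-eq : nat 3 - nat 4 * (1# + κ) * x ^ 2 + nat 6 * κ * x ^ 4 - κ ^ 2 * x ^ 8 ≡ π ^ 2 * w
    num-eq = trans (cong₂ (λ n x → n - nat 4 * (1# + κ) * x ^ 2 + nat 6 * κ * x ^ 4 - κ ^ 2 * x ^ 8) 3≡π²e eq)
      (solveMod (κ ∷ π ∷ k ∷ t ∷ e ∷ [])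
            (λ κ π k t e → π :^ 2 :* e :- con 4 :* (con 1 :+ κ) :* (π :^ 4 :* t) :^ 2 :+ con 6 :* κ :*
            (π :^ 4 :* t) :^ 4 :- κ :^ 2 :* (π :^ 4 :* t) :^ 8
            := π :^ 2 :* (e :+ con 4 :* k :* t :^ 2 :+ π :*
            (:- (con 4 :* π :^ 5 :* t :^ 2) :- con 6 :* k :* π :^ 7 :* t :^ 4 :- k :^ 2 :* π :^ 17 :* t :^ 8))
            given (κ :* π :^ 6 := :- k ∷ [])) (κπ⁶ ∷ []))

    s-cube : s (cube P) ≡ x * g
    s-cube = begin
      s (cube P)                    ≡⟨ solveMod (s (cube P) ∷ D ∷ D⁻¹ ∷ []) (λ y D i → y := y :* D :* i
            given (D :* i := con 1 ∷ [])) (D-inverse ∷ []) ⟩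
      s (cube P) * D * D⁻¹          ≡⟨ cong (_* D⁻¹) (trans (cong (s (cube P) *_) (sym den-eq)) (triple P)) ⟩
      x * (nat 3 - nat 4 * (1# + κ) * x ^ 2 + nat 6 * κ * x ^ 4 - κ ^ 2 * x ^ 8) * D⁻¹
                                    ≡⟨ cong (λ t → x * t * D⁻¹) num-eq ⟩
      x * (π ^ 2 * w) * D⁻¹         ≡⟨ solve (x ∷ w ∷ π ∷ D⁻¹ ∷ []) (λ x w π i → x :* (π :^ 2 :* w) :* i
            := x :* (π :* (π :* w :* i))) ⟩
      x * g                         ∎

  cubes : ℕ → J → J
  cubes zero    P = P
  cubes (suc n) P = cubes n (cube P)

  deep-cube : ∀ P → Deep P → Deep (cube P)
  deep-cube P dp@(t , Ot , eq) = let g , Mg , _ , eq′ = cube-deep P dp in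
    t * g , O-* Ot (M⇒O Mg) , trans eq′ (trans (cong (_* g) eq) (*-assoc (π ^ 4) t g))

  cubes-deep : ∀ n P → Deep P → s P ≢ 0# → ∃ λ g → O g × s (cubes n P) ≡ s P * g
  cubes-deep zero    P dp s≢0 = 1# , O-1 , sym (*-identityʳ (s P))
  cubes-deep (suc n) P dp s≢0 =
    let g , Mg , g≢0 , eq = cube-deep P dp
        h , Oh , eq′ = cubes-deep n (cube P) (deep-cube P dp) (λ z → *-≢0 s≢0 g≢0 (trans (sym eq) z))
    in g * h , O-* (M⇒O Mg) Oh , trans eq′ (trans (cong (_* h) eq) (*-assoc (s P) g h))

  -- After the common triplings are stripped off, `s P = s P g h` with `g` in `M`; cancelling `s P`
  -- would put 1 into `M`.
  cubes-injective : ∀ m n P → Deep P → s P ≢ 0# → m ℕ.< n → cubes m P ≢ cubes n P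
  cubes-injective zero (suc n) P dp s≢0 _ P≡ =
    let g , Mg , g≢0 , eq = cube-deep P dp
        h , Oh , eq′ = cubes-deep n (cube P) (deep-cube P dp) (λ z → *-≢0 s≢0 g≢0 (trans (sym eq) z))
        1≡gh = *-cancelˡ s≢0 (trans (*-identityʳ (s P))
              (trans (cong s P≡) (trans eq′ (trans (cong (_* h) eq) (*-assoc (s P) g h)))))
    in ¬M-1 (subst M (trans (*-comm h g) (sym 1≡gh)) (M-* Oh Mg))
  cubes-injective (suc m) (suc n) P dp s≢0 (ℕ.s≤s m<n) P≡ =
    let g , Mg , g≢0 , eq = cube-deep P dp
    in cubes-injective m n (cube P) (deep-cube P dp) (λ z → *-≢0 s≢0 g≢0 (trans (sym eq) z)) m<n P≡

  IsTorsion : J → Set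
  IsTorsion P = ∃ λ n → n ≢ 0 × n · P ≡ ε

  ·-ε : ∀ n → n · ε ≡ ε
  ·-ε zero    = refl
  ·-ε (suc n) = trans (identityˡ (n · ε)) (·-ε n)

  ·-annihilates : ∀ m n {P} → n · P ≡ ε → (m ℕ.* n) · P ≡ ε
  ·-annihilates m n {P} nP≡ε = trans (sym (×-assocˡ P m n)) (trans (cong (m ·_) nP≡ε) (·-ε m))

  ·-% : ∀ m n .{{_ : NonZero n}} {P} → n · P ≡ ε → m · P ≡ (m % n) · P
  ·-% m n {P} nP≡ε = begin
    m · P                                 ≡⟨ cong (_· P) (m≡m%n+[m/n]*n m n) ⟩
    (m % n ℕ.+ m / n ℕ.* n) · P           ≡⟨ ×-homo-+ P (m % n) (m / n ℕ.* n) ⟩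
    (m % n) · P ∙ (m / n ℕ.* n) · P       ≡⟨ cong ((m % n) · P ∙_) (·-annihilates (m / n) n nP≡ε) ⟩
    (m % n) · P ∙ ε                       ≡⟨ identityʳ ((m % n) · P) ⟩
    (m % n) · P                           ∎

  torsion-∙ : ∀ {P Q} → IsTorsion P → IsTorsion Q → IsTorsion (P ∙ Q)
  torsion-∙ {P} {Q} (m , m≢0 , mP) (n , n≢0 , nQ) = m ℕ.* n ,
        (λ mn≡0 → [ m≢0 , n≢0 ]′ (ℕₚ.m*n≡0⇒m≡0∨n≡0 m mn≡0)) , (begin
    (m ℕ.* n) · (P ∙ Q)              ≡⟨ ×-distrib-+ P Q (m ℕ.* n) ⟩
    (m ℕ.* n) · P ∙ (m ℕ.* n) · Q    ≡⟨ cong₂ _∙_ (trans (cong (_· P) (ℕₚ.*-comm m n)) (·-annihilates n m mP))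
          (·-annihilates m n nQ) ⟩
    ε ∙ ε                            ≡⟨ identityˡ ε ⟩
    ε                                ∎)

  torsion-· : ∀ {P} n → IsTorsion P → IsTorsion (n · P)
  torsion-· {P} n (m , m≢0 , mP) = m , m≢0 ,
    trans (×-assocˡ P m n) (trans (cong (_· P) (ℕₚ.*-comm m n)) (·-annihilates n m mP))

  ·-complement : ∀ {P} m n → m ℕ.≤ n → n · P ≡ ε → inv (m · P) ≡ (n ℕ.∸ m) · P
  ·-complement {P} m n m≤n nP = begin
    inv (m · P)                                     ≡⟨ identityʳ (inv (m · P)) ⟨
    inv (m · P) ∙ ε                                 ≡⟨ cong (inv (m · P) ∙_) nP ⟨
    inv (m · P) ∙ n · P                             ≡⟨ cong (λ r → inv (m · P) ∙ r · P) (ℕₚ.m+[n∸m]≡n m≤n) ⟨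
    inv (m · P) ∙ (m ℕ.+ (n ℕ.∸ m)) · P             ≡⟨ cong (inv (m · P) ∙_) (×-homo-+ P m (n ℕ.∸ m)) ⟩
    inv (m · P) ∙ (m · P ∙ (n ℕ.∸ m) · P)           ≡⟨ assoc (inv (m · P)) (m · P) ((n ℕ.∸ m) · P) ⟨
    (inv (m · P) ∙ m · P) ∙ (n ℕ.∸ m) · P           ≡⟨ cong (_∙ (n ℕ.∸ m) · P) (∙-inverseˡ (m · P)) ⟩
    ε ∙ (n ℕ.∸ m) · P                               ≡⟨ identityˡ ((n ℕ.∸ m) · P) ⟩
    (n ℕ.∸ m) · P                                   ∎

  torsion-inv : ∀ {P} → IsTorsion P → IsTorsion (inv P)
  torsion-inv {P} (n , n≢0 , nP) = n , n≢0 , (begin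
    n · inv P                ≡⟨ identityˡ (n · inv P) ⟨
    ε ∙ n · inv P            ≡⟨ cong (_∙ n · inv P) nP ⟨
    n · P ∙ n · inv P        ≡⟨ ×-distrib-+ P (inv P) n ⟨
    n · (P ∙ inv P)          ≡⟨ cong (n ·_) (trans (comm P (inv P)) (∙-inverseˡ P)) ⟩
    n · ε                    ≡⟨ ·-ε n ⟩
    ε                        ∎)

  cubes≡· : ∀ n P → cubes n P ≡ (3 ℕ.^ n) · P
  cubes≡· zero    P = sym (identityʳ P)
  cubes≡· (suc n) P = begin
    cubes n (cube P)          ≡⟨ cubes≡· n (cube P) ⟩
    (3 ℕ.^ n) · cube P        ≡⟨ cong (λ Q → (3 ℕ.^ n) · (P ∙ (P ∙ Q))) (identityʳ P) ⟨
    (3 ℕ.^ n) · (3 · P)       ≡⟨ ×-assocˡ P (3 ℕ.^ n) 3 ⟩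
    (3 ℕ.^ n ℕ.* 3) · P       ≡⟨ cong (_· P) (ℕₚ.*-comm (3 ℕ.^ n) 3) ⟩
    (3 ℕ.^ suc n) · P         ∎

  -- By pigeonhole two powers of 3 agree modulo the annihilating number, so two of the points `3ⁱ P`
  -- coincide. This also works when 3 divides that number.
  torsion-deep : ∀ P → IsTorsion P → Deep P → s P ≡ 0#
  torsion-deep P (zero  , n≢0 , _)    dp = ⊥-elim (n≢0 refl)
  torsion-deep P (suc n , _   , nP≡ε) dp = by-cases (s P ≟ 0#)
    where
    residue-of : Fin (suc (suc n)) → Fin (suc n)
    residue-of i = fromℕ< (m%n<n (3 ℕ.^ toℕ i) (suc n))
    by-cases : Dec (s P ≡ 0#) → s P ≡ 0#
    by-cases (yes s≡0) = s≡0
    by-cases (no  s≢0) =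
      let i , j , i<j , ri≡rj = Finₚ.pigeonhole ℕₚ.≤-refl residue-of
          %≡ = trans (sym (Finₚ.toℕ-fromℕ< (m%n<n (3 ℕ.^ toℕ i) (suc n))))
                (trans (cong toℕ ri≡rj) (Finₚ.toℕ-fromℕ< (m%n<n (3 ℕ.^ toℕ j) (suc n))))
      in ⊥-elim (cubes-injective (toℕ i) (toℕ j) P dp s≢0 i<j (begin
        cubes (toℕ i) P                    ≡⟨ cubes≡· (toℕ i) P ⟩
        (3 ℕ.^ toℕ i) · P                  ≡⟨ ·-% (3 ℕ.^ toℕ i) (suc n) nP≡ε ⟩
        (3 ℕ.^ toℕ i % suc n) · P          ≡⟨ cong (_· P) %≡ ⟩
        (3 ℕ.^ toℕ j % suc n) · P          ≡⟨ ·-% (3 ℕ.^ toℕ j) (suc n) nP≡ε ⟨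
        (3 ℕ.^ toℕ j) · P                  ≡⟨ cubes≡· (toℕ j) P ⟨
        cubes (toℕ j) P                    ∎))

  private
    -- The form in which "valuation at most 2" is used: `π²` is an integral multiple of `s P`.
    cofactor : ∀ {n P} → n ℕ.≤ 2 → Level n P → ∃ λ y → O y × s P * y ≡ π ^ 2
    cofactor {0} {P} _ (t , (_ , u , Ou , tu≡1) , eq) = π ^ 2 * u , O-* (O-^ 2 O-π) Ou ,
      trans (cong (_* (π ^ 2 * u)) eq) (solveMod (π ∷ t ∷ u ∷ []) (λ π t u → con 1 :* t :* (π :^ 2 :* u)
            := π :^ 2 given (t :* u := con 1 ∷ [])) (tu≡1 ∷ []))
    cofactor {1} {P} _ (t , (_ , u , Ou , tu≡1) , eq) = π * u , O-* O-π Ou ,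
      trans (cong (_* (π * u)) eq) (solveMod (π ∷ t ∷ u ∷ []) (λ π t u → π :* t :* (π :* u) := π :^ 2
            given (t :* u := con 1 ∷ [])) (tu≡1 ∷ []))
    cofactor {2} {P} _ (t , (_ , u , Ou , tu≡1) , eq) = u , Ou ,
      trans (cong (_* u) eq) (solveMod (π ∷ t ∷ u ∷ []) (λ π t u → π :^ 2 :* t :* u := π :^ 2
            given (t :* u := con 1 ∷ [])) (tu≡1 ∷ []))
    cofactor {suc (suc (suc _))} (ℕ.s≤s (ℕ.s≤s ()))

  -- s (P ∙ Q) s (P ∙ Q⁻¹) has valuation at least 5 if s P and s Q have the same
  -- valuation, while it would be at most 4 if neither factor were deep.
  same-level : ∀ n P Q → n ℕ.≤ 2 → Level n P → Level n Q → Deep (P ∙ Q) ⊎ Deep (P ∙ inv Q)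
  same-level n P Q n≤2 (t , Ut , s≡) (u , Uu , s≡′) = by-depth (depth (P ∙ Q)) (depth (P ∙ inv Q))
    where
    Ot = proj₁ Ut
    Ou = proj₁ Uu
    p : F
    p = π ^ n
    M-t²-u² : M (t ^ 2 - u ^ 2)
    M-t²-u² = subst M (solve (t ∷ u ∷ []) (λ t u → t :^ 2 :- con 1 :+ :- (u :^ 2 :- con 1) := t :^ 2 :- u :^ 2))
          (M-+ (M-square Ut) (M-neg (M-square Uu)))
    w = proj₁ M-t²-u²
    Ow = proj₁ (proj₂ M-t²-u²)
    w≡ : t ^ 2 - u ^ 2 ≡ π * w
    w≡ = proj₂ (proj₂ M-t²-u²)
    product : s (P ∙ Q) * s (P ∙ inv Q) * (1# - κ * (p * t) ^ 2 * (p * u) ^ 2) ≡ p ^ 2 * (π * w)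
    product = begin
      s (P ∙ Q) * s (P ∙ inv Q) * (1# - κ * (p * t) ^ 2 * (p * u) ^ 2)
        ≡⟨ cong₂ (λ x y → s (P ∙ Q) * s (P ∙ inv Q) * (1# - κ * x ^ 2 * y ^ 2)) s≡ s≡′ ⟨
      s (P ∙ Q) * s (P ∙ inv Q) * Δ P Q
        ≡⟨ sum-difference P Q ⟩
      s P ^ 2 - s Q ^ 2
        ≡⟨ cong₂ (λ x y → x ^ 2 - y ^ 2) s≡ s≡′ ⟩
      (p * t) ^ 2 - (p * u) ^ 2
        ≡⟨ solve (p ∷ t ∷ u ∷ []) (λ p t u → (p :* t) :^ 2 :- (p :* u) :^ 2 := p :^ 2 :* (t :^ 2 :- u :^ 2)) ⟩
      p ^ 2 * (t ^ 2 - u ^ 2)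
        ≡⟨ cong (p ^ 2 *_) w≡ ⟩
      p ^ 2 * (π * w) ∎
    U-ktu : Unit (k * (t * t) * (u * u))
    U-ktu = unit-* (unit-* Uk (unit-* Ut Ut)) (unit-* Uu Uu)
    -- The factor `π⁶` clears `κ`, whose term in `Δ` has valuation `4n − 6`. For `n` equal to 0 or 1
    -- this term dominates and the unit `k t² u²` would lie in `M`; for `n = 2` the term 1 dominates
    -- and 1 would lie in `M`.
    contradiction : ∀ n → n ℕ.≤ 2 → ∀ {y} → O y →
      π ^ 4 * (π ^ 6 * (1# - κ * (π ^ n * t) ^ 2 * (π ^ n * u) ^ 2)) ≡ π ^ 7 * ((π ^ n) ^ 2 * y) → ⊥
    contradiction 0 _ {y} Oy eq = ¬M-unit U-ktu
          (π ^ 2 * y - π ^ 5 , (integral (π ∷ y ∷ []) (λ π y → π :^ 2 :* y :- π :^ 5) (O-π ∷ Oy ∷ [])) ,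
          cancel-π 4 (begin
      π ^ 4 * (k * (t * t) * (u * u))
        ≡⟨ solveMod (κ ∷ k ∷ π ∷ t ∷ u ∷ []) (λ κ k π t u → π :^ 4 :* (k :* (t :* t) :* (u :* u))
              := π :^ 4 :* (π :^ 6 :* (con 1 :- κ :* (con 1 :* t) :^ 2 :* (con 1 :* u) :^ 2)) :- π :^ 10
              given (κ :* π :^ 6 := :- k ∷ [])) (κπ⁶ ∷ []) ⟩
      π ^ 4 * (π ^ 6 * (1# - κ * (1# * t) ^ 2 * (1# * u) ^ 2)) - π ^ 10
        ≡⟨ cong (_- π ^ 10) eq ⟩
      π ^ 7 * (1# ^ 2 * y) - π ^ 10
        ≡⟨ solve (π ∷ y ∷ []) (λ π y → π :^ 7 :* (con 1 :^ 2 :* y) :- π :^ 10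
              := π :^ 4 :* (π :* (π :^ 2 :* y :- π :^ 5))) ⟩
      π ^ 4 * (π * (π ^ 2 * y - π ^ 5)) ∎))
    contradiction 1 _ {y} Oy eq = ¬M-unit U-ktu
          (y - π , (integral (π ∷ y ∷ []) (λ π y → y :- π) (O-π ∷ Oy ∷ [])) , cancel-π 8 (begin
      π ^ 8 * (k * (t * t) * (u * u))
        ≡⟨ solveMod (κ ∷ k ∷ π ∷ t ∷ u ∷ []) (λ κ k π t u → π :^ 8 :* (k :* (t :* t) :* (u :* u))
              := π :^ 4 :* (π :^ 6 :* (con 1 :- κ :* (π :* t) :^ 2 :* (π :* u) :^ 2)) :- π :^ 10
              given (κ :* π :^ 6 := :- k ∷ [])) (κπ⁶ ∷ []) ⟩
      π ^ 4 * (π ^ 6 * (1# - κ * (π * t) ^ 2 * (π * u) ^ 2)) - π ^ 10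
        ≡⟨ cong (_- π ^ 10) eq ⟩
      π ^ 7 * (π ^ 2 * y) - π ^ 10
        ≡⟨ solve (π ∷ y ∷ []) (λ π y → π :^ 7 :* (π :^ 2 :* y) :- π :^ 10 := π :^ 8 :* (π :* (y :- π))) ⟩
      π ^ 8 * (π * (y - π)) ∎))
    contradiction 2 _ {y} Oy eq = ¬M-1
          (y - π * (k * (t * t) * (u * u)) ,
          (integral (π ∷ y ∷ k * (t * t) * (u * u) ∷ []) (λ π y z → y :- π :* z) (O-π ∷ Oy ∷ proj₁ U-ktu ∷ []))
          , cancel-π 10 (begin
      π ^ 10 * 1#
        ≡⟨ solveMod (κ ∷ k ∷ π ∷ t ∷ u ∷ []) (λ κ k π t u → π :^ 10 :* con 1
              := π :^ 4 :* (π :^ 6 :* (con 1 :- κ :* (π :^ 2 :* t) :^ 2 :* (π :^ 2 :* u) :^ 2)) :- π :^ 12 :*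
              (k :* (t :* t) :* (u :* u)) given (κ :* π :^ 6 := :- k ∷ [])) (κπ⁶ ∷ []) ⟩
      π ^ 4 * (π ^ 6 * (1# - κ * (π ^ 2 * t) ^ 2 * (π ^ 2 * u) ^ 2)) - π ^ 12 * (k * (t * t) * (u * u))
        ≡⟨ cong (_- π ^ 12 * (k * (t * t) * (u * u))) eq ⟩
      π ^ 7 * ((π ^ 2) ^ 2 * y) - π ^ 12 * (k * (t * t) * (u * u))
        ≡⟨ solve (π ∷ y ∷ k * (t * t) * (u * u) ∷ []) (λ π y z → π :^ 7 :* ((π :^ 2) :^ 2 :* y) :- π :^ 12 :* z
              := π :^ 10 :* (π :* (y :- π :* z))) ⟩
      π ^ 10 * (π * (y - π * (k * (t * t) * (u * u)))) ∎))
    contradiction (suc (suc (suc _))) (ℕ.s≤s (ℕ.s≤s ()))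
    by-depth : Depth (P ∙ Q) → Depth (P ∙ inv Q) → Deep (P ∙ Q) ⊎ Deep (P ∙ inv Q)
    by-depth (deep dp) _         = inj₁ dp
    by-depth _         (deep dp) = inj₂ dp
    by-depth (level i i≤2 lᵢ) (level j j≤2 lⱼ) =
      let y , Oy , y≡ = cofactor {i} {P ∙ Q} i≤2 lᵢ
          z , Oz , z≡ = cofactor {j} {P ∙ inv Q} j≤2 lⱼ
      in ⊥-elim (contradiction n n≤2 {w * y * z} (O-* (O-* Ow Oy) Oz) (begin
        π ^ 4 * (π ^ 6 * (1# - κ * (p * t) ^ 2 * (p * u) ^ 2))
          ≡⟨ solve (π ∷ 1# - κ * (p * t) ^ 2 * (p * u) ^ 2 ∷ []) (λ π x → π :^ 4 :* (π :^ 6 :* x)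
                := π :^ 2 :* π :^ 2 :* x :* π :^ 6) ⟩
        π ^ 2 * π ^ 2 * (1# - κ * (p * t) ^ 2 * (p * u) ^ 2) * π ^ 6
          ≡⟨ cong₂ (λ a b → a * b * (1# - κ * (p * t) ^ 2 * (p * u) ^ 2) * π ^ 6) y≡ z≡ ⟨
        s (P ∙ Q) * y * (s (P ∙ inv Q) * z) * (1# - κ * (p * t) ^ 2 * (p * u) ^ 2) * π ^ 6
          ≡⟨ solve (s (P ∙ Q) ∷ s (P ∙ inv Q) ∷ y ∷ z ∷ π ∷ 1# - κ * (p * t) ^ 2 * (p * u) ^ 2 ∷ [])
                (λ a b y z π x → a :* y :* (b :* z) :* x :* π :^ 6 := a :* b :* x :* (y :* z) :* π :^ 6) ⟩
        s (P ∙ Q) * s (P ∙ inv Q) * (1# - κ * (p * t) ^ 2 * (p * u) ^ 2) * (y * z) * π ^ 6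
          ≡⟨ cong (λ v → v * (y * z) * π ^ 6) product ⟩
        p ^ 2 * (π * w) * (y * z) * π ^ 6
          ≡⟨ solve (p ∷ π ∷ w ∷ y ∷ z ∷ []) (λ p π w y z → p :^ 2 :* (π :* w) :* (y :* z) :* π :^ 6
                := π :^ 7 :* (p :^ 2 :* (w :* y :* z))) ⟩
        π ^ 7 * (p ^ 2 * (w * y * z)) ∎))

  torsion-same-level : ∀ n P Q → n ℕ.≤ 2 → Level n P → Level n Q → IsTorsion P → IsTorsion Q →
                       s (P ∙ Q) ≡ 0# ⊎ s (P ∙ inv Q) ≡ 0#
  torsion-same-level n P Q n≤2 lP lQ tP tQ = by-cases (same-level n P Q n≤2 lP lQ)
    where
    by-cases : Deep (P ∙ Q) ⊎ Deep (P ∙ inv Q) → s (P ∙ Q) ≡ 0# ⊎ s (P ∙ inv Q) ≡ 0#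
    by-cases (inj₁ dp) = inj₁ (torsion-deep (P ∙ Q) (torsion-∙ tP tQ) dp)
    by-cases (inj₂ dp) = inj₂ (torsion-deep (P ∙ inv Q) (torsion-∙ tP (torsion-inv tQ)) dp)

-- The family of triples and its torsion group.

-- The triple a = α, b = −1/α, c = (m² − 1)/α with α² = m (m + 2), 2 m + 1 = q²;
-- here α is the uniformizer π.
module Family {𝔽 : Field} (𝕆 : ValuationRing 𝔽) (m q e : Field.F 𝔽)
    (q²≡ : Field._^_ 𝔽 q 2 ≡ Field._+_ 𝔽 (Field._*_ 𝔽 (Field.nat 𝔽 2) m) (Field.1# 𝔽))
    (π²≡ : Field._^_ 𝔽 (ValuationRing.π 𝕆) 2 ≡ Field._*_ 𝔽 m (Field._+_ 𝔽 m (Field.nat 𝔽 2)))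
    (Mm : ValuationRingProperties.M 𝕆 m)
    (3≡π²e : Field.nat 𝔽 3 ≡ Field._*_ 𝔽 (Field._^_ 𝔽 (ValuationRing.π 𝕆) 2) e)
    (Me-1 : ValuationRingProperties.M 𝕆 (Field._-_ 𝔽 e (Field.1# 𝔽))) where
  open Field 𝔽
  open Solver 𝔽 using (Exprs; Equation; Problem; applyVars; norm; rules; isZero; ⟦_⟧ᵉ; solve;
        solveMod; con; _:+_; _:*_; :-_; _:-_; _:^_; _:=_; _given_)
  open FieldProperties 𝔽
  open ValuationRing 𝕆
  open ValuationRingProperties 𝕆
  open ≡-Reasoning

  private
    Om : O m
    Om = M⇒O Mm

    Oe : O e
    Oe = proj₁ (unit-near-1 Me-1)

    M-3 : M (nat 3)
    M-3 = π * e , O-* O-π Oe , trans 3≡π²e (solve (π ∷ e ∷ []) (λ π e → π :^ 2 :* e := π :* (π :* e)))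

  2≢0 : nat 2 ≢ 0#
  2≢0 2≡0 = ¬M-2 M-3 (subst M (sym 2≡0) M-0)

  U-m+1 : Unit (m + 1#)
  U-m+1 = unit-near-1 (subst M (solve (m ∷ []) (λ m → m := m :+ con 1 :- con 1)) Mm)

  U-m-1 : Unit (m - 1#)
  U-m-1 = [ (λ Mm-1 → ⊥-elim (¬M-1
        (subst M (solve (m ∷ []) (λ m → m :- (m :- con 1) := con 1)) (M-+ Mm (M-neg Mm-1))))) , (λ U → U) ]′
    (M-or-unit (integral (m ∷ []) (λ m → m :- con 1) (Om ∷ [])))

  U-m+2 : Unit (m + nat 2)
  U-m+2 = [ (λ Mm+2 → ⊥-elim (¬M-2 M-3
        (subst M (solve (m ∷ []) (λ m → m :+ con 2 :- m := con 2)) (M-+ Mm+2 (M-neg Mm))))) , (λ U → U) ]′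
    (M-or-unit (integral (m ∷ []) (λ m → m :+ con 2) (Om ∷ [])))

  q≢0 : q ≢ 0#
  q≢0 q≡0 = ¬M-1 (subst M
    (trans (solve (m ∷ []) (λ m → :- (con 2 :* m) := con 1 :- (con 2 :* m :+ con 1)))
          (trans (cong (λ t → 1# - t) (trans (sym q²≡) (trans (cong (_^ 2) q≡0) (zeroˡ 0#))))
          (trans (cong (1# +_) -0#≈0#) (+-identityʳ 1#))))
    (M-neg (M-* (O-nat 2) Mm)))

  m≢0 : m ≢ 0#
  m≢0 m≡0 = *-≢0 π≢0 π≢0 (trans π²≡ (trans (cong (_* (m + nat 2)) m≡0) (zeroˡ _)))

  μ ϖ j : F
  μ = m ⁻¹
  ϖ = π ⁻¹
  j = (m + 1#) ⁻¹

  private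
    m*μ : m * μ ≡ 1#
    m*μ = inverseʳ m m≢0

    π*ϖ : π * ϖ ≡ 1#
    π*ϖ = inverseʳ π π≢0

    m*j : m * j ≡ 1# - j
    m*j = trans (solve (m ∷ j ∷ []) (λ m j → m :* j := (m :+ con 1) :* j :- j))
          (cong (_- j) (inverseʳ (m + 1#) (unit≢0 U-m+1)))

    μ*j : μ * j ≡ μ - j
    μ*j = trans (solveMod (m ∷ μ ∷ j ∷ []) (λ m u j → u :* j := u :* (m :* j :+ j) :- j
          given (m :* u := con 1 ∷ [])) (m*μ ∷ []))
      (trans (cong (λ t → μ * (t + j) - j) m*j) (solve (μ ∷ j ∷ []) (λ u j → u :* (con 1 :- j :+ j) :- j := u :- j)))

    -- This is `π² = m (m + 2)` divided by `m π`; `μ²`, `π*j` and `ϖ²*j` also follow from the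
    -- defining relations. Such consequences are what makes the rewriting in `relations` confluent.
    m*ϖ : m * ϖ ≡ π * μ - nat 2 * ϖ
    m*ϖ = begin
      m * ϖ                                 ≡⟨ solveMod (m ∷ ϖ ∷ μ ∷ []) (λ m w u → m :* w
            := m :* (m :+ con 2) :* w :* u :- con 2 :* w given (m :* u := con 1 ∷ [])) (m*μ ∷ []) ⟩
      m * (m + nat 2) * ϖ * μ - nat 2 * ϖ   ≡⟨ cong (λ t → t * ϖ * μ - nat 2 * ϖ) π²≡ ⟨
      π ^ 2 * ϖ * μ - nat 2 * ϖ             ≡⟨
            solveMod (ϖ ∷ μ ∷ π ∷ []) (λ w u π → π :^ 2 :* w :* u :- con 2 :* w := π :* u :- con 2 :* w
            given (π :* w := con 1 ∷ [])) (π*ϖ ∷ []) ⟩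
      π * μ - nat 2 * ϖ                     ∎

    μ² : μ ^ 2 ≡ ϖ ^ 2 + nat 2 * ϖ ^ 2 * μ
    μ² = begin
      μ ^ 2                                 ≡⟨ solveMod (μ ∷ π ∷ ϖ ∷ []) (λ u π w → u :^ 2
            := π :^ 2 :* (w :^ 2 :* u :^ 2) given (π :* w := con 1 ∷ [])) (π*ϖ ∷ []) ⟩
      π ^ 2 * (ϖ ^ 2 * μ ^ 2)               ≡⟨ cong (_* (ϖ ^ 2 * μ ^ 2)) π²≡ ⟩
      m * (m + nat 2) * (ϖ ^ 2 * μ ^ 2)     ≡⟨
            solveMod (m ∷ μ ∷ ϖ ∷ []) (λ m u w → m :* (m :+ con 2) :* (w :^ 2 :* u :^ 2)
            := w :^ 2 :+ con 2 :* w :^ 2 :* u given (m :* u := con 1 ∷ [])) (m*μ ∷ []) ⟩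
      ϖ ^ 2 + nat 2 * ϖ ^ 2 * μ             ∎

    π*j : π * j ≡ π * μ - ϖ - ϖ * j
    π*j = begin
      π * j                                                ≡⟨ solveMod (μ ∷ ϖ ∷ j ∷ π ∷ []) (λ u w j π → π :* j
            := π :* u :- (π :* u :- con 2 :* w) :* j :- con 2 :* w :* j given (u :* j := u :- j ∷ []))
            (μ*j ∷ []) ⟩
      π * μ - (π * μ - nat 2 * ϖ) * j - nat 2 * ϖ * j      ≡⟨ cong (λ t → π * μ - t * j - nat 2 * ϖ * j) m*ϖ ⟨
      π * μ - m * ϖ * j - nat 2 * ϖ * j                    ≡⟨
            solveMod (m ∷ μ ∷ ϖ ∷ j ∷ π ∷ []) (λ m u w j π → π :* u :- m :* w :* j :- con 2 :* w :* j
            := π :* u :- w :- w :* j given (m :* j := con 1 :- j ∷ [])) (m*j ∷ []) ⟩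
      π * μ - ϖ - ϖ * j                                    ∎

    ϖ²*j : ϖ ^ 2 * j ≡ μ - ϖ ^ 2 - j
    ϖ²*j = begin
      ϖ ^ 2 * j                                            ≡⟨ solveMod (μ ∷ ϖ ∷ j ∷ []) (λ u w j → w :^ 2 :* j
            := con 2 :* w :^ 2 :* u :- (w :^ 2 :+ con 2 :* w :^ 2 :* u) :* j given (u :* j := u :- j ∷ []))
            (μ*j ∷ []) ⟩
      nat 2 * ϖ ^ 2 * μ - (ϖ ^ 2 + nat 2 * ϖ ^ 2 * μ) * j  ≡⟨ cong (λ t → nat 2 * ϖ ^ 2 * μ - t * j) μ² ⟨
      nat 2 * ϖ ^ 2 * μ - μ ^ 2 * j                        ≡⟨
            solveMod (μ ∷ ϖ ∷ j ∷ []) (λ u w j → con 2 :* w :^ 2 :* u :- u :^ 2 :* j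
            := con 2 :* w :^ 2 :* u :- u :^ 2 :+ u :- j given (u :* j := u :- j ∷ [])) (μ*j ∷ []) ⟩
      nat 2 * ϖ ^ 2 * μ - μ ^ 2 + μ - j                    ≡⟨
            solveMod (μ ∷ ϖ ∷ j ∷ []) (λ u w j → con 2 :* w :^ 2 :* u :- u :^ 2 :+ u :- j := u :- w :^ 2 :- j
            given (u :^ 2 := w :^ 2 :+ con 2 :* w :^ 2 :* u ∷ [])) (μ² ∷ []) ⟩
      μ - ϖ ^ 2 - j                                        ∎

  a b c κ k ρ : F
  a = π
  b = - ϖ
  c = (m ^ 2 - 1#) * ϖ
  κ = (m - 1#) * (m + 1#) ^ 3 * μ ^ 2 * ϖ ^ 2
  k = (1# - m) * (m + 1#) ^ 3 * (m + nat 2) ^ 2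
  ρ = q * μ * ϖ

  private
    -- A confluent set of rewrite rules for the ring generated by m, 1/m, π, 1/π, 1/(m+1), q.
    relations : Exprs 7 (List Equation)
    relations m μ π ϖ j q κ =
      κ := (m :- con 1) :* (m :+ con 1) :^ 3 :* μ :^ 2 :* ϖ :^ 2 ∷
      m :* μ := con 1 ∷ π :* ϖ := con 1 ∷ m :* j := con 1 :- j ∷ μ :* j := μ :- j ∷
      π :^ 2 := m :^ 2 :+ con 2 :* m ∷ q :^ 2 := con 2 :* m :+ con 1 ∷ m :* ϖ := π :* μ :- con 2 :* ϖ ∷
      μ :^ 2 := ϖ :^ 2 :+ con 2 :* ϖ :^ 2 :* μ ∷ π :* j := π :* μ :- ϖ :- ϖ :* j ∷ ϖ :^ 2 :* j
            := μ :- ϖ :^ 2 :- j ∷ []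

    by-relations : (f : Exprs 7 Equation) (let p = λ m μ π ϖ j q κ → f m μ π ϖ j q κ given relations m μ π ϖ j q κ) →
      {_ : T (isZero (norm (rules (Problem.hyps (applyVars 7 0 p)))
            (Equation.lhs (applyVars 7 0 f) :- Equation.rhs (applyVars 7 0 f))))} →
      ⟦ applyVars 7 0 f ⟧ᵉ (m ∷ μ ∷ π ∷ ϖ ∷ j ∷ q ∷ κ ∷ [])
    by-relations f {z} = solveMod (m ∷ μ ∷ π ∷ ϖ ∷ j ∷ q ∷ κ ∷ []) (λ m μ π ϖ j q κ → f m μ π ϖ j q κ
          given relations m μ π ϖ j q κ)
      (refl ∷ m*μ ∷ π*ϖ ∷ m*j ∷ μ*j ∷ trans π²≡
            (solve (m ∷ []) (λ m → m :* (m :+ con 2) := m :^ 2 :+ con 2 :* m)) ∷ q²≡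
            ∷ m*ϖ ∷ μ² ∷ π*j ∷ ϖ²*j ∷ []) {z}

  ϖ≢0 : ϖ ≢ 0#
  ϖ≢0 = ≢0-factor (trans (*-comm ϖ π) π*ϖ)

  abc≢0 : a * b * c ≢ 0#
  abc≢0 abc≡0 = *-≢0 (*-≢0 (unit≢0 U-m-1) (unit≢0 U-m+1)) ϖ≢0
    (trans (by-relations (λ m μ π ϖ j q κ → (m :- con 1) :* (m :+ con 1) :* ϖ
          := :- (π :* :- ϖ :* ((m :^ 2 :- con 1) :* ϖ)))) (trans (cong -_ abc≡0) -0#≈0#))

  scale : μ ^ 2 * (a * c - a * b) ≡ 1#
  scale = by-relations (λ m μ π ϖ j q κ → μ :^ 2 :* (π :* ((m :^ 2 :- con 1) :* ϖ) :- π :* :- ϖ) := con 1)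

  κ-def : κ ≡ μ ^ 2 * (a * c - b * c)
  κ-def = by-relations (λ m μ π ϖ j q κ → κ
        := μ :^ 2 :* (π :* ((m :^ 2 :- con 1) :* ϖ) :- :- ϖ :* ((m :^ 2 :- con 1) :* ϖ)))

  private
    κπ⁶ : κ * π ^ 6 ≡ - k
    κπ⁶ = by-relations (λ m μ π ϖ j q κ → κ :* π :^ 6 := :- ((con 1 :- m) :* (m :+ con 1) :^ 3 :* (m :+ con 2) :^ 2))

    Mk-1 : M (k - 1#)
    Mk-1 = subst M (solve (m ∷ []) (λ m →
          con 3 :+ (con 12 :+ con 9 :* m :- con 6 :* m :^ 2 :- con 12 :* m :^ 3 :- con 6 :* m :^ 4 :- m :^ 5)
          :* m := (con 1 :- m) :* (m :+ con 1) :^ 3 :* (m :+ con 2) :^ 2 :- con 1))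
      (M-+ M-3 (M-* (integral (m ∷ [])
            (λ m → con 12 :+ con 9 :* m :- con 6 :* m :^ 2 :- con 12 :* m :^ 3 :- con 6 :* m :^ 4 :- m :^ 5)
            (Om ∷ [])) Mm))

  κ-nonsquare : ∀ x → x ^ 2 ≢ κ
  κ-nonsquare = NonSquare.nonsquare 𝕆 M-3 κπ⁶ Mk-1

  a≢0 : a ≢ 0#
  a≢0 = π≢0

  b≢0 : b ≢ 0#
  b≢0 b≡0 = ϖ≢0 (trans (sym (-‿involutive ϖ)) (trans (cong -_ b≡0) -0#≈0#))

  c≢0 : c ≢ 0#
  c≢0 = *-≢0 (λ eq → *-≢0 (unit≢0 U-m-1) (unit≢0 U-m+1)
        (trans (solve (m ∷ []) (λ m → (m :- con 1) :* (m :+ con 1) := m :^ 2 :- con 1)) eq)) ϖ≢0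

  a≢b : a ≢ b
  a≢b a≡b = *-≢0 (unit≢0 U-m+1) (unit≢0 U-m+1)
        (trans (by-relations (λ m μ π ϖ j q κ → (m :+ con 1) :* (m :+ con 1) := π :* (π :- :- ϖ)))
        (trans (cong (π *_) (≡⇒-≡0 a≡b)) (zeroʳ π)))

  a≢c : a ≢ c
  a≢c a≡c = *-≢0 q≢0 q≢0 (trans (by-relations (λ m μ π ϖ j q κ → q :* q := π :* (π :- (m :^ 2 :- con 1) :* ϖ)))
        (trans (cong (π *_) (≡⇒-≡0 a≡c)) (zeroʳ π)))

  b≢c : b ≢ c
  b≢c b≡c = *-≢0 m≢0 m≢0 (trans (by-relations (λ m μ π ϖ j q κ → m :* m
        := :- (π :* (:- ϖ :- (m :^ 2 :- con 1) :* ϖ))))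
        (trans (cong (λ t → - (π * t)) (≡⇒-≡0 b≡c)) (trans (cong -_ (zeroʳ π)) -0#≈0#)))

  square-ab : 0# * 0# ≡ a * b + 1#
  square-ab = by-relations (λ m μ π ϖ j q κ → con 0 :* con 0 := π :* :- ϖ :+ con 1)

  square-ac : m * m ≡ a * c + 1#
  square-ac = by-relations (λ m μ π ϖ j q κ → m :* m := π :* ((m :^ 2 :- con 1) :* ϖ) :+ con 1)

  square-bc : (q * ϖ) * (q * ϖ) ≡ b * c + 1#
  square-bc = by-relations (λ m μ π ϖ j q κ → (q :* ϖ) :* (q :* ϖ) := :- ϖ :* ((m :^ 2 :- con 1) :* ϖ) :+ con 1)

  module 𝕁 = JacobiGroup 𝔽 κ κ-nonsquare
  open 𝕁 using (J; jac; J-≡; _∙_; ε; inv; s; ∙-by)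
  open Legendre 𝔽 κ κ-nonsquare 2≢0 using (cubic; δ-inverse)
  open ChordTangent 𝔽 a b c using (Point; ∞; OnCurve; _⊕_; _·ᴾ_)
  open Uniformization 𝔽 a b c μ κ κ-nonsquare 2≢0 abc≢0 scale κ-def
  open Torsion 𝕆 κ k e κπ⁶ Mk-1 3≡π²e Me-1 κ-nonsquare
  open AbelianGroup 𝕁.abelianGroup using (assoc; comm; identityˡ; identityʳ) renaming (inverseʳ to inverseʳ′)

  private
    -- Membership in the image of `Φ`, shown for `jacᵃ`, `jacᵇ` and `jacᵖ` by explicit points and
    -- passed on to sums by `⊕-sum`.
    OverJ : J → Set
    OverJ Q = Σ Point λ P → Σ (OnCurve P) λ p → Φ P p ≡ Q

    -- `jacᵃ` and `G₆` are the 2-torsion points over `X = κ` and `X = 1`. `jacᵇ` is a half of `G₆`,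
    -- so of order 4; `jacᵖ` has order 6. Their sum `G` has order 12, and `G₂`, `G₃`, `G₆` are its
    -- multiples.
    jacᵃ jacᵇ jacᵖ G G₂ G₃ G₆ : J
    jacᵃ = jac 0# 1# (- 1#) (by-relations (λ m μ π ϖ j q κ → con 1 :^ 2 := con 1 :- con 0 :^ 2))
          (by-relations (λ m μ π ϖ j q κ → (:- con 1) :^ 2 := con 1 :- κ :* con 0 :^ 2))
    jacᵇ = jac (- 1#) 0# ρ (by-relations (λ m μ π ϖ j q κ → con 0 :^ 2 := con 1 :- (:- con 1) :^ 2))
          (by-relations (λ m μ π ϖ j q κ → (q :* μ :* ϖ) :^ 2 := con 1 :- κ :* (:- con 1) :^ 2))
    jacᵖ = jac (- (π * j)) j (- μ) (by-relations (λ m μ π ϖ j q κ → j :^ 2 := con 1 :- (:- (π :* j)) :^ 2))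
          (by-relations (λ m μ π ϖ j q κ → (:- μ) :^ 2 := con 1 :- κ :* (:- (π :* j)) :^ 2))
    G  = jac (m * j) (q * j) (- (q * ϖ)) (by-relations (λ m μ π ϖ j q κ → (q :* j) :^ 2
          := con 1 :- (m :* j) :^ 2)) (by-relations (λ m μ π ϖ j q κ → (:- (q :* ϖ)) :^ 2
          := con 1 :- κ :* (m :* j) :^ 2))
    G₂ = jac (- (π * j)) j μ (by-relations (λ m μ π ϖ j q κ → j :^ 2 := con 1 :- (:- (π :* j)) :^ 2))
          (by-relations (λ m μ π ϖ j q κ → μ :^ 2 := con 1 :- κ :* (:- (π :* j)) :^ 2))
    G₃ = jac 1# 0# (- ρ) (by-relations (λ m μ π ϖ j q κ → con 0 :^ 2 := con 1 :- con 1 :^ 2))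
          (by-relations (λ m μ π ϖ j q κ → (:- (q :* μ :* ϖ)) :^ 2 := con 1 :- κ :* con 1 :^ 2))
    G₆ = jac 0# (- 1#) 1# (by-relations (λ m μ π ϖ j q κ → (:- con 1) :^ 2 := con 1 :- con 0 :^ 2))
          (by-relations (λ m μ π ϖ j q κ → con 1 :^ 2 := con 1 :- κ :* con 0 :^ 2))

    G≡ : jacᵇ ∙ jacᵖ ≡ G
    G≡ = ∙-by jacᵇ jacᵖ
      (by-relations (λ m μ π ϖ j q κ → :- con 1 :* j :* :- μ :+ :- (π :* j) :* con 0 :* (q :* μ :* ϖ)
            := m :* j :* (con 1 :- κ :* (:- con 1) :^ 2 :* (:- (π :* j)) :^ 2)))
      (by-relations (λ m μ π ϖ j q κ → con 0 :* j :- :- con 1 :* :- (π :* j) :* (q :* μ :* ϖ) :* :- μ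
            := q :* j :* (con 1 :- κ :* (:- con 1) :^ 2 :* (:- (π :* j)) :^ 2)))
      (by-relations (λ m μ π ϖ j q κ → q :* μ :* ϖ :* :- μ :- κ :* :- con 1 :* :- (π :* j) :* con 0 :* j
            := :- (q :* ϖ) :* (con 1 :- κ :* (:- con 1) :^ 2 :* (:- (π :* j)) :^ 2)))

    G₂≡ : G ∙ G ≡ G₂
    G₂≡ = ∙-by G G
      (by-relations (λ m μ π ϖ j q κ → m :* j :* (q :* j) :* :- (q :* ϖ) :+ m :* j :* (q :* j) :* :- (q :* ϖ)
            := :- (π :* j) :* (con 1 :- κ :* (m :* j) :^ 2 :* (m :* j) :^ 2)))
      (by-relations (λ m μ π ϖ j q κ → q :* j :* (q :* j) :- m :* j :* (m :* j) :* :- (q :* ϖ) :* :- (q :* ϖ)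
            := j :* (con 1 :- κ :* (m :* j) :^ 2 :* (m :* j) :^ 2)))
      (by-relations (λ m μ π ϖ j q κ → :- (q :* ϖ) :* :- (q :* ϖ) :- κ :* (m :* j) :* (m :* j) :* (q :* j) :*
            (q :* j) := μ :* (con 1 :- κ :* (m :* j) :^ 2 :* (m :* j) :^ 2)))

    G₃≡ : G ∙ G₂ ≡ G₃
    G₃≡ = ∙-by G G₂
      (by-relations (λ m μ π ϖ j q κ → m :* j :* j :* μ :+ :- (π :* j) :* (q :* j) :* :- (q :* ϖ)
            := con 1 :* (con 1 :- κ :* (m :* j) :^ 2 :* (:- (π :* j)) :^ 2)))
      (by-relations (λ m μ π ϖ j q κ → q :* j :* j :- m :* j :* :- (π :* j) :* :- (q :* ϖ) :* μ
            := con 0 :* (con 1 :- κ :* (m :* j) :^ 2 :* (:- (π :* j)) :^ 2)))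
      (by-relations (λ m μ π ϖ j q κ → :- (q :* ϖ) :* μ :- κ :* (m :* j) :* :- (π :* j) :* (q :* j) :* j
            := :- (q :* μ :* ϖ) :* (con 1 :- κ :* (m :* j) :^ 2 :* (:- (π :* j)) :^ 2)))

    G₆≡ : G₃ ∙ G₃ ≡ G₆
    G₆≡ = ∙-by G₃ G₃
      (by-relations (λ m μ π ϖ j q κ → con 1 :* con 0 :* :- (q :* μ :* ϖ) :+ con 1 :* con 0 :* :- (q :* μ :* ϖ)
            := con 0 :* (con 1 :- κ :* con 1 :^ 2 :* con 1 :^ 2)))
      (by-relations (λ m μ π ϖ j q κ → con 0 :* con 0 :- con 1 :* con 1 :* :- (q :* μ :* ϖ) :* :- (q :* μ :* ϖ)
            := :- con 1 :* (con 1 :- κ :* con 1 :^ 2 :* con 1 :^ 2)))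
      (by-relations (λ m μ π ϖ j q κ →
            :- (q :* μ :* ϖ) :* :- (q :* μ :* ϖ) :- κ :* con 1 :* con 1 :* con 0 :* con 0
            := con 1 :* (con 1 :- κ :* con 1 :^ 2 :* con 1 :^ 2)))

    2-torsion : ∀ P → s P ≡ 0# → P ∙ P ≡ ε
    2-torsion P s≡0 = trans (cong (_∙ P)
          (J-≡ {P} {inv P} (trans s≡0 (trans (sym -0#≈0#) (cong -_ (sym s≡0)))) refl refl)) (𝕁.∙-inverseˡ P)

    2·≡ : ∀ P → 2 · P ≡ P ∙ P
    2·≡ P = cong (P ∙_) (identityʳ P)

    2·G : 2 · G ≡ G₂
    2·G = trans (2·≡ G) G₂≡

    3·G : 3 · G ≡ G₃
    3·G = trans (cong (G ∙_) 2·G) G₃≡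

    6·G : 6 · G ≡ G₆
    6·G = trans (sym (×-assocˡ G 2 3)) (trans (cong (2 ·_) 3·G) (trans (2·≡ G₃) G₆≡))

    12·G : 12 · G ≡ ε
    12·G = trans (sym (×-assocˡ G 2 6)) (trans (cong (2 ·_) 6·G) (trans (2·≡ G₆) (2-torsion G₆ refl)))

    2·A : 2 · jacᵃ ≡ ε
    2·A = trans (2·≡ jacᵃ) (2-torsion jacᵃ refl)

    -- Every proper divisor of 12 divides 4 or 6, so this and `6·G≢ε` fix the order of `G`.
    4·G≢ε : 4 · G ≢ ε
    4·G≢ε eq = *-≢0 (*-≢0 (*-≢0 2≢0 (*-≢0 π≢0 j≢0)) (*-≢0 j≢0 μ≢0))
          (≢0-factor (trans (*-comm _ _) (𝕁.Δ-inverse G₂ G₂))) (begin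
      nat 2 * (π * j) * (j * μ) * 𝕁.Δ⁻¹ G₂ G₂
        ≡⟨ solve (π ∷ j ∷ μ ∷ 𝕁.Δ⁻¹ G₂ G₂ ∷ []) (λ π j u i → con 2 :* (π :* j) :* (j :* u) :* i
              := :- ((:- (π :* j) :* j :* u :+ :- (π :* j) :* j :* u) :* i)) ⟩
      - s (G₂ ∙ G₂)
        ≡⟨ cong (λ Q → - s Q) (trans (sym (2·≡ G₂)) (trans (cong (2 ·_) (sym 2·G)) (trans (×-assocˡ G 2 2) eq))) ⟩
      - 0#
        ≡⟨ -0#≈0# ⟩
      0# ∎)
      where
      j≢0 : j ≢ 0#
      j≢0 = ≢0-factor (trans (*-comm j _) (inverseʳ (m + 1#) (unit≢0 U-m+1)))
      μ≢0 : μ ≢ 0#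
      μ≢0 = ≢0-factor (trans (*-comm μ m) m*μ)

    -1≢1 : - 1# ≢ 1#
    -1≢1 eq = 2≢0 (trans (cong (1# +_) (sym eq)) (-‿inverseʳ 1#))

    6·G≢ε : 6 · G ≢ ε
    6·G≢ε eq = -1≢1 (cong 𝕁.c (trans (sym 6·G) eq))

  -- The subgroup generated by a point of order 2 and a point of order 12.
  el : ℕ → ℕ → J
  el i j = i · jacᵃ ∙ j · G

  el-+ : ∀ i i′ j j′ → el (i ℕ.+ i′) (j ℕ.+ j′) ≡ el i j ∙ el i′ j′
  el-+ i i′ j j′ = begin
    (i ℕ.+ i′) · jacᵃ ∙ (j ℕ.+ j′) · G    ≡⟨ cong₂ _∙_ (×-homo-+ jacᵃ i i′) (×-homo-+ G j j′) ⟩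
    (w ∙ x) ∙ (y ∙ z)                     ≡⟨ assoc w x (y ∙ z) ⟩
    w ∙ (x ∙ (y ∙ z))                     ≡⟨ cong (w ∙_) (assoc x y z) ⟨
    w ∙ ((x ∙ y) ∙ z)                     ≡⟨ cong (λ t → w ∙ (t ∙ z)) (comm x y) ⟩
    w ∙ ((y ∙ x) ∙ z)                     ≡⟨ cong (w ∙_) (assoc y x z) ⟩
    w ∙ (y ∙ (x ∙ z))                     ≡⟨ assoc w y (x ∙ z) ⟨
    el i j ∙ el i′ j′                     ∎
    where
    w x y z : J
    w = i · jacᵃ
    x = i′ · jacᵃ
    y = j · G
    z = j′ · G

  el-% : ∀ i j → el i j ≡ el (i % 2) (j % 12)
  el-% i j = cong₂ _∙_ (·-% i 2 2·A) (·-% j 12 12·G)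

  private
    ·-by : ∀ r t n → (r ℕ.* t) % 12 ≡ n → t · G ≡ ε → n · G ≡ ε
    ·-by r t n refl eq = trans (sym (·-% (r ℕ.* t) 12 12·G)) (·-annihilates r t eq)

    double : ∀ i j → el i j ≡ ε → (2 ℕ.* j) · G ≡ ε
    double i j eq = begin
      (2 ℕ.* j) · G                   ≡⟨ ×-assocˡ G 2 j ⟨
      2 · (j · G)                     ≡⟨ identityˡ (2 · (j · G)) ⟨
      ε ∙ 2 · (j · G)                 ≡⟨
            cong (_∙ 2 · (j · G)) (trans (×-assocˡ jacᵃ 2 i)
            (trans (cong (_· jacᵃ) (ℕₚ.*-comm 2 i)) (·-annihilates i 2 2·A))) ⟨
      2 · (i · jacᵃ) ∙ 2 · (j · G)    ≡⟨ ×-distrib-+ (i · jacᵃ) (j · G) 2 ⟨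
      2 · el i j                      ≡⟨ cong (2 ·_) eq ⟩
      2 · ε                           ≡⟨ ·-ε 2 ⟩
      ε                               ∎

    el-6 : ∀ i → el i 6 ≡ i · jacᵃ ∙ G₆
    el-6 i = cong (i · jacᵃ ∙_) 6·G

    A∙G₆ : jacᵃ ∙ G₆ ≡ jac 0# (- 1#) (- 1#) (by-relations (λ m μ π ϖ j q κ → (:- con 1) :^ 2
          := con 1 :- con 0 :^ 2)) (by-relations (λ m μ π ϖ j q κ → (:- con 1) :^ 2
          := con 1 :- κ :* con 0 :^ 2))
    A∙G₆ = ∙-by jacᵃ G₆
      (by-relations (λ m μ π ϖ j q κ → con 0 :* :- con 1 :* con 1 :+ con 0 :* con 1 :* :- con 1
            := con 0 :* (con 1 :- κ :* con 0 :^ 2 :* con 0 :^ 2)))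
      (by-relations (λ m μ π ϖ j q κ → con 1 :* :- con 1 :- con 0 :* con 0 :* :- con 1 :* con 1
            := :- con 1 :* (con 1 :- κ :* con 0 :^ 2 :* con 0 :^ 2)))
      (by-relations (λ m μ π ϖ j q κ → :- con 1 :* con 1 :- κ :* con 0 :* con 0 :* con 1 :* :- con 1
            := :- con 1 :* (con 1 :- κ :* con 0 :^ 2 :* con 0 :^ 2)))

    1·A : 1 · jacᵃ ≡ jacᵃ
    1·A = identityʳ jacᵃ

    -- Doubling removes `jacᵃ`. Unless `j` is 0 or 6, some multiple of `2 j` is 4 or 6 modulo 12; in
    -- the two exceptional cases a non-trivial 2-torsion point is told from `ε` by a coordinate -1.
    kernel′ : ∀ i j → i ℕ.< 2 → j ℕ.< 12 → el i j ≡ ε → i ≡ 0 × j ≡ 0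
    kernel′ 0 0 _ _ _ = refl , refl
    kernel′ 1 0 _ _ eq = ⊥-elim (-1≢1 (cong 𝕁.d (trans (sym (trans (identityʳ (1 · jacᵃ)) 1·A)) eq)))
    kernel′ i 1 _ _ eq = ⊥-elim (4·G≢ε (·-by 2 2 4 refl (double i 1 eq)))
    kernel′ i 2 _ _ eq = ⊥-elim (4·G≢ε (·-by 1 4 4 refl (double i 2 eq)))
    kernel′ i 3 _ _ eq = ⊥-elim (6·G≢ε (·-by 1 6 6 refl (double i 3 eq)))
    kernel′ i 4 _ _ eq = ⊥-elim (4·G≢ε (·-by 2 8 4 refl (double i 4 eq)))
    kernel′ i 5 _ _ eq = ⊥-elim (4·G≢ε (·-by 4 10 4 refl (double i 5 eq)))
    kernel′ 0 6 _ _ eq = ⊥-elim (-1≢1 (cong 𝕁.c (trans (sym (trans (el-6 0) (identityˡ G₆))) eq)))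
    kernel′ 1 6 _ _ eq = ⊥-elim (-1≢1 (cong 𝕁.c (trans (sym (trans (el-6 1) (trans (cong (_∙ G₆) 1·A) A∙G₆))) eq)))
    kernel′ i 7 _ _ eq = ⊥-elim (4·G≢ε (·-by 2 14 4 refl (double i 7 eq)))
    kernel′ i 8 _ _ eq = ⊥-elim (4·G≢ε (·-by 1 16 4 refl (double i 8 eq)))
    kernel′ i 9 _ _ eq = ⊥-elim (6·G≢ε (·-by 1 18 6 refl (double i 9 eq)))
    kernel′ i 10 _ _ eq = ⊥-elim (4·G≢ε (·-by 2 20 4 refl (double i 10 eq)))
    kernel′ i 11 _ _ eq = ⊥-elim (4·G≢ε (·-by 4 22 4 refl (double i 11 eq)))
    kernel′ (suc (suc _)) _ (ℕ.s≤s (ℕ.s≤s ())) _ _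
    kernel′ _ (suc (suc (suc (suc (suc (suc (suc (suc (suc (suc (suc (suc _)))))))))))) _
      (ℕ.s≤s (ℕ.s≤s (ℕ.s≤s (ℕ.s≤s (ℕ.s≤s (ℕ.s≤s (ℕ.s≤s (ℕ.s≤s (ℕ.s≤s (ℕ.s≤s (ℕ.s≤s (ℕ.s≤s ())))))))))))) _

  el-kernel : ∀ i j → el i j ≡ ε → i % 2 ≡ 0 × j % 12 ≡ 0
  el-kernel i j eq = kernel′ (i % 2) (j % 12) (m%n<n i 2) (m%n<n j 12) (trans (sym (el-% i j)) eq)

  private
    cancel-mod-2 : ∀ (i i′ : Fin 2) → (toℕ i ℕ.+ (2 ℕ.∸ toℕ i′)) % 2 ≡ 0 → i ≡ i′
    cancel-mod-2 = from-yes (Finₚ.all? {P = λ i → ∀ i′ → Cancels i i′} λ i → Finₚ.all? {P = Cancels i} λ i′ →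
      ((toℕ i ℕ.+ (2 ℕ.∸ toℕ i′)) % 2 ℕ.≟ 0) →-dec (i Finₚ.≟ i′))
      where
      Cancels : Fin 2 → Fin 2 → Set
      Cancels i i′ = (toℕ i ℕ.+ (2 ℕ.∸ toℕ i′)) % 2 ≡ 0 → i ≡ i′

    cancel-mod-12 : ∀ (j j′ : Fin 12) → (toℕ j ℕ.+ (12 ℕ.∸ toℕ j′)) % 12 ≡ 0 → j ≡ j′
    cancel-mod-12 = from-yes (Finₚ.all? {P = λ j → ∀ j′ → Cancels j j′} λ j → Finₚ.all? {P = Cancels j} λ j′ →
      ((toℕ j ℕ.+ (12 ℕ.∸ toℕ j′)) % 12 ℕ.≟ 0) →-dec (j Finₚ.≟ j′))
      where
      Cancels : Fin 12 → Fin 12 → Set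
      Cancels j j′ = (toℕ j ℕ.+ (12 ℕ.∸ toℕ j′)) % 12 ≡ 0 → j ≡ j′

    complement : ∀ {n} (i : Fin n) → toℕ i ℕ.+ (n ℕ.∸ toℕ i) ≡ n
    complement i = ℕₚ.m+[n∸m]≡n (ℕₚ.<⇒≤ (Finₚ.toℕ<n i))

  el-injective : ∀ (i i′ : Fin 2) (j j′ : Fin 12) → el (toℕ i) (toℕ j) ≡ el (toℕ i′) (toℕ j′) → (i , j) ≡ (i′ , j′)
  el-injective i i′ j j′ eq = cong₂ _,_ (cancel-mod-2 i i′ (proj₁ zeros)) (cancel-mod-12 j j′ (proj₂ zeros))
    where
    zeros = el-kernel (toℕ i ℕ.+ (2 ℕ.∸ toℕ i′)) (toℕ j ℕ.+ (12 ℕ.∸ toℕ j′)) (begin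
      el (toℕ i ℕ.+ (2 ℕ.∸ toℕ i′)) (toℕ j ℕ.+ (12 ℕ.∸ toℕ j′))
        ≡⟨ el-+ (toℕ i) (2 ℕ.∸ toℕ i′) (toℕ j) (12 ℕ.∸ toℕ j′) ⟩
      el (toℕ i) (toℕ j) ∙ el (2 ℕ.∸ toℕ i′) (12 ℕ.∸ toℕ j′)
        ≡⟨ cong (_∙ el (2 ℕ.∸ toℕ i′) (12 ℕ.∸ toℕ j′)) eq ⟩
      el (toℕ i′) (toℕ j′) ∙ el (2 ℕ.∸ toℕ i′) (12 ℕ.∸ toℕ j′)
        ≡⟨ el-+ (toℕ i′) (2 ℕ.∸ toℕ i′) (toℕ j′) (12 ℕ.∸ toℕ j′) ⟨
      el (toℕ i′ ℕ.+ (2 ℕ.∸ toℕ i′)) (toℕ j′ ℕ.+ (12 ℕ.∸ toℕ j′))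
        ≡⟨ cong₂ el (complement i′) (complement j′) ⟩
      el 2 12
        ≡⟨ trans (cong₂ _∙_ 2·A 12·G) (identityˡ ε) ⟩
      ε ∎)

  private
    2-torsion-el : ∀ P → s P ≡ 0# → ∃ λ i → ∃ λ j → P ≡ el i j
    2-torsion-el P s≡0 = by-cases (root (λ x → 1# - x ^ 2) (𝕁.c² P)
          (solve (π ∷ []) (λ π → con 1 :- con 0 :^ 2 := con 1 :^ 2)))
          (root (λ x → 1# - κ * x ^ 2) (𝕁.d² P) (solve (κ ∷ []) (λ K → con 1 :- K :* con 0 :^ 2 := con 1 :^ 2)))
      where
      root : ∀ {x} (f : F → F) → x ^ 2 ≡ f (s P) → f 0# ≡ 1# ^ 2 → x ≡ 1# ⊎ x ≡ - 1#
      root f x² f0 = square-≡ (trans x² (trans (cong f s≡0) f0))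
      by-cases : 𝕁.c P ≡ 1# ⊎ 𝕁.c P ≡ - 1# → 𝕁.d P ≡ 1# ⊎ 𝕁.d P ≡ - 1# → ∃ λ i → ∃ λ j → P ≡ el i j
      by-cases (inj₁ c≡) (inj₁ d≡) = 0 , 0 , trans (J-≡ s≡0 c≡ d≡) (sym (identityˡ ε))
      by-cases (inj₁ c≡) (inj₂ d≡) = 1 , 0 , trans (J-≡ s≡0 c≡ d≡) (sym (trans (identityʳ (1 · jacᵃ)) 1·A))
      by-cases (inj₂ c≡) (inj₁ d≡) = 0 , 6 , trans (J-≡ s≡0 c≡ d≡) (sym (trans (el-6 0) (identityˡ G₆)))
      by-cases (inj₂ c≡) (inj₂ d≡) = 1 , 6 , trans (J-≡ s≡0 c≡ d≡)
            (sym (trans (el-6 1) (trans (cong (_∙ G₆) 1·A) A∙G₆)))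

    U-j : Unit j
    U-j = unit-inverse U-m+1 (inverseʳ (m + 1#) (unit≢0 U-m+1))

    level-G : ∀ n → n ℕ.≤ 2 → Level n ((3 ℕ.∸ n) · G)
    level-G 0 _ = 1# , (O-1 , 1# , O-1 , *-identityˡ 1#) , trans (cong s 3·G) (sym (*-identityˡ 1#))
    level-G 1 _ = - j , (O-neg (proj₁ U-j) , - (m + 1#) , O-neg (proj₁ U-m+1) ,
          (by-relations (λ m μ π ϖ j q κ → :- j :* :- (m :+ con 1) := con 1))) ,
      trans (cong s 2·G) (by-relations (λ m μ π ϖ j q κ → :- (π :* j) := π :* :- j))
    -- Since `m = π²/(m + 2)`, the value `s G = m j` is `π²` times the inverse of `(m + 2)(m + 1)`.
    level-G 2 _ = m * ϖ ^ 2 * j , unit-inverse (unit-* U-m+2 U-m+1)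
          (by-relations (λ m μ π ϖ j q κ → (m :+ con 2) :* (m :+ con 1) :* (m :* ϖ :^ 2 :* j) := con 1)) ,
      trans (cong s (identityʳ G)) (by-relations (λ m μ π ϖ j q κ → m :* j := π :^ 2 :* (m :* ϖ :^ 2 :* j)))
    level-G (suc (suc (suc _))) (ℕ.s≤s (ℕ.s≤s ()))

    torsion-G : IsTorsion G
    torsion-G = 12 , (λ ()) , 12·G

    shift : ∀ i j n → el i (j ℕ.+ n) ≡ el i j ∙ n · G
    shift i j n = trans (cong (i · jacᵃ ∙_) (×-homo-+ G j n)) (sym (assoc (i · jacᵃ) (j · G) (n · G)))

  torsion-el : ∀ P → IsTorsion P → ∃ λ i → ∃ λ j → P ≡ el i j
  torsion-el P tP = by-depth (depth P)
    where
    by-depth : Depth P → ∃ λ i → ∃ λ j → P ≡ el i j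
    by-depth (deep dp) = 2-torsion-el P (torsion-deep P tP dp)
    by-depth (level n n≤2 lP) = by-cases
          (torsion-same-level n P (r · G) n≤2 lP (level-G n n≤2) tP (torsion-· r torsion-G))
      where
      r = 3 ℕ.∸ n
      r≤12 : r ℕ.≤ 12
      r≤12 = ℕₚ.≤-trans (ℕₚ.m∸n≤m 3 n) (ℕ.s≤s (ℕ.s≤s (ℕ.s≤s ℕ.z≤n)))
      by-cases : s (P ∙ r · G) ≡ 0# ⊎ s (P ∙ inv (r · G)) ≡ 0# → ∃ λ i → ∃ λ j → P ≡ el i j
      by-cases (inj₁ s≡0) =
        let i , j , eq = 2-torsion-el (P ∙ r · G) s≡0
        in i , j ℕ.+ (12 ℕ.∸ r) , (begin
          P                               ≡⟨ identityʳ P ⟨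
          P ∙ ε                           ≡⟨ cong (P ∙_) (inverseʳ′ (r · G)) ⟨
          P ∙ (r · G ∙ inv (r · G))       ≡⟨ assoc P (r · G) (inv (r · G)) ⟨
          P ∙ r · G ∙ inv (r · G)         ≡⟨ cong₂ _∙_ eq (·-complement r 12 r≤12 12·G) ⟩
          el i j ∙ (12 ℕ.∸ r) · G         ≡⟨ shift i j (12 ℕ.∸ r) ⟨
          el i (j ℕ.+ (12 ℕ.∸ r))         ∎)
      by-cases (inj₂ s≡0) =
        let i , j , eq = 2-torsion-el (P ∙ inv (r · G)) s≡0
        in i , j ℕ.+ r , (begin
          P                               ≡⟨ identityʳ P ⟨
          P ∙ ε                           ≡⟨ cong (P ∙_) (𝕁.∙-inverseˡ (r · G)) ⟨
          P ∙ (inv (r · G) ∙ r · G)       ≡⟨ assoc P (inv (r · G)) (r · G) ⟨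
          P ∙ inv (r · G) ∙ r · G         ≡⟨ cong (_∙ r · G) eq ⟩
          el i j ∙ r · G                  ≡⟨ shift i j r ⟨
          el i (j ℕ.+ r)                  ∎)

  private
    over-∙ : ∀ {P Q} → OverJ P → OverJ Q → OverJ (P ∙ Q)
    over-∙ (P , p , refl) (Q , q , refl) = P ⊕ Q , ⊕-sum P Q p q

    over-A : OverJ jacᵃ
    over-A = _ , point-on m*μ on , trans (Φ-point m*μ on) (J-≡
        (divide (δ-inverse κ) (solve (κ ∷ []) (λ K → con 2 :* con 0 := con 0 :* (K :- K :^ 2))))
        (divide (δ-inverse κ) (solve (κ ∷ []) (λ K → con 2 :* K :- K :^ 2 :- K := con 1 :* (K :- K :^ 2))))
        (divide (δ-inverse κ) (solve (κ ∷ []) (λ K → con 2 :* K :* K :- K :^ 2 :- K := :- con 1 :* (K :- K :^ 2)))))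
      where
      on : 0# ^ 2 ≡ cubic κ
      on = solve (κ ∷ []) (λ K → con 0 :^ 2 := K :^ 3 :- (con 1 :+ K) :* K :^ 2 :+ K :* K)

    -- Halving the 2-torsion point `X = 1` of the Legendre curve leads to the abscissas `1 ± ρ` with
    -- `ρ² = 1 − κ`.
    over-B : OverJ jacᵇ
    over-B = _ , point-on m*μ on , trans (Φ-point m*μ on) (J-≡
        (divide (δ-inverse (1# + ρ)) (by-relations
              (λ m μ π ϖ j q κ → con 2 :* (q :* μ :* ϖ :* (con 1 :+ q :* μ :* ϖ))
              := :- con 1 :* (κ :- (con 1 :+ q :* μ :* ϖ) :^ 2))))
        (divide (δ-inverse (1# + ρ)) (by-relations
              (λ m μ π ϖ j q κ → con 2 :* (con 1 :+ q :* μ :* ϖ) :- (con 1 :+ q :* μ :* ϖ) :^ 2 :- κ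
              := con 0 :* (κ :- (con 1 :+ q :* μ :* ϖ) :^ 2))))
        (divide (δ-inverse (1# + ρ)) (by-relations
              (λ m μ π ϖ j q κ → con 2 :* κ :* (con 1 :+ q :* μ :* ϖ) :- (con 1 :+ q :* μ :* ϖ) :^ 2 :- κ
              := q :* μ :* ϖ :* (κ :- (con 1 :+ q :* μ :* ϖ) :^ 2)))))
      where
      on : (ρ * (1# + ρ)) ^ 2 ≡ cubic (1# + ρ)
      on = by-relations (λ m μ π ϖ j q κ → (q :* μ :* ϖ :* (con 1 :+ q :* μ :* ϖ)) :^ 2 :=
            (con 1 :+ q :* μ :* ϖ) :^ 3 :- (con 1 :+ κ) :* (con 1 :+ q :* μ :* ϖ) :^ 2 :+ κ :*
            (con 1 :+ q :* μ :* ϖ))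

    -- The point (0 , 1) of the induced curve.
    over-P : OverJ jacᵖ
    over-P = _ , point-on m*μ on , trans (Φ-point m*μ on) (J-≡
        (divide (δ-inverse ((m ^ 2 - 1#) * μ ^ 2))
              (by-relations (λ m μ π ϖ j q κ → con 2 :* :- ((m :^ 2 :- con 1) :* ϖ :* μ :^ 3)
              := :- (π :* j) :* (κ :- ((m :^ 2 :- con 1) :* μ :^ 2) :^ 2))))
        (divide (δ-inverse ((m ^ 2 - 1#) * μ ^ 2))
              (by-relations (λ m μ π ϖ j q κ →
              con 2 :* ((m :^ 2 :- con 1) :* μ :^ 2) :- ((m :^ 2 :- con 1) :* μ :^ 2) :^ 2 :- κ
              := j :* (κ :- ((m :^ 2 :- con 1) :* μ :^ 2) :^ 2))))
        (divide (δ-inverse ((m ^ 2 - 1#) * μ ^ 2))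
              (by-relations (λ m μ π ϖ j q κ →
              con 2 :* κ :* ((m :^ 2 :- con 1) :* μ :^ 2) :- ((m :^ 2 :- con 1) :* μ :^ 2) :^ 2 :- κ
              := :- μ :* (κ :- ((m :^ 2 :- con 1) :* μ :^ 2) :^ 2)))))
      where
      on : (- ((m ^ 2 - 1#) * ϖ * μ ^ 3)) ^ 2 ≡ cubic ((m ^ 2 - 1#) * μ ^ 2)
      on = by-relations (λ m μ π ϖ j q κ → (:- ((m :^ 2 :- con 1) :* ϖ :* μ :^ 3)) :^ 2 :=
            ((m :^ 2 :- con 1) :* μ :^ 2) :^ 3 :- (con 1 :+ κ) :* ((m :^ 2 :- con 1) :* μ :^ 2) :^ 2 :+ κ :*
            ((m :^ 2 :- con 1) :* μ :^ 2))

    over-G : OverJ G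
    over-G = subst OverJ G≡ (over-∙ over-B over-P)

    over-· : ∀ n {P} → OverJ P → OverJ (n · P)
    over-· zero    o = ∞ , tt , refl
    over-· (suc n) o = over-∙ o (over-· n o)

    over-el : ∀ i j → OverJ (el i j)
    over-el i j = over-∙ (over-· i over-A) (over-· j over-G)

  multiple : ∀ n P (p : OnCurve P) → Σ (OnCurve (n ·ᴾ P)) λ r → Φ (n ·ᴾ P) r ≡ n · Φ P p
  multiple zero    P p = tt , refl
  multiple (suc n) P p =
    let r  , eq  = multiple n P p
        r′ , eq′ = ⊕-sum P (n ·ᴾ P) p r
    in r′ , trans eq′ (cong (Φ P p ∙_) eq)

  g : Z2×Z12 → Point
  g (u , v) = proj₁ (over-el (toℕ u) (toℕ v))

  g-on : ∀ u → OnCurve (g u)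
  g-on (u , v) = proj₁ (proj₂ (over-el (toℕ u) (toℕ v)))

  private
    Φ-g : ∀ u v → Φ (g (u , v)) (g-on (u , v)) ≡ el (toℕ u) (toℕ v)
    Φ-g u v = proj₂ (proj₂ (over-el (toℕ u) (toℕ v)))

    toℕ-addMod : ∀ n .{{_ : NonZero n}} (u v : Fin n) → toℕ (addMod n u v) ≡ (toℕ u ℕ.+ toℕ v) % n
    toℕ-addMod n u v = Finₚ.toℕ-fromℕ< (m%n<n (toℕ u ℕ.+ toℕ v) n)

  g-⊞ : ∀ u v → g (u ⊞ v) ≡ g u ⊕ g v
  g-⊞ (u , v) (u′ , v′) = Φ-injective (g (w , z)) (g (u , v) ⊕ g (u′ , v′)) (g-on (w , z)) (proj₁ sum) (begin
      Φ (g (w , z)) (g-on (w , z))                              ≡⟨ Φ-g w z ⟩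
      el (toℕ w) (toℕ z)                                        ≡⟨ cong₂ el (toℕ-addMod 2 u u′) (toℕ-addMod 12 v v′) ⟩
      el ((toℕ u ℕ.+ toℕ u′) % 2) ((toℕ v ℕ.+ toℕ v′) % 12)     ≡⟨ el-% (toℕ u ℕ.+ toℕ u′) (toℕ v ℕ.+ toℕ v′) ⟨
      el (toℕ u ℕ.+ toℕ u′) (toℕ v ℕ.+ toℕ v′)                  ≡⟨ el-+ (toℕ u) (toℕ u′) (toℕ v) (toℕ v′) ⟩
      el (toℕ u) (toℕ v) ∙ el (toℕ u′) (toℕ v′)                 ≡⟨ cong₂ _∙_ (Φ-g u v) (Φ-g u′ v′) ⟨
      Φ (g (u , v)) (g-on (u , v)) ∙ Φ (g (u′ , v′)) (g-on (u′ , v′)) ≡⟨ proj₂ sum ⟨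
      Φ (g (u , v) ⊕ g (u′ , v′)) (proj₁ sum)                   ∎)
    where
    w = addMod 2 u u′
    z = addMod 12 v v′
    sum = ⊕-sum (g (u , v)) (g (u′ , v′)) (g-on (u , v)) (g-on (u′ , v′))

  g-injective : Injective _≡_ _≡_ g
  g-injective {u , v} {u′ , v′} eq = el-injective u u′ v v′
    (trans (sym (Φ-g u v)) (trans (Φ-cong eq (g-on (u , v)) (g-on (u′ , v′))) (Φ-g u′ v′)))
    where
    Φ-cong : ∀ {P Q} → P ≡ Q → .(p : OnCurve P) .(q : OnCurve Q) → Φ P p ≡ Φ Q q
    Φ-cong refl p q = refl

  g-torsion : ∀ P → OnCurve P → (∃ λ n → n ≢ 0 × n ·ᴾ P ≡ ∞) → ∃ λ u → g u ≡ P
  g-torsion P p (n , n≢0 , nP≡∞) = (u , v) , Φ-injective (g (u , v)) P (g-on (u , v)) p (begin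
      Φ (g (u , v)) (g-on (u , v))    ≡⟨ Φ-g u v ⟩
      el (toℕ u) (toℕ v)              ≡⟨ cong₂ el (Finₚ.toℕ-fromℕ< (m%n<n i₀ 2)) (Finₚ.toℕ-fromℕ< (m%n<n j₀ 12)) ⟩
      el (i₀ % 2) (j₀ % 12)           ≡⟨ el-% i₀ j₀ ⟨
      el i₀ j₀                        ≡⟨ ΦP≡ ⟨
      Φ P p                           ∎)
    where
    Φ-∞ : ∀ {Q} → Q ≡ ∞ → (q : OnCurve Q) → Φ Q q ≡ ε
    Φ-∞ refl q = refl
    found : ∃ λ i → ∃ λ j → Φ P p ≡ el i j
    found = torsion-el (Φ P p) (n , n≢0 , trans (sym (proj₂ (multiple n P p))) (Φ-∞ nP≡∞ (proj₁ (multiple n P p))))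
    i₀ j₀ : ℕ
    i₀ = proj₁ found
    j₀ = proj₁ (proj₂ found)
    ΦP≡ : Φ P p ≡ el i₀ j₀
    ΦP≡ = proj₂ (proj₂ found)
    u : Fin 2
    u = fromℕ< (m%n<n i₀ 2)
    v : Fin 12
    v = fromℕ< (m%n<n j₀ 12)

-- The rationals and their localisations at a prime.

invℚ-inverse : ∀ d p → p ≢ 0ℚ → p ℚ.* QField.invℚ d p ≡ 1ℚ
invℚ-inverse d p p≢0 with p ℚₚ.≟ 0ℚ
... | yes p≡0 = ⊥-elim (p≢0 p≡0)
... | no  p≢0 = ℚₚ.*-inverseʳ p {{ℚ.≢-nonZero p≢0}}

ℚ-field : Field
ℚ-field = record
  { F = ℚ ; _+_ = ℚ._+_ ; _*_ = ℚ._*_ ; -_ = ℚ.-_ ; 0# = 0ℚ ; 1# = 1ℚ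
  ; isCommutativeRing = ℚₚ.+-*-isCommutativeRing
  ; 1≢0 = λ ()
  -- The parameter of `QField` does not enter the inverse of a rational; 0 is a placeholder.
  ; _⁻¹ = QField.invℚ (ℤ.+ 0)
  ; inverseʳ = invℚ-inverse (ℤ.+ 0)
  ; _≟_ = ℚₚ._≟_ }

open Field ℚ-field using (_+_; _*_; -_; _-_; _^_; 0#; 1#; nat; 1≢0; _⁻¹; inverseʳ; *-comm; *-assoc; *-identityˡ;
      *-identityʳ; zeroˡ; +-identityʳ; +-identityˡ)
open Solver ℚ-field using (^-suc; solve; solveMod; con; _:+_; _:*_; :-_; _:-_; _:^_; _:=_; _given_)
open FieldProperties ℚ-field

ι : ℤ → ℚ
ι n = n ℚ./ 1

private
  ι-toℚᵘ : ∀ n → toℚᵘ (ι n) ℚᵘ.≃ mkℚᵘ n 0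
  ι-toℚᵘ n = ℚₚ.toℚᵘ-fromℚᵘ (mkℚᵘ n 0)

ι-+ : ∀ m n → ι (m ℤ.+ n) ≡ ι m + ι n
ι-+ m n = ℚₚ.toℚᵘ-injective (ℚᵘₚ.≃-trans (ι-toℚᵘ (m ℤ.+ n)) (ℚᵘₚ.≃-trans
  (*≡* (cong (ℤ._* ℤ.+ 1) (sym (cong₂ ℤ._+_ (ℤₚ.*-identityʳ m) (ℤₚ.*-identityʳ n)))))
  (ℚᵘₚ.≃-sym (ℚᵘₚ.≃-trans (ℚₚ.toℚᵘ-homo-+ (ι m) (ι n)) (ℚᵘₚ.+-cong (ι-toℚᵘ m) (ι-toℚᵘ n))))))

ι-* : ∀ m n → ι (m ℤ.* n) ≡ ι m * ι n
ι-* m n = ℚₚ.toℚᵘ-injective (ℚᵘₚ.≃-trans (ι-toℚᵘ (m ℤ.* n)) (ℚᵘₚ.≃-trans (*≡* refl)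
  (ℚᵘₚ.≃-sym (ℚᵘₚ.≃-trans (ℚₚ.toℚᵘ-homo-* (ι m) (ι n)) (ℚᵘₚ.*-cong (ι-toℚᵘ m) (ι-toℚᵘ n))))))

ι-injective : ∀ {m n} → ι m ≡ ι n → m ≡ n
ι-injective {m} {n} eq with ℚᵘₚ.≃-trans (ℚᵘₚ.≃-sym (ι-toℚᵘ m)) (ℚᵘₚ.≃-trans (ℚₚ.toℚᵘ-cong eq) (ι-toℚᵘ n))
... | *≡* m*1≡n*1 = trans (sym (ℤₚ.*-identityʳ m)) (trans m*1≡n*1 (ℤₚ.*-identityʳ n))

ι-neg : ∀ n → ι (ℤ.- n) ≡ - ι n
ι-neg n = -‿≡0 (trans (solve (ι (ℤ.- n) ∷ ι n ∷ []) (λ x y → x :- :- y := x :+ y))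
      (trans (sym (ι-+ (ℤ.- n) n)) (cong ι (ℤₚ.+-inverseˡ n))))

ι-nat : ∀ n → ι (ℤ.+ n) ≡ nat n
ι-nat zero          = refl
ι-nat (suc zero)    = refl
ι-nat (suc (suc n)) = trans (ι-+ (ℤ.+ 1) (ℤ.+ suc n)) (cong (1# +_) (ι-nat (suc n)))

numerator-denominator : ∀ x → x * ι (↧ x) ≡ ι (↥ x)
numerator-denominator x@(mkℚ n d-1 _) = ℚₚ.toℚᵘ-injective (ℚᵘₚ.≃-trans (ℚₚ.toℚᵘ-homo-* x (ι (↧ x)))
  (ℚᵘₚ.≃-trans (ℚᵘₚ.*-cong {mkℚᵘ n d-1} ℚᵘₚ.≃-refl (ι-toℚᵘ (↧ x)))
  (ℚᵘₚ.≃-trans (*≡* (trans (ℤₚ.*-identityʳ _) (cong (n ℤ.*_) (sym (ℤₚ.*-identityʳ _))))) (ℚᵘₚ.≃-sym (ι-toℚᵘ n)))))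

-- ℤ localised at a prime p.
module Local (p : ℕ) (p-prime : Prime p) where

  record Int (x : ℚ) : Set where
    constructor int
    field
      num den : ℤ
      p∤den   : ¬ (p ∣ₙ ∣ den ∣)
      num≡    : x * ι den ≡ ι num

  private
    p∤1 : ¬ (p ∣ₙ 1)
    p∤1 p∣1 = ℕₚ.<⇒≢ (ℕ.nonTrivial⇒n>1 p {{prime⇒nonTrivial p-prime}}) (sym (∣ₙ.∣1⇒≡1 p∣1))

    p∤* : ∀ {b b′} → ¬ (p ∣ₙ ∣ b ∣) → ¬ (p ∣ₙ ∣ b′ ∣) → ¬ (p ∣ₙ ∣ b ℤ.* b′ ∣)
    p∤* {b} {b′} p∤b p∤b′ p∣bb′ = [ p∤b , p∤b′ ]′
          (euclidsLemma ∣ b ∣ ∣ b′ ∣ p-prime (subst (p ∣ₙ_) (ℤₚ.abs-* b b′) p∣bb′))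

  Int-ι : ∀ n → Int (ι n)
  Int-ι n = int n (ℤ.+ 1) p∤1 (*-identityʳ (ι n))

  Int-1 : Int 1#
  Int-1 = Int-ι (ℤ.+ 1)

  Int-+ : ∀ {x y} → Int x → Int y → Int (x + y)
  Int-+ {x} {y} (int n b p∤b eq) (int n′ b′ p∤b′ eq′) = int (n ℤ.* b′ ℤ.+ n′ ℤ.* b) (b ℤ.* b′)
        (p∤* {b} {b′} p∤b p∤b′) (begin
    (x + y) * ι (b ℤ.* b′)          ≡⟨ cong ((x + y) *_) (ι-* b b′) ⟩
    (x + y) * (ι b * ι b′)          ≡⟨ solve (x ∷ y ∷ ι b ∷ ι b′ ∷ []) (λ x y b b′ → (x :+ y) :* (b :* b′)
          := x :* b :* b′ :+ y :* b′ :* b) ⟩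
    x * ι b * ι b′ + y * ι b′ * ι b ≡⟨ cong₂ (λ u v → u * ι b′ + v * ι b) eq eq′ ⟩
    ι n * ι b′ + ι n′ * ι b         ≡⟨ cong₂ _+_ (ι-* n b′) (ι-* n′ b) ⟨
    ι (n ℤ.* b′) + ι (n′ ℤ.* b)     ≡⟨ ι-+ (n ℤ.* b′) (n′ ℤ.* b) ⟨
    ι (n ℤ.* b′ ℤ.+ n′ ℤ.* b)       ∎)
    where open ≡-Reasoning

  Int-* : ∀ {x y} → Int x → Int y → Int (x * y)
  Int-* {x} {y} (int n b p∤b eq) (int n′ b′ p∤b′ eq′) = int (n ℤ.* n′) (b ℤ.* b′) (p∤* {b} {b′} p∤b p∤b′) (begin
    x * y * ι (b ℤ.* b′)          ≡⟨ cong (x * y *_) (ι-* b b′) ⟩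
    x * y * (ι b * ι b′)          ≡⟨ solve (x ∷ y ∷ ι b ∷ ι b′ ∷ []) (λ x y b b′ → x :* y :* (b :* b′) :=
          (x :* b) :* (y :* b′)) ⟩
    (x * ι b) * (y * ι b′)        ≡⟨ cong₂ _*_ eq eq′ ⟩
    ι n * ι n′                    ≡⟨ ι-* n n′ ⟨
    ι (n ℤ.* n′)                  ∎)
    where open ≡-Reasoning

  Int-neg : ∀ {x} → Int x → Int (- x)
  Int-neg {x} (int n b p∤b eq) = int (ℤ.- n) b p∤b
    (trans (solve (x ∷ ι b ∷ []) (λ x b → :- x :* b := :- (x :* b))) (trans (cong -_ eq) (sym (ι-neg n))))

  open Subring ℚ-field Int Int-1 Int-+ Int-* Int-neg public using (integral) renaming (O-nat to Int-nat; O-^ to Int-^)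

  P : ℚ
  P = ι (ℤ.+ p)

  ι≢0 : ∀ {b} → ¬ (p ∣ₙ ∣ b ∣) → ι b ≢ 0#
  ι≢0 {b} p∤b ιb≡0 = p∤b (subst (λ t → p ∣ₙ ∣ t ∣) (sym (ι-injective {b} {ℤ.+ 0} ιb≡0)) (p ∣ₙ.∣0))

  P≢0 : P ≢ 0#
  P≢0 P≡0 = ℕₚ.<⇒≢ (ℕₚ.<-trans (ℕ.s≤s ℕ.z≤n) (ℕ.nonTrivial⇒n>1 p {{prime⇒nonTrivial p-prime}}))
        (sym (ℤₚ.+-injective (ι-injective {ℤ.+ p} {ℤ.+ 0} P≡0)))

  P-nonunit : ∀ {y} → Int y → P * y ≢ 1#
  P-nonunit {y} (int n b p∤b eq) Py≡1 = p∤b (subst (p ∣ₙ_) (trans (sym (ℤₚ.abs-* n (ℤ.+ p))) (cong ∣_∣ n*p≡b))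
        (divides ∣ n ∣ refl))
    where
    open ≡-Reasoning
    n*p≡b : n ℤ.* ℤ.+ p ≡ b
    n*p≡b = ι-injective (begin
      ι (n ℤ.* ℤ.+ p)   ≡⟨ ι-* n (ℤ.+ p) ⟩
      ι n * P           ≡⟨ cong (_* P) eq ⟨
      y * ι b * P       ≡⟨ solve (y ∷ ι b ∷ P ∷ []) (λ y b P → y :* b :* P := P :* y :* b) ⟩
      P * y * ι b       ≡⟨ cong (_* ι b) Py≡1 ⟩
      1# * ι b          ≡⟨ *-identityˡ (ι b) ⟩
      ι b               ∎)

  -- In lowest terms `p` divides at most one of numerator and denominator; if it divides the
  -- denominator, then `1/x` is `p` times an integral element.
  valuation : ∀ x → Int x ⊎ ∃ λ y → Int y × x * (P * y) ≡ 1#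
  valuation x = by-cases (p ∣ₙ.∣? ↧ₙ x)
    where
    open ≡-Reasoning
    by-cases : Dec (p ∣ₙ ↧ₙ x) → Int x ⊎ ∃ λ y → Int y × x * (P * y) ≡ 1#
    by-cases (no  p∤↧) = inj₁ (int (↥ x) (↧ x) p∤↧ (numerator-denominator x))
    by-cases (yes (divides k ↧≡kp)) = inj₂ (y , int (ℤ.+ k) (↥ x) p∤↥ y*↥ , *-cancelˡ (ι≢0 {↥ x} p∤↥) (begin
        N * (x * (P * y))     ≡⟨ solve (N ∷ x ∷ P ∷ y ∷ []) (λ N x P y → N :* (x :* (P :* y))
              := x :* (P :* (y :* N))) ⟩
        x * (P * (y * N))     ≡⟨ cong (λ t → x * (P * t)) y*↥ ⟩
        x * (P * ι (ℤ.+ k))   ≡⟨ cong (x *_)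
              (trans (*-comm P _) (trans (sym (ι-* (ℤ.+ k) (ℤ.+ p)))
              (cong ι (trans (sym (ℤₚ.pos-* k p)) (sym (cong ℤ.+_ ↧≡kp)))))) ⟩
        x * ι (↧ x)           ≡⟨ numerator-denominator x ⟩
        N                     ≡⟨ *-identityʳ N ⟨
        N * 1#                ∎))
      where
      N : ℚ
      N = ι (↥ x)
      p∤↥ : ¬ (p ∣ₙ ∣ ↥ x ∣)
      p∤↥ p∣↥ = ℕₚ.<⇒≢ (ℕ.nonTrivial⇒n>1 p {{prime⇒nonTrivial p-prime}}) (sym (ℚₚ-coprime x (p∣↥ , divides k ↧≡kp)))
        where
        ℚₚ-coprime : ∀ x → Coprime ∣ ↥ x ∣ (↧ₙ x)
        ℚₚ-coprime (mkℚ n d-1 c) = Coprimality.recompute c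
      y : ℚ
      y = ι (ℤ.+ k) * N ⁻¹
      y*↥ : y * N ≡ ι (ℤ.+ k)
      y*↥ = solveMod (ι (ℤ.+ k) ∷ N ∷ N ⁻¹ ∷ []) (λ k N i → k :* i :* N := k given (N :* i := con 1 ∷ []))
            (inverseʳ N (ι≢0 {↥ x} p∤↥) ∷ [])

  Unit : ℚ → Set
  Unit x = Int x × ∃ λ y → Int y × x * y ≡ 1#

  unit-near-1 : ∀ {z} → Int z → Unit (1# + P * z)
  unit-near-1 {z} Iz = Ix , by-valuation (valuation (x ⁻¹))
    where
    x : ℚ
    x = 1# + P * z
    Ix : Int x
    Ix = integral (P ∷ z ∷ []) (λ P z → con 1 :+ P :* z) (Int-ι (ℤ.+ p) ∷ Iz ∷ [])
    x≢0 : x ≢ 0#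
    x≢0 x≡0 = P-nonunit (Int-neg Iz)
          (trans (solve (P ∷ z ∷ []) (λ P z → P :* :- z := con 1 :- (con 1 :+ P :* z)))
          (trans (cong (λ t → 1# - t) x≡0) (solve (P ∷ []) (λ P → con 1 :- con 0 := con 1))))
    by-valuation : Int (x ⁻¹) ⊎ (∃ λ y → Int y × x ⁻¹ * (P * y) ≡ 1#) → ∃ λ y → Int y × x * y ≡ 1#
    by-valuation (inj₁ Ix⁻¹) = x ⁻¹ , Ix⁻¹ , inverseʳ x x≢0
    by-valuation (inj₂ (y , Iy , eq)) = ⊥-elim (P-nonunit (Int-+ Iy (Int-neg Iz)) (begin
      P * (y - z)               ≡⟨ solve (P ∷ y ∷ z ∷ []) (λ P y z → P :* (y :- z)
            := P :* y :- (con 1 :+ P :* z) :+ con 1) ⟩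
      P * y - x + 1#            ≡⟨ cong (λ t → t - x + 1#) P*y≡x ⟩
      x - x + 1#                ≡⟨ solve (x ∷ []) (λ x → x :- x :+ con 1 := con 1) ⟩
      1#                        ∎))
      where
      open ≡-Reasoning
      P*y≡x : P * y ≡ x
      P*y≡x = begin
        P * y                 ≡⟨ solveMod (P * y ∷ x ∷ x ⁻¹ ∷ []) (λ u x i → u := x :* (i :* u)
              given (x :* i := con 1 ∷ [])) (inverseʳ x x≢0 ∷ []) ⟩
        x * (x ⁻¹ * (P * y))  ≡⟨ cong (x *_) eq ⟩
        x * 1#                ≡⟨ *-identityʳ x ⟩
        x                     ∎

prime-3 : Prime 3
prime-3 = from-yes (prime? 3)

open Local 3 prime-3 public

-- Modulo 3 the denominator is ±1, hence its own inverse, and the class of `x` is the product of the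
-- classes of numerator and denominator.
residue₃ : ∀ {x} → Int x → ∃ λ y → Int y × (x ≡ P * y ⊎ x ≡ 1# + P * y ⊎ x ≡ - 1# + P * y)
residue₃ {x} (int n b 3∤b eq) = by-residues (mod-3 n) (mod-3 b)
  where
  open ≡-Reasoning

  data Mod3 (n : ℤ) : Set where
    zero≡ : ∀ k → n ≡ ℤ.+ 3 ℤ.* k → Mod3 n
    one≡  : ∀ k → n ≡ ℤ.+ 1 ℤ.+ ℤ.+ 3 ℤ.* k → Mod3 n
    two≡  : ∀ k → n ≡ ℤ.- ℤ.+ 1 ℤ.+ ℤ.+ 3 ℤ.* k → Mod3 n

  identity₀ : ∀ q → ℤ.+ 0 ℤ.+ q ℤ.* ℤ.+ 3 ≡ ℤ.+ 3 ℤ.* q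
  identity₀ = ℤ-Solver.solve-∀

  identity₁ : ∀ q → ℤ.+ 1 ℤ.+ q ℤ.* ℤ.+ 3 ≡ ℤ.+ 1 ℤ.+ ℤ.+ 3 ℤ.* q
  identity₁ = ℤ-Solver.solve-∀

  identity₂ : ∀ q → ℤ.+ 2 ℤ.+ q ℤ.* ℤ.+ 3 ≡ ℤ.- ℤ.+ 1 ℤ.+ ℤ.+ 3 ℤ.* (q ℤ.+ ℤ.+ 1)
  identity₂ = ℤ-Solver.solve-∀

  identity₃ : ∀ k l → ℤ.+ 3 ℤ.* k ≡ ℤ.+ 0 ℤ.* (ℤ.+ 1 ℤ.+ ℤ.+ 3 ℤ.* l) ℤ.+ ℤ.+ 3 ℤ.* k
  identity₃ = ℤ-Solver.solve-∀

  identity₄ : ∀ k l → ℤ.+ 3 ℤ.* k ≡ ℤ.+ 0 ℤ.* (ℤ.- ℤ.+ 1 ℤ.+ ℤ.+ 3 ℤ.* l) ℤ.+ ℤ.+ 3 ℤ.* k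
  identity₄ = ℤ-Solver.solve-∀

  identity₅ : ∀ k l → ℤ.+ 1 ℤ.+ ℤ.+ 3 ℤ.* k ≡ ℤ.+ 1 ℤ.* (ℤ.+ 1 ℤ.+ ℤ.+ 3 ℤ.* l) ℤ.+ ℤ.+ 3 ℤ.* (k ℤ.- l)
  identity₅ = ℤ-Solver.solve-∀

  identity₆ : ∀ k l → ℤ.+ 1 ℤ.+ ℤ.+ 3 ℤ.* k ≡ ℤ.- ℤ.+ 1 ℤ.* (ℤ.- ℤ.+ 1 ℤ.+ ℤ.+ 3 ℤ.* l) ℤ.+ ℤ.+ 3 ℤ.* (k ℤ.+ l)
  identity₆ = ℤ-Solver.solve-∀

  identity₇ : ∀ k l → ℤ.- ℤ.+ 1 ℤ.+ ℤ.+ 3 ℤ.* k ≡ ℤ.- ℤ.+ 1 ℤ.* (ℤ.+ 1 ℤ.+ ℤ.+ 3 ℤ.* l) ℤ.+ ℤ.+ 3 ℤ.* (k ℤ.+ l)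
  identity₇ = ℤ-Solver.solve-∀

  identity₈ : ∀ k l → ℤ.- ℤ.+ 1 ℤ.+ ℤ.+ 3 ℤ.* k ≡ ℤ.+ 1 ℤ.* (ℤ.- ℤ.+ 1 ℤ.+ ℤ.+ 3 ℤ.* l) ℤ.+ ℤ.+ 3 ℤ.* (k ℤ.- l)
  identity₈ = ℤ-Solver.solve-∀

  mod-3 : ∀ n → Mod3 n
  mod-3 n = by-remainder (n %ℕ 3) (n%ℕd<d n 3) (a≡a%ℕn+[a/ℕn]*n n 3)
    where
    q : ℤ
    q = n /ℕ 3
    by-remainder : ∀ r → r ℕ.< 3 → n ≡ ℤ.+ r ℤ.+ q ℤ.* ℤ.+ 3 → Mod3 n
    by-remainder 0 _ eq = zero≡ q (trans eq (identity₀ q))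
    by-remainder 1 _ eq = one≡ q (trans eq (identity₁ q))
    by-remainder 2 _ eq = two≡ (q ℤ.+ ℤ.+ 1) (trans eq (identity₂ q))
    by-remainder (suc (suc (suc _))) (ℕ.s≤s (ℕ.s≤s (ℕ.s≤s ()))) _

  congruent : ∀ j k → n ≡ j ℤ.* b ℤ.+ ℤ.+ 3 ℤ.* k → ∃ λ y → Int y × x ≡ ι j + P * y
  congruent j k n≡ = y , int k b 3∤b y*b , *-cancelˡ (ι≢0 {b} 3∤b) (begin
    ι b * x                     ≡⟨ *-comm (ι b) x ⟩
    x * ι b                     ≡⟨ trans eq (cong ι n≡) ⟩
    ι (j ℤ.* b ℤ.+ ℤ.+ 3 ℤ.* k) ≡⟨ trans (ι-+ (j ℤ.* b) (ℤ.+ 3 ℤ.* k)) (cong₂ _+_ (ι-* j b) (ι-* (ℤ.+ 3) k)) ⟩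
    ι j * ι b + P * ι k         ≡⟨ cong (λ t → ι j * ι b + P * t) y*b ⟨
    ι j * ι b + P * (y * ι b)   ≡⟨ solve (ι j ∷ ι b ∷ P ∷ y ∷ []) (λ j b P y → j :* b :+ P :* (y :* b)
          := b :* (j :+ P :* y)) ⟩
    ι b * (ι j + P * y)         ∎)
    where
    y : ℚ
    y = ι k * ι b ⁻¹
    y*b : y * ι b ≡ ι k
    y*b = solveMod (ι k ∷ ι b ∷ ι b ⁻¹ ∷ []) (λ k b i → k :* i :* b := k given (b :* i := con 1 ∷ []))
          (inverseʳ (ι b) (ι≢0 {b} 3∤b) ∷ [])

  zero-class : ∀ k → n ≡ ℤ.+ 0 ℤ.* b ℤ.+ ℤ.+ 3 ℤ.* k → ∃ λ y → Int y × (x ≡ P * y ⊎ x ≡ 1# + P * y ⊎ x ≡ - 1# + P * y)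
  zero-class k n≡ = let y , Iy , x≡ = congruent (ℤ.+ 0) k n≡ in y , Iy , inj₁ (trans x≡ (+-identityˡ (P * y)))

  one-class : ∀ k → n ≡ ℤ.+ 1 ℤ.* b ℤ.+ ℤ.+ 3 ℤ.* k → ∃ λ y → Int y × (x ≡ P * y ⊎ x ≡ 1# + P * y ⊎ x ≡ - 1# + P * y)
  one-class k n≡ = let y , Iy , x≡ = congruent (ℤ.+ 1) k n≡ in y , Iy , inj₂ (inj₁ x≡)

  two-class : ∀ k → n ≡ ℤ.- ℤ.+ 1 ℤ.* b ℤ.+ ℤ.+ 3 ℤ.* k → ∃ λ y →
        Int y × (x ≡ P * y ⊎ x ≡ 1# + P * y ⊎ x ≡ - 1# + P * y)
  two-class k n≡ = let y , Iy , x≡ = congruent (ℤ.- ℤ.+ 1) k n≡ in y , Iy , inj₂ (inj₂ x≡)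

  by-residues : Mod3 n → Mod3 b → ∃ λ y → Int y × (x ≡ P * y ⊎ x ≡ 1# + P * y ⊎ x ≡ - 1# + P * y)
  by-residues _ (zero≡ l b≡) = ⊥-elim
        (3∤b (divides ∣ l ∣ (trans (cong ∣_∣ b≡) (trans (ℤₚ.abs-* (ℤ.+ 3) l) (ℕₚ.*-comm 3 ∣ l ∣)))))
  by-residues (zero≡ k refl) (one≡ l refl) = zero-class k
    (identity₃ k l)
  by-residues (zero≡ k refl) (two≡ l refl) = zero-class k
    (identity₄ k l)
  by-residues (one≡ k refl) (one≡ l refl) = one-class (k ℤ.- l)
    (identity₅ k l)
  by-residues (one≡ k refl) (two≡ l refl) = two-class (k ℤ.+ l)
    (identity₆ k l)
  by-residues (two≡ k refl) (one≡ l refl) = two-class (k ℤ.+ l)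
    (identity₇ k l)
  by-residues (two≡ k refl) (two≡ l refl) = one-class (k ℤ.- l)
    (identity₈ k l)

-- A unit times 3 has odd valuation. The proof runs through the possible classes of `t`: not
-- integral, 0, 1 and -1 modulo 3.
nonsquare₃ : ∀ {u v} → Int u → Int v → u * v ≡ 1# → ∀ t → t ^ 2 ≢ P * u
nonsquare₃ {u} {v} Iu Iv uv≡1 t t²≡Pu = [ by-residue ∘ residue₃ ,
      (λ (y , Iy , ty≡1) → P-nonunit ((integral (P ∷ u ∷ y ∷ []) (λ P u y → P :^ 2 :* u :* y :^ 2)
      (Int-ι (ℤ.+ 3) ∷ Iu ∷ Iy ∷ [])))
      (trans (solve (P ∷ u ∷ y ∷ []) (λ P u y → P :* (P :^ 2 :* u :* y :^ 2) := P :* u :* (P :* y) :^ 2))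
            (trans (cong (_* (P * y) ^ 2) (sym t²≡Pu))
        (trans (solve (t ∷ P * y ∷ []) (λ t z → t :^ 2 :* z :^ 2 := (t :* z) :^ 2))
              (trans (cong (_^ 2) ty≡1) (*-identityˡ 1#)))))) ]′ (valuation t)
  where
  open ≡-Reasoning
  unit-class : ∀ {y e} → Int y → Int e → t ≡ e + P * y → e ^ 2 ≡ 1# → ⊥
  unit-class {y} {e} Iy Ie t≡ e²≡1 = P-nonunit
        ((integral (P ∷ e ∷ y ∷ u ∷ []) (λ P e y u → u :- con 2 :* e :* y :- P :* y :^ 2)
        (Int-ι (ℤ.+ 3) ∷ Ie ∷ Iy ∷ Iu ∷ []))) (begin
    P * (u - nat 2 * e * y - P * y ^ 2)     ≡⟨
          solve (P ∷ e ∷ y ∷ u ∷ []) (λ P e y u → P :* (u :- con 2 :* e :* y :- P :* y :^ 2)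
          := P :* u :- (e :+ P :* y) :^ 2 :+ e :^ 2) ⟩
    P * u - (e + P * y) ^ 2 + e ^ 2         ≡⟨ cong₂ (λ x z → P * u - x ^ 2 + z) (sym t≡) e²≡1 ⟩
    P * u - t ^ 2 + 1#                      ≡⟨ cong (λ z → P * u - z + 1#) t²≡Pu ⟩
    P * u - P * u + 1#                      ≡⟨ solve (P * u ∷ []) (λ z → z :- z :+ con 1 := con 1) ⟩
    1#                                      ∎)
  by-residue : (∃ λ y → Int y × (t ≡ P * y ⊎ t ≡ 1# + P * y ⊎ t ≡ - 1# + P * y)) → ⊥
  by-residue (y , Iy , inj₁ t≡) = P-nonunit ((integral (y ∷ v ∷ []) (λ y v → y :^ 2 :* v) (Iy ∷ Iv ∷ [])))
        (*-cancelˡ P≢0 (begin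
    P * (P * (y ^ 2 * v))     ≡⟨ solve (P ∷ y ∷ v ∷ []) (λ P y v → P :* (P :* (y :^ 2 :* v)) := (P :* y) :^ 2 :* v) ⟩
    (P * y) ^ 2 * v           ≡⟨ cong (λ z → z ^ 2 * v) t≡ ⟨
    t ^ 2 * v                 ≡⟨ cong (_* v) t²≡Pu ⟩
    P * u * v                 ≡⟨ solveMod (P ∷ u ∷ v ∷ []) (λ P u v → P :* u :* v := P :* con 1
          given (u :* v := con 1 ∷ [])) (uv≡1 ∷ []) ⟩
    P * 1#                    ∎))
  by-residue (y , Iy , inj₂ (inj₁ t≡)) = unit-class Iy Int-1 t≡ (solve (P ∷ []) (λ P → con 1 :^ 2 := con 1))
  by-residue (y , Iy , inj₂ (inj₂ t≡)) = unit-class Iy (Int-neg Int-1) t≡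
        (solve (P ∷ []) (λ P → (:- con 1) :^ 2 := con 1))

-- Quadratic fields, and the passage to the given chord-tangent law.

module QuadraticField (d : ℤ) (nonsquare : ∀ t → t ^ 2 ≢ ι d) where
  open QField d
  open ≡-Reasoning

  isCommutativeRing : IsCommutativeRing _≡_ _+K_ _*K_ (λ z → -K z) 0K 1K
  isCommutativeRing = record
    { isRing = record
      { +-isAbelianGroup = record
        { isGroup = record
          { isMonoid = record
            { isSemigroup = record
              { isMagma = record { isEquivalence = isEquivalence ; ∙-cong = cong₂ _+K_ }
              ; assoc = λ (a , b) (c , e) (f , g) → cong₂ _,_ (ℚₚ.+-assoc a c f) (ℚₚ.+-assoc b e g) }
            ; identity = (λ (a , b) → cong₂ _,_ (ℚₚ.+-identityˡ a) (ℚₚ.+-identityˡ b)) ,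
                         (λ (a , b) → cong₂ _,_ (ℚₚ.+-identityʳ a) (ℚₚ.+-identityʳ b)) }
          ; inverse = (λ (a , b) → cong₂ _,_ (ℚₚ.+-inverseˡ a) (ℚₚ.+-inverseˡ b)) ,
                      (λ (a , b) → cong₂ _,_ (ℚₚ.+-inverseʳ a) (ℚₚ.+-inverseʳ b))
          ; ⁻¹-cong = cong (λ z → -K z) }
        ; comm = λ (a , b) (c , e) → cong₂ _,_ (ℚₚ.+-comm a c) (ℚₚ.+-comm b e) }
      ; *-cong = cong₂ _*K_
      ; *-assoc = λ (a , b) (c , e) (f , g) → cong₂ _,_
          (solve (dℚ ∷ a ∷ b ∷ c ∷ e ∷ f ∷ g ∷ []) (λ d a b c e f g →
                (a :* c :+ d :* b :* e) :* f :+ d :* (a :* e :+ b :* c) :* g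
                := a :* (c :* f :+ d :* e :* g) :+ d :* b :* (c :* g :+ e :* f)))
          (solve (dℚ ∷ a ∷ b ∷ c ∷ e ∷ f ∷ g ∷ []) (λ d a b c e f g →
                (a :* c :+ d :* b :* e) :* g :+ (a :* e :+ b :* c) :* f
                := a :* (c :* g :+ e :* f) :+ b :* (c :* f :+ d :* e :* g)))
      ; *-identity = (λ (a , b) → cong₂ _,_ (solve (dℚ ∷ a ∷ b ∷ []) (λ d a b → con 1 :* a :+ d :* con 0 :* b
            := a)) (solve (dℚ ∷ a ∷ b ∷ []) (λ d a b → con 1 :* b :+ con 0 :* a := b))) ,
                     (λ (a , b) → cong₂ _,_ (solve (dℚ ∷ a ∷ b ∷ []) (λ d a b → a :* con 1 :+ d :* b :* con 0
                           := a)) (solve (dℚ ∷ a ∷ b ∷ []) (λ d a b → a :* con 0 :+ b :* con 1 := b)))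
      ; distrib = (λ (a , b) (c , e) (f , g) → cong₂ _,_
                    (solve (dℚ ∷ a ∷ b ∷ c ∷ e ∷ f ∷ g ∷ [])
                          (λ d a b c e f g → a :* (c :+ f) :+ d :* b :* (e :+ g)
                          := a :* c :+ d :* b :* e :+ (a :* f :+ d :* b :* g)))
                    (solve (dℚ ∷ a ∷ b ∷ c ∷ e ∷ f ∷ g ∷ []) (λ d a b c e f g → a :* (e :+ g) :+ b :* (c :+ f)
                          := a :* e :+ b :* c :+ (a :* g :+ b :* f)))) ,
                  (λ (a , b) (c , e) (f , g) → cong₂ _,_
                    (solve (dℚ ∷ a ∷ b ∷ c ∷ e ∷ f ∷ g ∷ []) (λ d a b c e f g →
                          (c :+ f) :* a :+ d :* (e :+ g) :* b
                          := c :* a :+ d :* e :* b :+ (f :* a :+ d :* g :* b)))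
                    (solve (dℚ ∷ a ∷ b ∷ c ∷ e ∷ f ∷ g ∷ []) (λ d a b c e f g → (c :+ f) :* b :+ (e :+ g) :* a
                          := c :* b :+ e :* a :+ (f :* b :+ g :* a)))) }
    ; *-comm = λ (a , b) (c , e) → cong₂ _,_
        (solve (dℚ ∷ a ∷ b ∷ c ∷ e ∷ []) (λ d a b c e → a :* c :+ d :* b :* e := c :* a :+ d :* e :* b))
        (solve (dℚ ∷ a ∷ b ∷ c ∷ e ∷ []) (λ d a b c e → a :* e :+ b :* c := c :* b :+ e :* a)) }

  norm≢0 : ∀ a b → (a , b) ≢ 0K → a * a - dℚ * b * b ≢ 0#
  norm≢0 a b z≢0 n≡0 = by-cases (b ℚₚ.≟ 0#)
    where
    by-cases : Dec (b ≡ 0#) → ⊥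
    by-cases (yes refl) = a≢0 (*-zero
          (trans (solve (dℚ ∷ a ∷ []) (λ d a → a :* a := a :* a :- d :* con 0 :* con 0)) n≡0) a≢0)
      where
      a≢0 : a ≢ 0#
      a≢0 refl = z≢0 refl
    by-cases (no b≢0) = nonsquare (a * b ⁻¹) (begin
      (a * b ⁻¹) ^ 2                                      ≡⟨ solveMod (dℚ ∷ a ∷ b ∷ b ⁻¹ ∷ []) (λ d a b i →
            (a :* i) :^ 2 := (a :* a :- d :* b :* b) :* i :^ 2 :+ d given (b :* i := con 1 ∷ []))
            (inverseʳ b b≢0 ∷ []) ⟩
      (a * a - dℚ * b * b) * (b ⁻¹) ^ 2 + dℚ              ≡⟨ cong (λ n → n * (b ⁻¹) ^ 2 + dℚ) n≡0 ⟩
      0# * (b ⁻¹) ^ 2 + dℚ                                ≡⟨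
            solve (dℚ ∷ b ⁻¹ ∷ []) (λ d i → con 0 :* i :^ 2 :+ d := d) ⟩
      dℚ                                                  ∎)

  inverseK : ∀ x → x ≢ 0K → x *K invK x ≡ 1K
  inverseK (a , b) x≢0 = cong₂ _,_
    (trans (solve (dℚ ∷ a ∷ b ∷ n ∷ []) (λ d a b n → a :* (a :* n) :+ d :* b :* :- (b :* n) :=
          (a :* a :- d :* b :* b) :* n)) (invℚ-inverse d (a * a - dℚ * b * b) (norm≢0 a b x≢0)))
    (solve (a ∷ b ∷ n ∷ []) (λ a b n → a :* :- (b :* n) :+ b :* (a :* n) := con 0))
    where
    n : ℚ
    n = invℚ (a * a - dℚ * b * b)

  K-field : Field
  K-field = record
    { F = K ; _+_ = _+K_ ; _*_ = _*K_ ; -_ = λ z → -K z ; 0# = 0K ; 1# = 1K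
    ; isCommutativeRing = isCommutativeRing
    ; 1≢0 = λ ()
    ; _⁻¹ = invK
    ; inverseʳ = inverseK
    ; _≟_ = _≟K_ }

  module Transport (a b c : K) where
    module D = Curve a b c
    open ChordTangent K-field a b c using (∞; _⊕_; _·ᴾ_) renaming (Point to Point′; aff to aff′; OnCurve to OnCurve′)

    to : Point′ → Point
    to ∞          = O
    to (aff′ x y) = aff x y

    from : Point → Point′
    from O         = ∞
    from (aff x y) = aff′ x y

    to-from : ∀ P → to (from P) ≡ P
    to-from O         = refl
    to-from (aff x y) = refl

    to-injective : ∀ {P Q} → to P ≡ to Q → P ≡ Q
    to-injective {∞}       {∞}       refl = refl
    to-injective {aff′ _ _} {aff′ _ _} refl = refl

    -- Both laws branch on the same decisions. Once these are made the sides agree by computation,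
    -- `nat 2` and `nat 3` included.
    to-⊕ : ∀ P Q → to (P ⊕ Q) ≡ to P D.⊕ to Q
    to-⊕ ∞            Q            = refl
    to-⊕ (aff′ x₁ y₁) ∞            = refl
    to-⊕ (aff′ x₁ y₁) (aff′ x₂ y₂) with x₁ ≟K x₂
    ... | no _ = refl
    ... | yes _ with y₁ ≟K (-K y₂)
    ...   | yes _ = refl
    ...   | no _  = refl

    to-on : ∀ P → OnCurve′ P → D.OnCurve (to P)
    to-on ∞          _  = tt
    to-on (aff′ x y) on = on

    from-on : ∀ P → D.OnCurve P → OnCurve′ (from P)
    from-on O         _  = tt
    from-on (aff x y) on = on

    to-multiple : ∀ n P → to (n ·ᴾ from P) ≡ n D.· P
    to-multiple zero    P = refl
    to-multiple (suc n) P = trans (to-⊕ (from P) (n ·ᴾ from P)) (cong₂ D._⊕_ (to-from P) (to-multiple n P))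

    transport : (g : Z2×Z12 → Point′) → (∀ u → OnCurve′ (g u)) →
          (∀ u v → g (u ⊞ v) ≡ g u ⊕ g v) → Injective _≡_ _≡_ g →
      (∀ P → OnCurve′ P → (∃ λ n → n ≢ 0 × n ·ᴾ P ≡ ∞) → ∃ λ u → g u ≡ P) →
      ∃ λ (g : Z2×Z12 → Point) →
        (∀ u → D.OnCurve (g u)) ×
        (∀ u v → g (u ⊞ v) ≡ (g u D.⊕ g v)) ×
        Injective _≡_ _≡_ g ×
        (∀ P → D.OnCurve P → D.IsTorsion P → ∃ λ u → g u ≡ P)
    transport g g-on g-⊞ g-injective g-torsion =
        (λ u → to (g u)) , (λ u → to-on (g u) (g-on u)) ,
        (λ u v → trans (cong to (g-⊞ u v)) (to-⊕ (g u) (g v))) ,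
        (λ eq → g-injective (to-injective eq)) , torsion
      where
      torsion : ∀ P → D.OnCurve P → D.IsTorsion P → ∃ λ u → to (g u) ≡ P
      torsion P on (n , n≢0 , nP≡O) =
        let u , eq = g-torsion (from P) (from-on P on) (n , n≢0 , to-injective (trans (to-multiple n P) nP≡O))
        in u , trans (cong to eq) (to-from P)

-- The valuation ring above the ramified prime 3.

-- For d = 3 u the prime 3 is ramified in ℚ(√d), with uniformizer r √d.
module Ramified (d : ℤ) (u v r s : ℚ) (Iu : Int u) (Iv : Int v) (uv≡1 : u * v ≡ 1#) (d≡ : ι d ≡ P * u)
    (Ir : Int r) (Is : Int s) (rs≡1 : r * s ≡ 1#) where
  open QField d
  open QuadraticField d (λ t t²≡d → nonsquare₃ Iu Iv uv≡1 t (trans t²≡d d≡)) public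
  open ≡-Reasoning

  -- As 3 divides `d` exactly once, ℤ₍₃₎[√d] is already the full valuation ring.
  Oᴷ : K → Set
  Oᴷ (a , b) = Int a × Int b

  π : K
  π = 0# , r

  private
    I3 : Int P
    I3 = Int-ι (ℤ.+ 3)

    Id : Int dℚ
    Id = Int-ι d

    -- `w` inverts the norm `1 − d t²` of `1 + t √d`, which is 1 modulo 3.
    one-unit : ∀ {t} → Int t → ∃ λ w → Int w × w - P * u * t ^ 2 * w ≡ 1#
    one-unit {t} It = let _ , w , Iw , eq = unit-near-1 (Int-neg (Int-* Iu (Int-^ 2 It))) in
      w , Iw , trans (solve (P ∷ u ∷ t ∷ w ∷ []) (λ P u t w → w :- P :* u :* t :^ 2 :* w :=
            (con 1 :+ P :* :- (u :* t :^ 2)) :* w)) eq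

    -- z = a (1 + t √d) with 1/a = 3 y
    first : ∀ {a b y t} → Int y → Int t → a * (P * y) ≡ 1# → b ≡ t * a → ∃ λ z → Oᴷ z × (a , b) *K (π *K z) ≡ 1K
    first {a} {b} {y} {t} Iy It ay≡1 refl =
      let w , Iw , w≡ = one-unit It in
      (- (P * y * w * t * s) , y * w * v * s) ,
      ((integral (P ∷ y ∷ w ∷ t ∷ s ∷ []) (λ P y w t s → :- (P :* y :* w :* t :* s))
            (I3 ∷ Iy ∷ Iw ∷ It ∷ Is ∷ [])) ,
            (integral (y ∷ w ∷ v ∷ s ∷ []) (λ y w v s → y :* w :* v :* s) (Iy ∷ Iw ∷ Iv ∷ Is ∷ []))) ,
      cong₂ _,_
        (begin
          a * (0# * - (P * y * w * t * s) + dℚ * r * (y * w * v * s)) + dℚ * (t * a) *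
                (0# * (y * w * v * s) + r * - (P * y * w * t * s))
            ≡⟨ cong (λ d → a * (0# * - (P * y * w * t * s) + d * r * (y * w * v * s)) + d * (t * a) *
                  (0# * (y * w * v * s) + r * - (P * y * w * t * s))) d≡ ⟩
          a * (0# * - (P * y * w * t * s) + P * u * r * (y * w * v * s)) + P * u * (t * a) *
                (0# * (y * w * v * s) + r * - (P * y * w * t * s))
            ≡⟨ solveMod (P ∷ a ∷ t ∷ u ∷ v ∷ w ∷ y ∷ r ∷ s ∷ []) (λ P a t u v w y r s →
                  a :* (con 0 :* :- (P :* y :* w :* t :* s) :+ P :* u :* r :* (y :* w :* v :* s)) :+ P :* u :*
                  (t :* a) :* (con 0 :* (y :* w :* v :* s) :+ r :* :- (P :* y :* w :* t :* s))
                  := a :* (P :* y) :* (w :- P :* u :* t :^ 2 :* w)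
                  given (u :* v := con 1 ∷ r :* s := con 1 ∷ [])) (uv≡1 ∷ rs≡1 ∷ []) ⟩
          a * (P * y) * (w - P * u * t ^ 2 * w)
            ≡⟨ cong₂ _*_ ay≡1 w≡ ⟩
          1# * 1#
            ≡⟨ *-identityˡ 1# ⟩
          1# ∎)
        (begin
          a * (0# * (y * w * v * s) + r * - (P * y * w * t * s)) + t * a *
                (0# * - (P * y * w * t * s) + dℚ * r * (y * w * v * s))
            ≡⟨ cong (λ d → a * (0# * (y * w * v * s) + r * - (P * y * w * t * s)) + t * a *
                  (0# * - (P * y * w * t * s) + d * r * (y * w * v * s))) d≡ ⟩
          a * (0# * (y * w * v * s) + r * - (P * y * w * t * s)) + t * a *
                (0# * - (P * y * w * t * s) + P * u * r * (y * w * v * s))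
            ≡⟨ solveMod (P ∷ a ∷ t ∷ u ∷ v ∷ w ∷ y ∷ r ∷ s ∷ []) (λ P a t u v w y r s →
                  a :* (con 0 :* (y :* w :* v :* s) :+ r :* :- (P :* y :* w :* t :* s)) :+ t :* a :*
                  (con 0 :* :- (P :* y :* w :* t :* s) :+ P :* u :* r :* (y :* w :* v :* s)) := con 0
                  given (u :* v := con 1 ∷ r :* s := con 1 ∷ [])) (uv≡1 ∷ rs≡1 ∷ []) ⟩
          0# ∎)

    -- z = b √d (1 + t √d) with 1/(b d) = e
    second : ∀ {a b e t} → Int e → Int t → e * b * dℚ ≡ 1# → a ≡ t * b * dℚ → ∃ λ z → Oᴷ z × (a , b) *K (π *K z) ≡ 1K
    second {a} {b} {e} {t} Ie It eb≡1 refl =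
      let w , Iw , w≡ = one-unit It
          w≡′ = trans (solve (dℚ ∷ t ∷ w ∷ []) (λ d t w → w :- d :* t :^ 2 :* w := w :- d :* t :^ 2 :* w))
                (trans (cong (λ d → w - d * t ^ 2 * w) d≡) w≡) in
      (e * w * s , - (e * t * w * s)) ,
            ((integral (e ∷ w ∷ s ∷ []) (λ e w s → e :* w :* s) (Ie ∷ Iw ∷ Is ∷ [])) ,
            (integral (e ∷ t ∷ w ∷ s ∷ []) (λ e t w s → :- (e :* t :* w :* s)) (Ie ∷ It ∷ Iw ∷ Is ∷ []))) ,
      cong₂ _,_
        (begin
          t * b * dℚ * (0# * (e * w * s) + dℚ * r * - (e * t * w * s)) + dℚ * b *
                (0# * - (e * t * w * s) + r * (e * w * s))
            ≡⟨ solveMod (b ∷ dℚ ∷ e ∷ r ∷ s ∷ t ∷ w ∷ [])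
                  (λ b d e r s t w → t :* b :* d :* (con 0 :* (e :* w :* s) :+ d :* r :* :- (e :* t :* w :* s))
                  :+ d :* b :* (con 0 :* :- (e :* t :* w :* s) :+ r :* (e :* w :* s))
                  := e :* b :* d :* (w :- d :* t :^ 2 :* w) given (r :* s := con 1 ∷ [])) (rs≡1 ∷ []) ⟩
          e * b * dℚ * (w - dℚ * t ^ 2 * w)
            ≡⟨ cong₂ _*_ eb≡1 w≡′ ⟩
          1# * 1#
            ≡⟨ *-identityˡ 1# ⟩
          1# ∎)
        (solveMod (b ∷ dℚ ∷ e ∷ r ∷ s ∷ t ∷ w ∷ [])
              (λ b d e r s t w → t :* b :* d :* (con 0 :* :- (e :* t :* w :* s) :+ r :* (e :* w :* s)) :+ b :*
              (con 0 :* (e :* w :* s) :+ d :* r :* :- (e :* t :* w :* s)) := con 0 given (r :* s := con 1 ∷ []))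
              (rs≡1 ∷ []))

  -- The valuation of `a` is even and that of `b √d` is odd, so one summand dominates: the element
  -- is `a (1 + t √d)` or `b √d (1 + t √d)` with `t` integral, as handled by `first` and `second`.
  valuationK : ∀ z → Oᴷ z ⊎ ∃ λ y → Oᴷ y × z *K (π *K y) ≡ 1K
  valuationK (a , b) = by-valuation (valuation a) (valuation b)
    where
    by-valuation : Int a ⊎ (∃ λ y → Int y × a * (P * y) ≡ 1#) → Int b ⊎ (∃ λ y → Int y × b * (P * y) ≡ 1#) →
                   Oᴷ (a , b) ⊎ ∃ λ y → Oᴷ y × (a , b) *K (π *K y) ≡ 1K
    by-valuation (inj₁ Ia) (inj₁ Ib) = inj₁ (Ia , Ib)
    by-valuation (inj₁ Ia) (inj₂ (y , Iy , by≡1)) = inj₂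
          (second {e = y * v} {t = a * (y * v)} (Int-* Iy Iv) (Int-* Ia (Int-* Iy Iv))
      e*b*d
      (trans (trans (sym (*-identityʳ a)) (cong (a *_) (sym e*b*d)))
            (solve (a ∷ y * v ∷ b ∷ dℚ ∷ []) (λ a e b d → a :* (e :* b :* d) := a :* e :* b :* d))))
      where
      e*b*d : y * v * b * dℚ ≡ 1#
      e*b*d = trans (cong (y * v * b *_) d≡)
            (trans (solveMod (P ∷ u ∷ v ∷ b ∷ y ∷ []) (λ P u v b y → y :* v :* b :* (P :* u) := b :* (P :* y)
            given (u :* v := con 1 ∷ [])) (uv≡1 ∷ [])) by≡1)
    by-valuation (inj₂ (y , Iy , ay≡1)) _ = by-ratio (valuation (b * (P * y)))
      where
      by-ratio : Int (b * (P * y)) ⊎ (∃ λ y′ → Int y′ × b * (P * y) * (P * y′) ≡ 1#) → Oᴷ (a , b) ⊎ ∃ λ y →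
            Oᴷ y × (a , b) *K (π *K y) ≡ 1K
      by-ratio (inj₁ It) = inj₂ (first Iy It ay≡1
            (trans (trans (sym (*-identityʳ b)) (cong (b *_) (sym ay≡1)))
            (solve (a ∷ b ∷ P * y ∷ []) (λ a b z → b :* (a :* z) := b :* z :* a))))
      by-ratio (inj₂ (y′ , Iy′ , eq)) = inj₂
            (second {e = e} {t = y′ * v} (integral (P ∷ y ∷ y′ ∷ v ∷ []) (λ P y y′ v → P :* y :* y′ :* v)
            (I3 ∷ Iy ∷ Iy′ ∷ Iv ∷ [])) (Int-* Iy′ Iv)
        (trans (cong (e * b *_) d≡) (trans
              (solveMod (P ∷ u ∷ v ∷ b ∷ y ∷ y′ ∷ []) (λ P u v b y y′ → P :* y :* y′ :* v :* b :* (P :* u)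
              := b :* (P :* y) :* (P :* y′) given (u :* v := con 1 ∷ [])) (uv≡1 ∷ [])) eq))
        (begin
          a                              ≡⟨ trans (sym (*-identityʳ a)) (cong (a *_) (sym eq)) ⟩
          a * (b * (P * y) * (P * y′))   ≡⟨
                solve (a ∷ b ∷ P * y ∷ P * y′ ∷ []) (λ a b x x′ → a :* (b :* x :* x′) := a :* x :* (b :* x′)) ⟩
          a * (P * y) * (b * (P * y′))   ≡⟨ cong (_* (b * (P * y′))) ay≡1 ⟩
          1# * (b * (P * y′))            ≡⟨
                solveMod (P ∷ b ∷ u ∷ v ∷ y′ ∷ []) (λ P b u v y′ → con 1 :* (b :* (P :* y′))
                := y′ :* v :* b :* (P :* u) given (u :* v := con 1 ∷ [])) (uv≡1 ∷ []) ⟩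
          y′ * v * b * (P * u)           ≡⟨ cong (y′ * v * b *_) d≡ ⟨
          y′ * v * b * dℚ                ∎))
        where
        e : ℚ
        e = P * y * y′ * v

  -- The maximal ideal consists of the (a , b) with 3 ∣ a.
  multiple-of-π : ∀ {y b} → Int y → Int b → ∃ λ z → Oᴷ z × (P * y , b) ≡ π *K z
  multiple-of-π {y} {b} Iy Ib = (b * s , y * v * s) ,
        (Int-* Ib Is , (integral (y ∷ v ∷ s ∷ []) (λ y v s → y :* v :* s) (Iy ∷ Iv ∷ Is ∷ []))) , cong₂ _,_
    (sym (trans (cong (λ d → 0# * (b * s) + d * r * (y * v * s)) d≡)
      (solveMod (P ∷ b ∷ r ∷ s ∷ u ∷ v ∷ y ∷ [])
            (λ P b r s u v y → con 0 :* (b :* s) :+ P :* u :* r :* (y :* v :* s) := P :* y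
            given (u :* v := con 1 ∷ r :* s := con 1 ∷ [])) (uv≡1 ∷ rs≡1 ∷ []))))
    (solveMod (b ∷ r ∷ s ∷ y * v * s ∷ []) (λ b r s t → b := con 0 :* t :+ r :* (b :* s)
          given (r :* s := con 1 ∷ [])) (rs≡1 ∷ []))

  valuation-ring : ValuationRing K-field
  valuation-ring = record
    { O = Oᴷ
    ; π = π
    ; O-1 = Int-1 , Int-nat 0
    ; O-π = Int-nat 0 , Ir
    ; O-+ = λ (Ia , Ib) (Ic , Ie) → Int-+ Ia Ic , Int-+ Ib Ie
    ; O-* = λ {(a , b)} {(c , e)} (Ia , Ib) (Ic , Ie) →
        (integral (a ∷ b ∷ c ∷ e ∷ dℚ ∷ []) (λ a b c e d → a :* c :+ d :* b :* e) (Ia ∷ Ib ∷ Ic ∷ Ie ∷ Id ∷ []))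
              , (integral (a ∷ b ∷ c ∷ e ∷ []) (λ a b c e → a :* e :+ b :* c) (Ia ∷ Ib ∷ Ic ∷ Ie ∷ []))
    ; O-neg = λ (Ia , Ib) → Int-neg Ia , Int-neg Ib
    ; valuation = valuationK
    ; residue = residueK
    ; π≢0 = λ π≡0 → 1≢0 (trans (sym rs≡1) (trans (cong (_* s) (cong proj₂ π≡0)) (zeroˡ s)))
    ; π-nonunit = nonunit }
    where
    residueK : ∀ {z} → Oᴷ z → ∃ λ y → Oᴷ y × (z ≡ π *K y ⊎ z ≡ 1K +K π *K y ⊎ z ≡ -K 1K +K π *K y)
    residueK {a , b} (Ia , Ib) = by-residue (residue₃ Ia)
      where
      by-residue : (∃ λ y → Int y × (a ≡ P * y ⊎ a ≡ 1# + P * y ⊎ a ≡ - 1# + P * y)) →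
                   ∃ λ y → Oᴷ y × ((a , b) ≡ π *K y ⊎ (a , b) ≡ 1K +K π *K y ⊎ (a , b) ≡ -K 1K +K π *K y)
      by-residue (y , Iy , inj₁ refl) = let z , Oz , eq = multiple-of-π Iy Ib in z , Oz , inj₁ eq
      by-residue (y , Iy , inj₂ (inj₁ refl)) = let z , Oz , eq = multiple-of-π Iy Ib in
        z , Oz , inj₂ (inj₁ (trans (cong₂ _,_ refl (sym (+-identityˡ b))) (cong (1K +K_) eq)))
      by-residue (y , Iy , inj₂ (inj₂ refl)) = let z , Oz , eq = multiple-of-π Iy Ib in
        z , Oz , inj₂ (inj₂ (trans (cong₂ _,_ refl (sym (+-identityˡ b))) (cong (-K 1K +K_) eq)))
    nonunit : ∀ {y} → Oᴷ y → π *K y ≢ 1K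
    nonunit {a , b} (_ , Ib) eq = P-nonunit ((integral (u ∷ r ∷ b ∷ []) (λ u r b → u :* r :* b) (Iu ∷ Ir ∷ Ib ∷ [])))
      (trans (solve (P ∷ u ∷ r ∷ b ∷ a ∷ []) (λ P u r b a → P :* (u :* r :* b) := con 0 :* a :+ P :* u :* r :* b))
        (trans (cong (λ d → 0# * a + d * r * b) (sym d≡)) (cong proj₁ eq)))

-- Points on the twist, and their triples.

module ℤ₍₂₎ = Local 2 prime[2]
open ℤ₍₂₎ using () renaming (Int to Int₂)

-- Rational points on a twist of the modular curve X₁(2,12) : y² = x³ − x² + x,
-- with ζ = 1/(3x), that are close to the point ζ = 1 in ℤ₍₃₎ and to ζ = 0 in ℤ₍₂₎.
record State (D n : ℕ) : Set where
  field
    ζ θ z ζ₂ θ₂ : ℚ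
    Iz     : Int z
    Iθ     : Int θ
    I₂ζ₂   : Int₂ ζ₂
    I₂θ₂   : Int₂ θ₂
    ζ≡     : ζ ≡ 1# + nat 3 * z
    ζ≡2ζ₂  : ζ ≡ nat 2 * ζ₂
    θ≡     : θ ≡ nat 2 ^ n * θ₂
    curve  : ι (ℤ.+ D) * θ ^ 2 ≡ ζ * (1# - nat 3 * ζ + nat 9 * ζ ^ 2)

  Iζ : Int ζ
  Iζ = subst Int (sym ζ≡) (integral (z ∷ []) (λ z → con 1 :+ con 3 :* z) (Iz ∷ []))

-- The inverses found at 3 and at 2 coincide, since inverses in ℚ are unique.
inverse₂₃ : ∀ {x y z} → Int y → Int₂ z → x ≡ 1# + nat 3 * y → x ≡ 1# + nat 2 * z → ∃ λ i → Int i × Int₂ i × x * i ≡ 1#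
inverse₂₃ {x} Iy I₂z x≡ x≡′ = i , Ii , subst Int₂ (*-cancelˡ {x} (≢0-factor {x} {i} xi) (trans xj (sym xi))) I₂j , xi
  where
  u₃ = unit-near-1 Iy
  u₂ = ℤ₍₂₎.unit-near-1 I₂z
  i j : ℚ
  i = proj₁ (proj₂ u₃)
  j = proj₁ (proj₂ u₂)
  Ii : Int i
  Ii = proj₁ (proj₂ (proj₂ u₃))
  I₂j : Int₂ j
  I₂j = proj₁ (proj₂ (proj₂ u₂))
  xi : x * i ≡ 1#
  xi = trans (cong (_* i) x≡) (proj₂ (proj₂ (proj₂ u₃)))
  xj : x * j ≡ 1#
  xj = trans (cong (_* j) x≡′) (proj₂ (proj₂ (proj₂ u₂)))

-- Duplication on the twist; it divides θ by 2 once more in ℤ₍₂₎.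
double : ∀ {D n} → State D n → State D (suc n)
double {D} {n} st = record
  { ζ = ζ′ ; θ = θ′ ; z = z′ ; ζ₂ = nat 2 * ζ * N * k ^ 2 ; θ₂ = θ₂ * Q * k ^ 3
  ; Iz = integral (z ∷ ζ ∷ N ∷ k ∷ [])
        (λ z ζ N k → ζ :* N :* k :^ 2 :+ z :* N :* k :^ 2 :+ (con 3 :* ζ :^ 2 :- ζ) :* k :^ 2 :+ con 3 :* ζ :^ 2
        :* k :* (k :+ con 1)) (Iz ∷ Iζ ∷ IN ∷ Ik ∷ [])
  ; Iθ = integral (θ ∷ ζ ∷ k ∷ [])
        (λ θ ζ k → con 2 :* θ :* (con 1 :- con 6 :* ζ :+ con 54 :* ζ :^ 2 :- con 54 :* ζ :^ 3 :+ con 81 :* ζ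
        :^ 4) :* k :^ 3) (Iθ ∷ Iζ ∷ Ik ∷ [])
  ; I₂ζ₂ = ℤ₍₂₎.integral (ζ ∷ N ∷ k ∷ []) (λ ζ N k → con 2 :* ζ :* N :* k :^ 2) (I₂ζ ∷ I₂N ∷ I₂k ∷ [])
  ; I₂θ₂ = ℤ₍₂₎.integral (θ₂ ∷ ζ ∷ k ∷ [])
        (λ θ₂ ζ k → θ₂ :* (con 1 :- con 6 :* ζ :+ con 54 :* ζ :^ 2 :- con 54 :* ζ :^ 3 :+ con 81 :* ζ :^ 4) :* k
        :^ 3) (I₂θ₂ ∷ I₂ζ ∷ I₂k ∷ [])
  -- Each of 4, `ζ`, `N` and `k` is 1 modulo 3; the difference `4 ζ N k² − 1` is telescoped over
  -- these factors.
  ; ζ≡ = begin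
      nat 4 * ζ * N * k ^ 2
        ≡⟨ solve (ζ ∷ N ∷ k ∷ []) (λ ζ N k → con 4 :* ζ :* N :* k :^ 2
              := con 3 :* (ζ :* N :* k :^ 2) :+ (ζ :- con 1) :* N :* k :^ 2 :+ (N :- con 1) :* k :^ 2 :+
              (k :- con 1) :* (k :+ con 1) :+ con 1) ⟩
      nat 3 * (ζ * N * k ^ 2) + (ζ - 1#) * N * k ^ 2 + (N - 1#) * k ^ 2 + (k - 1#) * (k + 1#) + 1#
        ≡⟨ cong₂ (λ x y → nat 3 * (ζ * N * k ^ 2) + x * N * k ^ 2 + (N - 1#) * k ^ 2 + y * (k + 1#) + 1#) ζ-1 k-1 ⟩
      nat 3 * (ζ * N * k ^ 2) + nat 3 * z * N * k ^ 2 + (N - 1#) * k ^ 2 + nat 9 * ζ ^ 2 * k * (k + 1#) + 1#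
        ≡⟨ solve (ζ ∷ z ∷ N ∷ k ∷ []) (λ ζ z M k →
              con 3 :* (ζ :* M :* k :^ 2) :+ con 3 :* z :* M :* k :^ 2 :+
              (con 1 :- con 3 :* ζ :+ con 9 :* ζ :^ 2 :- con 1) :* k :^ 2 :+ con 9 :* ζ :^ 2 :* k :*
              (k :+ con 1) :+ con 1 := con 1 :+ con 3 :*
              (ζ :* M :* k :^ 2 :+ z :* M :* k :^ 2 :+ (con 3 :* ζ :^ 2 :- ζ) :* k :^ 2 :+ con 3 :* ζ :^ 2 :* k
              :* (k :+ con 1))) ⟩
      1# + nat 3 * z′ ∎
  ; ζ≡2ζ₂ = solve (ζ ∷ N ∷ k ∷ []) (λ ζ N k → con 4 :* ζ :* N :* k :^ 2 := con 2 :* (con 2 :* ζ :* N :* k :^ 2))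
  ; θ≡ = trans (cong (λ t → nat 2 * t * Q * k ^ 3) θ≡)
      (trans (solve (nat 2 ^ n ∷ θ₂ ∷ Q ∷ k ∷ []) (λ a θ₂ Q k → con 2 :* (a :* θ₂) :* Q :* k :^ 3
            := con 2 :* a :* (θ₂ :* Q :* k :^ 3)))
        (cong (_* (θ₂ * Q * k ^ 3)) (sym (^-suc (nat 2) n))))
  ; curve = begin
      ι (ℤ.+ D) * (nat 2 * θ * Q * k ^ 3) ^ 2
        ≡⟨ solve (ι (ℤ.+ D) ∷ θ ∷ Q ∷ k ∷ []) (λ d θ Q k → d :* (con 2 :* θ :* Q :* k :^ 3) :^ 2
              := d :* θ :^ 2 :* (con 4 :* Q :^ 2 :* k :^ 6)) ⟩
      ι (ℤ.+ D) * θ ^ 2 * (nat 4 * Q ^ 2 * k ^ 6)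
        ≡⟨ cong (_* (nat 4 * Q ^ 2 * k ^ 6)) curve ⟩
      ζ * N * (nat 4 * Q ^ 2 * k ^ 6)
        -- The point is the identity `Q² = E⁴ − 12 ζ N E² + 144 ζ² N²`, whose right side is
        -- `E⁴ (1 − 3 ζ′ + 9 ζ′²)` because `ζ′ = 4 ζ N / E²`.
        ≡⟨ solve (ζ ∷ k ∷ []) (λ ζ k → ζ :* (con 1 :- con 3 :* ζ :+ con 9 :* ζ :^ 2) :*
              (con 4 :* (con 1 :- con 6 :* ζ :+ con 54 :* ζ :^ 2 :- con 54 :* ζ :^ 3 :+ con 81 :* ζ :^ 4) :^ 2
              :* k :^ 6) := con 4 :* ζ :* (con 1 :- con 3 :* ζ :+ con 9 :* ζ :^ 2) :* k :^ 6 :*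
              ((con 1 :- con 9 :* ζ :^ 2) :^ 4 :- con 12 :* ζ :* (con 1 :- con 3 :* ζ :+ con 9 :* ζ :^ 2) :*
              (con 1 :- con 9 :* ζ :^ 2) :^ 2 :+ con 144 :* ζ :^ 2 :* (con 1 :- con 3 :* ζ :+ con 9 :* ζ :^ 2)
              :^ 2)) ⟩
      nat 4 * ζ * N * k ^ 6 * (E ^ 4 - nat 12 * ζ * N * E ^ 2 + nat 144 * ζ ^ 2 * N ^ 2)
        ≡⟨ solveMod (ζ ∷ N ∷ k ∷ E ∷ [])
              (λ ζ N k E → con 4 :* ζ :* N :* k :^ 6 :*
              (E :^ 4 :- con 12 :* ζ :* N :* E :^ 2 :+ con 144 :* ζ :^ 2 :* N :^ 2)
              := con 4 :* ζ :* N :* k :^ 2 :*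
              (con 1 :- con 3 :* (con 4 :* ζ :* N :* k :^ 2) :+ con 9 :* (con 4 :* ζ :* N :* k :^ 2) :^ 2)
              given (E :* k := con 1 ∷ [])) (Ek ∷ []) ⟩
      ζ′ * (1# - nat 3 * ζ′ + nat 9 * ζ′ ^ 2) ∎ }
  where
  open State st
  open ≡-Reasoning
  -- With `ζ = 1/(3x)`, the duplication `(x² − 1)²/(4 (x³ − x² + x))` becomes `4 ζ N / E²`, and `θ`
  -- becomes `2 θ Q / E³`. As `ζ` is even, `E` is a unit at 2 as well as at 3.
  N Q E : ℚ
  N = 1# - nat 3 * ζ + nat 9 * ζ ^ 2
  Q = 1# - nat 6 * ζ + nat 54 * ζ ^ 2 - nat 54 * ζ ^ 3 + nat 81 * ζ ^ 4
  E = 1# - nat 9 * ζ ^ 2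
  I₂ζ : Int₂ ζ
  I₂ζ = subst Int₂ (sym ζ≡2ζ₂) (ℤ₍₂₎.integral (ζ₂ ∷ []) (λ ζ₂ → con 2 :* ζ₂) (I₂ζ₂ ∷ []))
  IN : Int N
  IN = integral (ζ ∷ []) (λ ζ → con 1 :- con 3 :* ζ :+ con 9 :* ζ :^ 2) (Iζ ∷ [])
  I₂N : Int₂ N
  I₂N = ℤ₍₂₎.integral (ζ ∷ []) (λ ζ → con 1 :- con 3 :* ζ :+ con 9 :* ζ :^ 2) (I₂ζ ∷ [])
  E-inverse : ∃ λ i → Int i × Int₂ i × E * i ≡ 1#
  E-inverse = inverse₂₃ {y = - (nat 3 * ζ ^ 2)} {z = - (nat 18 * ζ₂ ^ 2)}
        (integral (ζ ∷ []) (λ ζ → :- (con 3 :* ζ :^ 2)) (Iζ ∷ []))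
        (ℤ₍₂₎.integral (ζ₂ ∷ []) (λ ζ₂ → :- (con 18 :* ζ₂ :^ 2)) (I₂ζ₂ ∷ []))
    (solve (ζ ∷ []) (λ ζ → con 1 :- con 9 :* ζ :^ 2 := con 1 :+ con 3 :* :- (con 3 :* ζ :^ 2)))
    (trans (cong (λ t → 1# - nat 9 * t ^ 2) ζ≡2ζ₂) (solve (ζ₂ ∷ []) (λ ζ₂ → con 1 :- con 9 :* (con 2 :* ζ₂) :^ 2
          := con 1 :+ con 2 :* :- (con 18 :* ζ₂ :^ 2))))
  k : ℚ
  k = proj₁ E-inverse
  Ik : Int k
  Ik = proj₁ (proj₂ E-inverse)
  I₂k : Int₂ k
  I₂k = proj₁ (proj₂ (proj₂ E-inverse))
  Ek : E * k ≡ 1#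
  Ek = proj₂ (proj₂ (proj₂ E-inverse))
  ζ′ θ′ z′ : ℚ
  ζ′ = nat 4 * ζ * N * k ^ 2
  θ′ = nat 2 * θ * Q * k ^ 3
  z′ = ζ * N * k ^ 2 + z * N * k ^ 2 + (nat 3 * ζ ^ 2 - ζ) * k ^ 2 + nat 3 * ζ ^ 2 * k * (k + 1#)
  ζ-1 : ζ - 1# ≡ nat 3 * z
  ζ-1 = trans (cong (_- 1#) ζ≡) (solve (z ∷ []) (λ z → con 1 :+ con 3 :* z :- con 1 := con 3 :* z))
  k-1 : k - 1# ≡ nat 9 * ζ ^ 2 * k
  k-1 = trans (cong (λ t → k - t) (sym Ek)) (solve (ζ ∷ k ∷ []) (λ ζ k → k :- (con 1 :- con 9 :* ζ :^ 2) :* k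
        := con 9 :* ζ :^ 2 :* k))

doubles : ∀ {D} n → State D 0 → State D n
doubles zero    st = st
doubles (suc n) st = double (doubles n st)

module FromState (D : ℕ) (3∤D : ¬ (3 ∣ₙ D)) {n : ℕ} (st : State D n) where
  open State st
  open ≡-Reasoning

  u v : ℚ
  u = ι (ℤ.+ D)
  v = u ⁻¹

  d : ℤ
  d = ℤ.+ (3 ℕ.* D)

  d≡ : ι d ≡ P * u
  d≡ = trans (cong ι (ℤₚ.pos-* 3 D)) (ι-* (ℤ.+ 3) (ℤ.+ D))

  Iu : Int u
  Iu = Int-ι (ℤ.+ D)

  uv≡1 : u * v ≡ 1#
  uv≡1 = inverseʳ u (ι≢0 {ℤ.+ D} 3∤D)

  Iv : Int v
  Iv = int (ℤ.+ 1) (ℤ.+ D) 3∤D (trans (*-comm v u) uv≡1)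

  private
    I₂ζ : Int₂ ζ
    I₂ζ = subst Int₂ (sym ζ≡2ζ₂) (ℤ₍₂₎.integral (ζ₂ ∷ []) (λ ζ₂ → con 2 :* ζ₂) (I₂ζ₂ ∷ []))

    h-inverse : ∃ λ i → Int i × Int₂ i × (1# - nat 3 * ζ) * i ≡ 1#
    h-inverse = inverse₂₃ {y = - ζ} {z = - (nat 3 * ζ₂)} (Int-neg Iζ)
          (ℤ₍₂₎.integral (ζ₂ ∷ []) (λ ζ₂ → :- (con 3 :* ζ₂)) (I₂ζ₂ ∷ []))
      (solve (ζ ∷ []) (λ ζ → con 1 :- con 3 :* ζ := con 1 :+ con 3 :* :- ζ))
      (trans (cong (λ t → 1# - nat 3 * t) ζ≡2ζ₂) (solve (ζ₂ ∷ []) (λ ζ₂ → con 1 :- con 3 :* (con 2 :* ζ₂)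
            := con 1 :+ con 2 :* :- (con 3 :* ζ₂))))

  h : ℚ
  h = proj₁ h-inverse

  Ih : Int h
  Ih = proj₁ (proj₂ h-inverse)

  private
    I₂h : Int₂ h
    I₂h = proj₁ (proj₂ (proj₂ h-inverse))

    h≡ : (1# - nat 3 * ζ) * h ≡ 1#
    h≡ = proj₂ (proj₂ (proj₂ h-inverse))

  -- With `h = 1/(1 − 3ζ)` this parametrises the conic `q² = 2m + 1` by `m = 6ζ/(1 − 3ζ)²`,
  -- `q = (1 + 3ζ)/(1 − 3ζ)`. Then `m (m + 2) = 12 ζ (1 − 3ζ + 9ζ²) h⁴`, so the curve of `State`
  -- says that `r √(3D)` is a square root of it. `w` is `π²/3`.
  m₁ m₀ q₀ r w w′ : ℚ
  m₁ = nat 2 * ζ * h ^ 2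
  m₀ = P * m₁
  q₀ = (1# + nat 3 * ζ) * h
  r  = nat 2 * θ * h ^ 2
  w  = m₁ * (m₀ + nat 2)
  w′ = nat 4 * ζ ^ 2 * h ^ 4 + ζ * h ^ 2 + z * h ^ 2 + ζ * h * (h + 1#)

  Im₁ : Int m₁
  Im₁ = integral (ζ ∷ h ∷ []) (λ ζ h → con 2 :* ζ :* h :^ 2) (Iζ ∷ Ih ∷ [])

  Ir : Int r
  Ir = integral (θ ∷ h ∷ []) (λ θ h → con 2 :* θ :* h :^ 2) (Iθ ∷ Ih ∷ [])

  private
    Iw′ : Int w′
    Iw′ = integral (ζ ∷ h ∷ z ∷ [])
          (λ ζ h z → con 4 :* ζ :^ 2 :* h :^ 4 :+ ζ :* h :^ 2 :+ z :* h :^ 2 :+ ζ :* h :* (h :+ con 1))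
          (Iζ ∷ Ih ∷ Iz ∷ [])

    ur² : u * r ^ 2 ≡ w
    ur² = begin
      u * (nat 2 * θ * h ^ 2) ^ 2        ≡⟨ solve (u ∷ θ ∷ h ∷ []) (λ u θ h → u :* (con 2 :* θ :* h :^ 2) :^ 2
            := u :* θ :^ 2 :* (con 4 :* h :^ 4)) ⟩
      u * θ ^ 2 * (nat 4 * h ^ 4)        ≡⟨ cong (_* (nat 4 * h ^ 4)) curve ⟩
      ζ * (1# - nat 3 * ζ + nat 9 * ζ ^ 2) * (nat 4 * h ^ 4)
        ≡⟨ solve (ζ ∷ h ∷ []) (λ ζ h → ζ :* (con 1 :- con 3 :* ζ :+ con 9 :* ζ :^ 2) :* (con 4 :* h :^ 4)
              := con 2 :* ζ :* h :^ 2 :* (con 3 :* (con 2 :* ζ :* h :^ 2) :+ con 2 :*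
              ((con 1 :- con 3 :* ζ) :* h) :^ 2)) ⟩
      nat 2 * ζ * h ^ 2 * (nat 3 * (nat 2 * ζ * h ^ 2) + nat 2 * ((1# - nat 3 * ζ) * h) ^ 2)
        ≡⟨ cong (λ t → nat 2 * ζ * h ^ 2 * (nat 3 * (nat 2 * ζ * h ^ 2) + nat 2 * t ^ 2)) h≡ ⟩
      w                                  ∎

    -- Modulo 3, `w` is `2ζ · 2`, hence 1 by the congruence for `ζ`. That congruence is carried by
    -- `State` for this purpose: it makes `e = 1/w` congruent to 1.
    w≡ : w ≡ 1# + P * w′
    w≡ = begin
      nat 2 * ζ * h ^ 2 * (nat 3 * (nat 2 * ζ * h ^ 2) + nat 2)
        ≡⟨ solve (ζ ∷ h ∷ []) (λ ζ h → con 2 :* ζ :* h :^ 2 :* (con 3 :* (con 2 :* ζ :* h :^ 2) :+ con 2)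
              := con 12 :* ζ :^ 2 :* h :^ 4 :+ con 3 :* ζ :* h :^ 2 :+ (ζ :- con 1) :* h :^ 2 :+ (h :- con 1) :*
              (h :+ con 1) :+ con 1) ⟩
      nat 12 * ζ ^ 2 * h ^ 4 + nat 3 * ζ * h ^ 2 + (ζ - 1#) * h ^ 2 + (h - 1#) * (h + 1#) + 1#
        ≡⟨ cong₂ (λ x y → nat 12 * ζ ^ 2 * h ^ 4 + nat 3 * ζ * h ^ 2 + x * h ^ 2 + y * (h + 1#) + 1#)
            (trans (cong (_- 1#) ζ≡) (solve (z ∷ []) (λ z → con 1 :+ con 3 :* z :- con 1 := con 3 :* z)))
            (trans (cong (λ t → h - t) (sym h≡)) (solve (ζ ∷ h ∷ []) (λ ζ h → h :- (con 1 :- con 3 :* ζ) :* h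
                  := con 3 :* ζ :* h))) ⟩
      nat 12 * ζ ^ 2 * h ^ 4 + nat 3 * ζ * h ^ 2 + nat 3 * z * h ^ 2 + nat 3 * ζ * h * (h + 1#) + 1#
        ≡⟨ solve (ζ ∷ h ∷ z ∷ []) (λ ζ h z →
              con 12 :* ζ :^ 2 :* h :^ 4 :+ con 3 :* ζ :* h :^ 2 :+ con 3 :* z :* h :^ 2 :+ con 3 :* ζ :* h :*
              (h :+ con 1) :+ con 1 := con 1 :+ con 3 :*
              (con 4 :* ζ :^ 2 :* h :^ 4 :+ ζ :* h :^ 2 :+ z :* h :^ 2 :+ ζ :* h :* (h :+ con 1))) ⟩
      1# + P * w′ ∎

    w-unit : Unit (1# + P * w′)
    w-unit = unit-near-1 Iw′

  w⁻¹ s : ℚ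
  w⁻¹ = proj₁ (proj₂ w-unit)
  s   = u * r * w⁻¹

  Iw⁻¹ : Int w⁻¹
  Iw⁻¹ = proj₁ (proj₂ (proj₂ w-unit))

  w*w⁻¹ : w * w⁻¹ ≡ 1#
  w*w⁻¹ = trans (cong (_* w⁻¹) w≡) (proj₂ (proj₂ (proj₂ w-unit)))

  Is : Int s
  Is = Int-* (Int-* Iu Ir) Iw⁻¹

  rs≡1 : r * s ≡ 1#
  rs≡1 = trans (solve (r ∷ u ∷ w⁻¹ ∷ []) (λ r u i → r :* (u :* r :* i) := u :* r :^ 2 :* i))
        (trans (cong (_* w⁻¹) ur²) w*w⁻¹)

  open QField d
  module R = Ramified d u v r s Iu Iv uv≡1 d≡ Ir Is rs≡1
  module V = ValuationRingProperties R.valuation-ring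
  module 𝕂 = Field R.K-field

  m q e : K
  m = m₀ , 0#
  q = q₀ , 0#
  e = w⁻¹ , 0#

  private
    q²≡ : q 𝕂.^ 2 ≡ 𝕂.nat 2 *K m +K 1K
    q²≡ = cong₂ _,_ (begin
        (1# + nat 3 * ζ) * h * ((1# + nat 3 * ζ) * h) + dℚ * 0# * 0#
          ≡⟨ solve (dℚ ∷ ζ ∷ h ∷ []) (λ d ζ h →
                (con 1 :+ con 3 :* ζ) :* h :* ((con 1 :+ con 3 :* ζ) :* h) :+ d :* con 0 :* con 0
                := con 2 :* (con 3 :* (con 2 :* ζ :* h :^ 2)) :+ d :* con 0 :* con 0 :+
                ((con 1 :- con 3 :* ζ) :* h) :^ 2) ⟩
        nat 2 * m₀ + dℚ * 0# * 0# + ((1# - nat 3 * ζ) * h) ^ 2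
          ≡⟨ cong (λ t → nat 2 * m₀ + dℚ * 0# * 0# + t ^ 2) h≡ ⟩
        nat 2 * m₀ + dℚ * 0# * 0# + 1# ∎)
      (solve (q₀ ∷ m₀ ∷ []) (λ x y → x :* con 0 :+ con 0 :* x := con 2 :* con 0 :+ con 0 :* y :+ con 0))

    dr² : dℚ * r * r ≡ P * w
    dr² = trans (cong (λ t → t * r * r) d≡)
          (trans (solve (P ∷ u ∷ r ∷ []) (λ P u r → P :* u :* r :* r := P :* (u :* r :^ 2))) (cong (P *_) ur²))

    π²≡ : R.π 𝕂.^ 2 ≡ m *K (m +K 𝕂.nat 2)
    π²≡ = cong₂ _,_
      (trans (solve (dℚ * r * r ∷ []) (λ x → con 0 :* con 0 :+ x := x))
            (trans dr² (solve (P ∷ dℚ ∷ m₁ ∷ []) (λ P d x → P :* (x :* (P :* x :+ con 2))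
            := P :* x :* (P :* x :+ con 2) :+ d :* con 0 :* (con 0 :+ con 0)))))
      (solve (r ∷ m₀ ∷ []) (λ r x → con 0 :* r :+ r :* con 0 := x :* (con 0 :+ con 0) :+ con 0 :* (x :+ con 2)))

    Mm : V.M m
    Mm = R.multiple-of-π Im₁ (Int-nat 0)

    3≡π²e : 𝕂.nat 3 ≡ R.π 𝕂.^ 2 *K e
    3≡π²e = cong₂ _,_
      (sym (begin
        (0# * 0# + dℚ * r * r) * w⁻¹ + dℚ * (0# * r + r * 0#) * 0#
          ≡⟨ solve (dℚ * r * r ∷ w⁻¹ ∷ dℚ ∷ r ∷ []) (λ x i d r →
                (con 0 :* con 0 :+ x) :* i :+ d :* (con 0 :* r :+ r :* con 0) :* con 0 := x :* i) ⟩
        dℚ * r * r * w⁻¹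
          ≡⟨ cong (_* w⁻¹) dr² ⟩
        P * w * w⁻¹
          ≡⟨ solveMod (P ∷ w ∷ w⁻¹ ∷ []) (λ P w i → P :* w :* i := P given (w :* i := con 1 ∷ [])) (w*w⁻¹ ∷ []) ⟩
        P ∎))
      (solve (dℚ ∷ r ∷ w⁻¹ ∷ []) (λ d r i → con 0 :=
            (con 0 :* con 0 :+ d :* r :* r) :* con 0 :+ (con 0 :* r :+ r :* con 0) :* i))

    Me-1 : V.M (e 𝕂.- 1K)
    Me-1 = subst V.M (cong₂ _,_
        (begin
          P * - (w′ * w⁻¹)                ≡⟨ solve (P ∷ w′ ∷ w⁻¹ ∷ []) (λ P x i → P :* :- (x :* i)
                := i :- (con 1 :+ P :* x) :* i) ⟩
          w⁻¹ - (1# + P * w′) * w⁻¹       ≡⟨ cong (λ t → w⁻¹ - t * w⁻¹) w≡ ⟨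
          w⁻¹ - w * w⁻¹                   ≡⟨ cong (λ t → w⁻¹ - t) w*w⁻¹ ⟩
          w⁻¹ - 1#                        ∎)
        refl)
      (R.multiple-of-π (Int-neg (Int-* Iw′ Iw⁻¹)) (Int-nat 0))

  module Fam = Family R.valuation-ring m q e q²≡ π²≡ Mm 3≡π²e Me-1

  2ⁿ∣r : ∃ λ x → Int₂ x × r ≡ nat 2 ^ n * x
  2ⁿ∣r = nat 2 * θ₂ * h ^ 2 , (ℤ₍₂₎.integral (θ₂ ∷ h ∷ []) (λ θ₂ h → con 2 :* θ₂ :* h :^ 2) (I₂θ₂ ∷ I₂h ∷ [])) ,
    trans (cong (λ t → nat 2 * t * h ^ 2) θ≡)
          (solve (nat 2 ^ n ∷ θ₂ ∷ h ∷ []) (λ a θ₂ h → con 2 :* (a :* θ₂) :* h :^ 2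
          := a :* (con 2 :* θ₂ :* h :^ 2)))

-- Infinitely many fields: squarefree parts divisible by a large prime.

prime-above : ∀ N → ∃ λ ℓ → Prime ℓ × N < ℓ
prime-above N = from-factors (PrimeFactorisation.factors F) (PrimeFactorisation.isFactorisation F)
      (PrimeFactorisation.factorsPrime F)
  where
  F : PrimeFactorisation (suc (N !))
  F = factorise (suc (N !))

  divides-factorial : ∀ {p} → .{{NonZero p}} → p ℕ.≤ N → p ∣ₙ N !
  divides-factorial {suc p} p≤N = ∣ₙ.∣-trans (divides (p !) (ℕₚ.*-comm (suc p) (p !))) (∣ₙ.m≤n⇒m!∣n! p≤N)

  from-factors : ∀ ps → suc (N !) ≡ ListAction.product ps → All Prime ps → ∃ λ ℓ → Prime ℓ × N < ℓ
  from-factors []       eq _        = ⊥-elim (ℕₚ.<⇒≢ (ℕₚ.1≤n! N) (sym (ℕₚ.suc-injective eq)))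
  from-factors (p ∷ ps) eq (pp ∷ _) = p , pp , ℕₚ.≰⇒> λ p≤N →
    ℕₚ.<⇒≢ (ℕ.nonTrivial⇒n>1 p {{prime⇒nonTrivial pp}}) (sym (∣ₙ.∣1⇒≡1
      (∣ₙ.∣m+n∣m⇒∣n (subst (p ∣ₙ_) (trans (sym eq) (ℕₚ.+-comm 1 (N !)))
            (divides (ListAction.product ps) (ℕₚ.*-comm p (ListAction.product ps))))
                    (divides-factorial {{prime⇒nonZero pp}} p≤N))))

SquarefreeDecomposition : ℕ → Set
SquarefreeDecomposition n = ∃ λ D → ∃ λ T → n ≡ D ℕ.* (T ℕ.* T) × (∀ k → k ℕ.* k ∣ₙ D → k ≡ 1)

squarefree-decomposition : ∀ n → n ≢ 0 → SquarefreeDecomposition n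
squarefree-decomposition = <-rec (λ n → n ≢ 0 → SquarefreeDecomposition n) step
  where
  step : ∀ n → (∀ {m} → m < n → m ≢ 0 → SquarefreeDecomposition m) → n ≢ 0 → SquarefreeDecomposition n
  step n ih n≢0 = by-search (ℕₚ.anyUpTo? (λ k → ¬? (k ℕ.≟ 1) ×-dec (k ℕ.* k ∣ₙ.∣? n)) (suc n))
    where
    by-search : Dec (∃ λ k → k < suc n × k ≢ 1 × k ℕ.* k ∣ₙ n) → SquarefreeDecomposition n
    by-search (no none) = n , 1 , sym (ℕₚ.*-identityʳ n) , λ k kk∣n → unit k kk∣n (k ℕ.≟ 1)
      where
      unit : ∀ k → k ℕ.* k ∣ₙ n → Dec (k ≡ 1) → k ≡ 1
      unit k _    (yes k≡1) = k≡1
      unit k kk∣n (no  k≢1) = ⊥-elim (none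
            (k , ℕ.s≤s (∣ₙ.∣⇒≤ {{ℕ.≢-nonZero n≢0}} (∣ₙ.∣-trans (divides k refl) kk∣n)) , k≢1 , kk∣n))
    by-search (yes (k , _ , k≢1 , divides m n≡)) = from-quotient (ih (m<n k k≢1 n≡) m≢0)
      where
      m≢0 : m ≢ 0
      m≢0 refl = n≢0 n≡
      m<n : ∀ k → k ≢ 1 → n ≡ m ℕ.* (k ℕ.* k) → m < n
      m<n zero          _   eq = ⊥-elim (n≢0 (trans eq (ℕₚ.*-zeroʳ m)))
      m<n (suc zero)    k≢1 _  = ⊥-elim (k≢1 refl)
      m<n (suc (suc k)) _   eq = subst (m <_) (sym eq)
            (ℕₚ.m<m*n m (suc (suc k) ℕ.* suc (suc k)) {{ℕ.≢-nonZero m≢0}} (ℕ.s≤s (ℕ.s≤s ℕ.z≤n)))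
      regroup : ∀ D T k → D ℕ.* (T ℕ.* T) ℕ.* (k ℕ.* k) ≡ D ℕ.* ((T ℕ.* k) ℕ.* (T ℕ.* k))
      regroup = solve-∀
      from-quotient : SquarefreeDecomposition m → SquarefreeDecomposition n
      from-quotient (D , T , m≡ , sf) = D , T ℕ.* k , trans n≡ (trans (cong (ℕ._* (k ℕ.* k)) m≡) (regroup D T k)) , sf

ι⁺ : ℕ → ℚ
ι⁺ n = ι (ℤ.+ n)

ι⁺-+ : ∀ m n → ι⁺ (m ℕ.+ n) ≡ ι⁺ m + ι⁺ n
ι⁺-+ m n = trans (cong ι (ℤₚ.pos-+ m n)) (ι-+ (ℤ.+ m) (ℤ.+ n))

ι⁺-* : ∀ m n → ι⁺ (m ℕ.* n) ≡ ι⁺ m * ι⁺ n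
ι⁺-* m n = trans (cong ι (ℤₚ.pos-* m n)) (ι-* (ℤ.+ m) (ℤ.+ n))

-- The prime ℓ exactly divides ζ (1 − 3ζ + 9ζ²) for ζ = ℓ (ℓ + 3), hence it
-- divides the squarefree part D.
module InitialState (ℓ : ℕ) (ℓ-prime : Prime ℓ) (3<ℓ : 3 < ℓ) where

  -- `f` is `1 − 3Z + 9Z²`, expanded in `Z − 1` so that no coefficient is negative.
  Z f : ℕ
  Z = ℓ ℕ.* (ℓ ℕ.+ 3)
  f = 9 ℕ.* (ℕ.pred Z ℕ.* ℕ.pred Z) ℕ.+ 15 ℕ.* ℕ.pred Z ℕ.+ 7

  private
    1<ℓ : 1 < ℓ
    1<ℓ = ℕ.nonTrivial⇒n>1 ℓ {{prime⇒nonTrivial ℓ-prime}}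

    Z≢0 : Z ≢ 0
    Z≢0 Z≡0 = [ (λ ℓ≡0 → ℕₚ.<⇒≢ (ℕₚ.<-trans (ℕ.s≤s ℕ.z≤n) 1<ℓ) (sym ℓ≡0)) ,
          (λ ℓ+3≡0 → ℕₚ.<⇒≢ (ℕₚ.m<n+m 0 {3} (ℕ.s≤s ℕ.z≤n)) (sym (ℕₚ.m+n≡0⇒n≡0 ℓ ℓ+3≡0))) ]′
      (ℕₚ.m*n≡0⇒m≡0∨n≡0 ℓ Z≡0)

    norm-identity : ∀ Z → Z ≢ 0 → 9 ℕ.* (ℕ.pred Z ℕ.* ℕ.pred Z) ℕ.+ 15 ℕ.* ℕ.pred Z ℕ.+ 7 ℕ.+ 3 ℕ.* Z ≡
          9 ℕ.* (Z ℕ.* Z) ℕ.+ 1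
    norm-identity zero    Z≢0 = ⊥-elim (Z≢0 refl)
    norm-identity (suc t) _   = identity t
      where
      identity : ∀ t → 9 ℕ.* (t ℕ.* t) ℕ.+ 15 ℕ.* t ℕ.+ 7 ℕ.+ 3 ℕ.* (1 ℕ.+ t) ≡ 9 ℕ.* ((1 ℕ.+ t) ℕ.* (1 ℕ.+ t)) ℕ.+ 1
      identity = solve-∀

    f+3Z : f ℕ.+ 3 ℕ.* Z ≡ 9 ℕ.* (Z ℕ.* Z) ℕ.+ 1
    f+3Z = norm-identity Z Z≢0

    Zf≢0 : Z ℕ.* f ≢ 0
    Zf≢0 Zf≡0 = [ Z≢0 , (λ f≡0 → ℕₚ.<⇒≢ (ℕ.s≤s ℕ.z≤n)
          (sym (ℕₚ.m+n≡0⇒n≡0 (9 ℕ.* (ℕ.pred Z ℕ.* ℕ.pred Z) ℕ.+ 15 ℕ.* ℕ.pred Z) f≡0))) ]′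
      (ℕₚ.m*n≡0⇒m≡0∨n≡0 Z Zf≡0)

    decomposition : SquarefreeDecomposition (Z ℕ.* f)
    decomposition = squarefree-decomposition (Z ℕ.* f) Zf≢0

  D W : ℕ
  D = proj₁ decomposition
  W = proj₁ (proj₂ decomposition)

  Zf≡DWW : Z ℕ.* f ≡ D ℕ.* (W ℕ.* W)
  Zf≡DWW = proj₁ (proj₂ (proj₂ decomposition))

  D-squarefree : ∀ k → k ℕ.* k ∣ₙ D → k ≡ 1
  D-squarefree = proj₂ (proj₂ (proj₂ decomposition))

  D≢0 : D ≢ 0
  D≢0 D≡0 = Zf≢0 (trans Zf≡DWW (cong (ℕ._* (W ℕ.* W)) D≡0))

  private
    prime∤1 : ∀ {p} → Prime p → ¬ (p ∣ₙ 1)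
    prime∤1 {p} pp p∣1 = ℕₚ.<⇒≢ (ℕ.nonTrivial⇒n>1 p {{prime⇒nonTrivial pp}}) (sym (∣ₙ.∣1⇒≡1 p∣1))

    3∤ℓ : ¬ (3 ∣ₙ ℓ)
    3∤ℓ 3∣ℓ = [ (λ ()) , (λ 3≡ℓ → ℕₚ.<⇒≢ 3<ℓ 3≡ℓ) ]′ (prime⇒irreducible ℓ-prime 3∣ℓ)

    ℓ∤3 : ¬ (ℓ ∣ₙ 3)
    ℓ∤3 ℓ∣3 = ℕₚ.<⇒≱ 3<ℓ (∣ₙ.∣⇒≤ ℓ∣3)

    3∤Z : ¬ (3 ∣ₙ Z)
    3∤Z 3∣Z = [ 3∤ℓ , (λ 3∣ℓ+3 → 3∤ℓ (∣ₙ.∣m+n∣m⇒∣n (subst (3 ∣ₙ_) (ℕₚ.+-comm ℓ 3) 3∣ℓ+3) (divides 1 refl))) ]′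
          (euclidsLemma ℓ (ℓ ℕ.+ 3) prime-3 3∣Z)

    3∤f : ¬ (3 ∣ₙ f)
    3∤f 3∣f = prime∤1 prime-3 (∣ₙ.∣m+n∣m⇒∣n (subst (3 ∣ₙ_) f+3Z (∣ₙ.∣m∣n⇒∣m+n 3∣f (divides Z (ℕₚ.*-comm 3 Z))))
      (divides (3 ℕ.* (Z ℕ.* Z)) (nine (Z ℕ.* Z))))
      where
      nine : ∀ x → 9 ℕ.* x ≡ 3 ℕ.* x ℕ.* 3
      nine = solve-∀

    ℓ∤f : ¬ (ℓ ∣ₙ f)
    ℓ∤f ℓ∣f = prime∤1 ℓ-prime (∣ₙ.∣m+n∣m⇒∣n (subst (ℓ ∣ₙ_) f+3Z (∣ₙ.∣m∣n⇒∣m+n ℓ∣f (∣ₙ.∣n⇒∣m*n 3 ℓ∣Z)))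
      (∣ₙ.∣n⇒∣m*n 9 (∣ₙ.∣m⇒∣m*n Z ℓ∣Z)))
      where
      ℓ∣Z : ℓ ∣ₙ Z
      ℓ∣Z = divides (ℓ ℕ.+ 3) (ℕₚ.*-comm ℓ (ℓ ℕ.+ 3))

  3∤D : ¬ (3 ∣ₙ D)
  3∤D 3∣D = [ 3∤Z , 3∤f ]′ (euclidsLemma Z f prime-3 (subst (3 ∣ₙ_) (sym Zf≡DWW) (∣ₙ.∣m⇒∣m*n (W ℕ.* W) 3∣D)))

  ℓ∣D : ℓ ∣ₙ D
  ℓ∣D = by-cases (euclidsLemma D (W ℕ.* W) ℓ-prime
        (subst (ℓ ∣ₙ_) (trans (sym (ℕₚ.*-assoc ℓ (ℓ ℕ.+ 3) f)) Zf≡DWW)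
        (divides ((ℓ ℕ.+ 3) ℕ.* f) (ℕₚ.*-comm ℓ _))))
    where
    ℓ∤cofactor : ¬ (ℓ ∣ₙ (ℓ ℕ.+ 3) ℕ.* f)
    ℓ∤cofactor ℓ∣ = [ (λ ℓ∣ℓ+3 → ℓ∤3 (∣ₙ.∣m+n∣m⇒∣n ℓ∣ℓ+3 ∣ₙ.∣-refl)) , ℓ∤f ]′ (euclidsLemma (ℓ ℕ.+ 3) f ℓ-prime ℓ∣)
    regroup : ∀ D k ℓ → D ℕ.* ((k ℕ.* ℓ) ℕ.* (k ℕ.* ℓ)) ≡ ℓ ℕ.* (D ℕ.* k ℕ.* k ℕ.* ℓ)
    regroup = solve-∀
    ℓ∤W : ¬ (ℓ ∣ₙ W)
    ℓ∤W (divides k W≡) = ℓ∤cofactor (divides (D ℕ.* k ℕ.* k) (ℕₚ.*-cancelˡ-≡ _ _ ℓ {{prime⇒nonZero ℓ-prime}}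
      (trans (sym (ℕₚ.*-assoc ℓ (ℓ ℕ.+ 3) f))
            (trans Zf≡DWW (trans (cong (λ W → D ℕ.* (W ℕ.* W)) W≡) (regroup D k ℓ))))))
    by-cases : ℓ ∣ₙ D ⊎ ℓ ∣ₙ W ℕ.* W → ℓ ∣ₙ D
    by-cases (inj₁ ℓ∣D)  = ℓ∣D
    by-cases (inj₂ ℓ∣WW) = ⊥-elim ([ ℓ∤W , ℓ∤W ]′ (euclidsLemma W W ℓ-prime ℓ∣WW))

  -- As 3 does not divide `D`, 9 does not divide `3 D`; so `k²` is prime to 3 and divides `D`.
  3D-squarefree : ∀ k → k ℕ.* k ∣ₙ 3 ℕ.* D → k ≡ 1
  3D-squarefree k kk∣3D = D-squarefree k (coprime-divisor coprime kk∣3D)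
    where
    3∤k : ¬ (3 ∣ₙ k)
    3∤k 3∣k = 3∤D (∣ₙ.*-cancelˡ-∣ 3 (∣ₙ.∣-trans (∣ₙ.*-pres-∣ 3∣k 3∣k) kk∣3D))
    coprime : Coprime (k ℕ.* k) 3
    coprime {i} (i∣kk , i∣3) = [ (λ i≡1 → i≡1) ,
          (λ { refl → ⊥-elim ([ 3∤k , 3∤k ]′ (euclidsLemma k k prime-3 i∣kk)) }) ]′
          (prime⇒irreducible prime-3 i∣3)

  private
    even : ∀ n → ∃ λ k → n ℕ.* (n ℕ.+ 3) ≡ 2 ℕ.* k
    even zero    = 0 , refl
    even (suc n) = let k , eq = even n in k ℕ.+ n ℕ.+ 2 , trans (expand n)
          (trans (cong (λ t → t ℕ.+ (2 ℕ.* n ℕ.+ 4)) eq) (collect k n))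
      where
      expand : ∀ n → (1 ℕ.+ n) ℕ.* (1 ℕ.+ n ℕ.+ 3) ≡ n ℕ.* (n ℕ.+ 3) ℕ.+ (2 ℕ.* n ℕ.+ 4)
      expand = solve-∀
      collect : ∀ k n → 2 ℕ.* k ℕ.+ (2 ℕ.* n ℕ.+ 4) ≡ 2 ℕ.* (k ℕ.+ n ℕ.+ 2)
      collect = solve-∀

    ιZ : ι⁺ Z ≡ ι⁺ ℓ * (ι⁺ ℓ + nat 3)
    ιZ = trans (ι⁺-* ℓ (ℓ ℕ.+ 3)) (cong (ι⁺ ℓ *_) (ι⁺-+ ℓ 3))

    -- Modulo 3, `ℓ (ℓ + 3)` is `ℓ²`, which is 1 because 3 does not divide `ℓ`.
    ζ-residue : ∃ λ z → Int z × ι⁺ Z ≡ 1# + nat 3 * z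
    ζ-residue = by-residue (residue₃ (Int-ι (ℤ.+ ℓ)))
      where
      by-residue : (∃ λ y → Int y × (ι⁺ ℓ ≡ P * y ⊎ ι⁺ ℓ ≡ 1# + P * y ⊎ ι⁺ ℓ ≡ - 1# + P * y)) → ∃ λ z →
            Int z × ι⁺ Z ≡ 1# + nat 3 * z
      by-residue (y , Iy , inj₁ eq) = ⊥-elim
            (P-nonunit (Int-* Iy (int (ℤ.+ 1) (ℤ.+ ℓ) 3∤ℓ (trans (*-comm (ι⁺ ℓ ⁻¹) (ι⁺ ℓ)) ℓ-inverse)))
          (trans (sym (*-assoc P y (ι⁺ ℓ ⁻¹))) (trans (cong (_* ι⁺ ℓ ⁻¹) (sym eq)) ℓ-inverse)))
        where
        ℓ-inverse : ι⁺ ℓ * ι⁺ ℓ ⁻¹ ≡ 1#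
        ℓ-inverse = inverseʳ (ι⁺ ℓ) (ι≢0 {ℤ.+ ℓ} 3∤ℓ)
      by-residue (y , Iy , inj₂ (inj₁ eq)) = 1# + nat 5 * y + nat 3 * y ^ 2 ,
            (integral (y ∷ []) (λ y → con 1 :+ con 5 :* y :+ con 3 :* y :^ 2) (Iy ∷ [])) ,
        trans ιZ (trans (cong (λ t → t * (t + nat 3)) eq)
              (solve (y ∷ []) (λ y → (con 1 :+ con 3 :* y) :* (con 1 :+ con 3 :* y :+ con 3)
              := con 1 :+ con 3 :* (con 1 :+ con 5 :* y :+ con 3 :* y :^ 2))))
      by-residue (y , Iy , inj₂ (inj₂ eq)) = y + nat 3 * y ^ 2 - 1# ,
            (integral (y ∷ []) (λ y → y :+ con 3 :* y :^ 2 :- con 1) (Iy ∷ [])) ,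
        trans ιZ (trans (cong (λ t → t * (t + nat 3)) eq)
              (solve (y ∷ []) (λ y → (:- con 1 :+ con 3 :* y) :* (:- con 1 :+ con 3 :* y :+ con 3)
              := con 1 :+ con 3 :* (y :+ con 3 :* y :^ 2 :- con 1))))

    ιf : ι⁺ f ≡ 1# - nat 3 * ι⁺ Z + nat 9 * ι⁺ Z ^ 2
    ιf = begin
      ι⁺ f                                                ≡⟨
            solve (ι⁺ f ∷ ι⁺ Z ∷ []) (λ x y → x := x :+ con 3 :* y :- con 3 :* y) ⟩
      ι⁺ f + nat 3 * ι⁺ Z - nat 3 * ι⁺ Z                  ≡⟨
            cong (_- nat 3 * ι⁺ Z) (trans (cong (ι⁺ f +_) (sym (ι⁺-* 3 Z))) (sym (ι⁺-+ f (3 ℕ.* Z)))) ⟩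
      ι⁺ (f ℕ.+ 3 ℕ.* Z) - nat 3 * ι⁺ Z                   ≡⟨ cong (λ t → ι⁺ t - nat 3 * ι⁺ Z) f+3Z ⟩
      ι⁺ (9 ℕ.* (Z ℕ.* Z) ℕ.+ 1) - nat 3 * ι⁺ Z           ≡⟨
            cong (_- nat 3 * ι⁺ Z) (trans (ι⁺-+ (9 ℕ.* (Z ℕ.* Z)) 1)
            (cong (_+ 1#) (trans (ι⁺-* 9 (Z ℕ.* Z)) (cong (nat 9 *_) (ι⁺-* Z Z))))) ⟩
      nat 9 * (ι⁺ Z * ι⁺ Z) + 1# - nat 3 * ι⁺ Z           ≡⟨
            solve (ι⁺ Z ∷ []) (λ y → con 9 :* (y :* y) :+ con 1 :- con 3 :* y
            := con 1 :- con 3 :* y :+ con 9 :* y :^ 2) ⟩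
      1# - nat 3 * ι⁺ Z + nat 9 * ι⁺ Z ^ 2                ∎
      where open ≡-Reasoning

  initial : State D 0
  initial = record
    { ζ = ι⁺ Z ; θ = ι⁺ W ; z = proj₁ ζ-residue ; ζ₂ = ι⁺ (proj₁ (even ℓ)) ; θ₂ = ι⁺ W
    ; Iz = proj₁ (proj₂ ζ-residue)
    ; Iθ = Int-ι (ℤ.+ W)
    ; I₂ζ₂ = ℤ₍₂₎.Int-ι (ℤ.+ proj₁ (even ℓ))
    ; I₂θ₂ = ℤ₍₂₎.Int-ι (ℤ.+ W)
    ; ζ≡ = proj₂ (proj₂ ζ-residue)
    ; ζ≡2ζ₂ = trans (cong ι⁺ (proj₂ (even ℓ))) (ι⁺-* 2 (proj₁ (even ℓ)))
    ; θ≡ = sym (*-identityˡ (ι⁺ W))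
    ; curve = trans (cong (ι⁺ D *_) (sym (ι⁺-* W W)))
          (trans (sym (ι⁺-* D (W ℕ.* W))) (trans (cong ι⁺ (sym Zf≡DWW)) (trans (ι⁺-* Z f) (cong (ι⁺ Z *_) ιf))))
          }

-- Infinitely many triples over one field: powers of 2 in numerators.

prime-power-divides : ∀ {p} → Prime p → ∀ n {a b} → p ℕ.^ n ∣ₙ a ℕ.* b → ¬ (p ∣ₙ b) → p ℕ.^ n ∣ₙ a
prime-power-divides p-prime zero    {a} _     _   = ∣ₙ.1∣ a
prime-power-divides {p} p-prime (suc n) {a} {b} pⁿ∣ab p∤b = by-cases
      (euclidsLemma a b p-prime (∣ₙ.∣-trans (divides (p ℕ.^ n) (ℕₚ.*-comm p (p ℕ.^ n))) pⁿ∣ab))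
  where
  by-cases : p ∣ₙ a ⊎ p ∣ₙ b → p ℕ.* p ℕ.^ n ∣ₙ a
  by-cases (inj₂ p∣b) = ⊥-elim (p∤b p∣b)
  by-cases (inj₁ (divides k refl)) = subst (p ℕ.* p ℕ.^ n ∣ₙ_) (ℕₚ.*-comm p k) (∣ₙ.*-monoʳ-∣ p
    (prime-power-divides p-prime n {k} {b}
          (∣ₙ.*-cancelˡ-∣ p {{prime⇒nonZero p-prime}} (subst (p ℕ.* p ℕ.^ n ∣ₙ_) (regroup k p b) pⁿ∣ab)) p∤b))
    where
    regroup : ∀ k p b → k ℕ.* p ℕ.* b ≡ p ℕ.* (k ℕ.* b)
    regroup = solve-∀

n<2^n : ∀ n → n < 2 ℕ.^ n
n<2^n zero    = ℕ.s≤s ℕ.z≤n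
n<2^n (suc n) = ℕₚ.≤-trans (ℕₚ.+-mono-≤ (ℕₚ.m^n>0 2 n) (n<2^n n))
      (ℕₚ.≤-reflexive (cong (2 ℕ.^ n ℕ.+_) (sym (ℕₚ.+-identityʳ (2 ℕ.^ n)))))

-- The numerator is a non-zero multiple of `2ⁿ`, because the denominator of `x` allowed by `Int₂` is
-- odd.
numerator-bound : ∀ {r x} n → r ≢ 0# → Int₂ x → r ≡ nat 2 ^ n * x → n < ∣ ↥ r ∣
numerator-bound {r} {x} n r≢0 (ℤ₍₂₎.int k b 2∤b eq) r≡ = ℕₚ.<-≤-trans (n<2^n n) (∣ₙ.∣⇒≤ {{ℕ.≢-nonZero ↥≢0}}
    (prime-power-divides prime[2] n {∣ ↥ r ∣} {∣ b ∣}
          (divides (∣ k ∣ ℕ.* ↧ₙ r) (trans (sym (ℤₚ.abs-* (↥ r) b))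
          (trans (cong ∣_∣ product) (trans (ℤₚ.abs-* (k ℤ.* ↧ r) (ℤ.+ (2 ℕ.^ n)))
          (cong (ℕ._* 2 ℕ.^ n) (ℤₚ.abs-* k (↧ r))))))) 2∤b))
  where
  open ≡-Reasoning
  ι-2^ : ∀ n → ι⁺ (2 ℕ.^ n) ≡ nat 2 ^ n
  ι-2^ zero    = refl
  ι-2^ (suc n) = trans (ι⁺-* 2 (2 ℕ.^ n)) (trans (cong (nat 2 *_) (ι-2^ n)) (sym (^-suc (nat 2) n)))
  ↥≢0 : ∣ ↥ r ∣ ≢ 0
  ↥≢0 ↥≡0 = r≢0 (*-zero {ι (↧ r)} {r}
        (trans (*-comm (ι (↧ r)) r) (trans (numerator-denominator r) (cong ι {↥ r} {ℤ.+ 0} (ℤₚ.∣i∣≡0⇒i≡0 ↥≡0))))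
        ↧≢0)
    where
    ↧≢0 : ι (↧ r) ≢ 0#
    ↧≢0 eq = ℕₚ.<⇒≢ (ℕ.s≤s ℕ.z≤n) (sym (ℤₚ.+-injective (ι-injective {↧ r} {ℤ.+ 0} eq)))
  product : ↥ r ℤ.* b ≡ k ℤ.* ↧ r ℤ.* ℤ.+ (2 ℕ.^ n)
  product = ι-injective (begin
    ι (↥ r ℤ.* b)                          ≡⟨ ι-* (↥ r) b ⟩
    ι (↥ r) * ι b                          ≡⟨ cong (_* ι b) (numerator-denominator r) ⟨
    r * ι (↧ r) * ι b                      ≡⟨ cong (λ t → t * ι (↧ r) * ι b) r≡ ⟩
    nat 2 ^ n * x * ι (↧ r) * ι b          ≡⟨
          solve (nat 2 ^ n ∷ x ∷ ι (↧ r) ∷ ι b ∷ []) (λ a x y b → a :* x :* y :* b := x :* b :* y :* a) ⟩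
    x * ι b * ι (↧ r) * nat 2 ^ n          ≡⟨ cong₂ (λ u v → u * ι (↧ r) * v) eq (sym (ι-2^ n)) ⟩
    ι k * ι (↧ r) * ι⁺ (2 ℕ.^ n)           ≡⟨ cong (_* ι⁺ (2 ℕ.^ n)) (ι-* k (↧ r)) ⟨
    ι (k ℤ.* ↧ r) * ι⁺ (2 ℕ.^ n)           ≡⟨ ι-* (k ℤ.* ↧ r) (ℤ.+ (2 ℕ.^ n)) ⟨
    ι (k ℤ.* ↧ r ℤ.* ℤ.+ (2 ℕ.^ n))        ∎)

module Escape (d : ℤ) where
  open QField d

  -- The new triples start with `α = r √d`, whose rational part is 0, so the numerator of the `√d`
  -- coordinate is the quantity to watch.
  height : K → ℕ
  height x = ∣ ↥ proj₂ x ∣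

  bound : List (K × K × K) → ℕ
  bound []                = 0
  bound ((x , y , z) ∷ L) = height x ℕ.+ height y ℕ.+ height z ℕ.+ bound L

  height≤bound : ∀ {x t L} → t ∈ L → x ∈₃ t → height x ℕ.≤ bound L
  height≤bound {L = (x , y , z) ∷ L} (here refl) x∈t = ℕₚ.≤-trans (in-triple x∈t) (ℕₚ.m≤m+n _ (bound L))
    where
    in-triple : ∀ {w} → w ∈₃ (x , y , z) → height w ℕ.≤ height x ℕ.+ height y ℕ.+ height z
    in-triple (inj₁ refl)        = ℕₚ.≤-trans (ℕₚ.m≤m+n (height x) (height y)) (ℕₚ.m≤m+n _ (height z))
    in-triple (inj₂ (inj₁ refl)) = ℕₚ.≤-trans (ℕₚ.m≤n+m (height y) (height x)) (ℕₚ.m≤m+n _ (height z))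
    in-triple (inj₂ (inj₂ refl)) = ℕₚ.m≤n+m (height z) (height x ℕ.+ height y)
  height≤bound {L = (x , y , z) ∷ L} (there t∈L) x∈t = ℕₚ.≤-trans (height≤bound t∈L x∈t) (ℕₚ.m≤n+m (bound L) _)

module Triples (D : ℕ) (3∤D : ¬ (3 ∣ₙ D)) (initial : State D 0) where

  private
    d : ℤ
    d = ℤ.+ (3 ℕ.* D)

  open QField d

  triples : ∀ (L : List (K × K × K)) → ∃ λ a → ∃ λ b → ∃ λ c →
    DiophantineTriple a b c ×
    (∀ t → t ∈ L → ¬ SameSet (a , b , c) t) ×
    (let open Curve a b c in
    ∃ λ (g : Z2×Z12 → Point) →
    (∀ u → OnCurve (g u)) ×
    (∀ u v → g (u ⊞ v) ≡ (g u ⊕ g v)) ×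
    Injective _≡_ _≡_ g ×
    (∀ P → OnCurve P → IsTorsion P → ∃ λ u → g u ≡ P))
  triples L = a , b , c ,
      (a≢0 , b≢0 , c≢0 , a≢b , a≢c , b≢c , (0K , square-ab) , (m , square-ac) , (q *K ϖ , square-bc)) ,
      (λ t t∈L same → ℕₚ.<⇒≱ n<height (height≤bound t∈L (proj₁ same a (inj₁ refl)))) ,
      S.R.Transport.transport a b c g g-on g-⊞ g-injective g-torsion
    where
    open Escape d
    -- As many doublings as the bound of the list push the height of `a` beyond every entry
    -- occurring in it.
    module S = FromState D 3∤D (doubles (bound L) initial)
    open S using (m; q; r)
    open S.Fam
    r≢0 : r ≢ 0#
    r≢0 = ≢0-factor {r} {S.s} S.rs≡1

    n<height : bound L < height a
    n<height = numerator-bound (bound L) r≢0 (proj₁ (proj₂ S.2ⁿ∣r)) (proj₂ (proj₂ S.2ⁿ∣r))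

theorem2 : ∀ (N : ℕ) → ∃ λ d → QuadraticDiscr d × N < ∣ d ∣ ×
    (let open QField d in
    ∀ (L : List (K × K × K)) → ∃ λ a → ∃ λ b → ∃ λ c →
    DiophantineTriple a b c ×
    (∀ t → t ∈ L → ¬ SameSet (a , b , c) t) ×
    (let open Curve a b c in
    ∃ λ (g : Z2×Z12 → Point) →
    (∀ u → OnCurve (g u)) ×
    (∀ u v → g (u ⊞ v) ≡ (g u ⊕ g v)) ×
    Injective _≡_ _≡_ g ×
    (∀ P → OnCurve P → IsTorsion P → ∃ λ u → g u ≡ P)))
theorem2 N = d , discriminant , large , Triples.triples D 3∤D initial
  where
  -- The summand 3 secures the hypothesis `3 < ℓ` of `InitialState`.
  found : ∃ λ ℓ → Prime ℓ × N ℕ.+ 3 < ℓ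
  found = prime-above (N ℕ.+ 3)
  ℓ : ℕ
  ℓ = proj₁ found
  open InitialState ℓ (proj₁ (proj₂ found)) (ℕₚ.≤-<-trans (ℕₚ.m≤n+m 3 N) (proj₂ (proj₂ found)))

  d : ℤ
  d = ℤ.+ (3 ℕ.* D)

  D≤3D : D ℕ.≤ 3 ℕ.* D
  D≤3D = ℕₚ.m≤m+n D (D ℕ.+ (D ℕ.+ 0))

  ℓ≤3D : ℓ ℕ.≤ 3 ℕ.* D
  ℓ≤3D = ℕₚ.≤-trans (∣ₙ.∣⇒≤ {{ℕ.≢-nonZero D≢0}} ℓ∣D) D≤3D

  N+3<3D : N ℕ.+ 3 < 3 ℕ.* D
  N+3<3D = ℕₚ.<-≤-trans (proj₂ (proj₂ found)) ℓ≤3D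

  large : N < 3 ℕ.* D
  large = ℕₚ.≤-<-trans (ℕₚ.m≤m+n N 3) N+3<3D

  1<3D : 1 < 3 ℕ.* D
  1<3D = ℕₚ.≤-<-trans (ℕₚ.≤-trans (ℕ.s≤s ℕ.z≤n) (ℕₚ.m≤n+m 3 N)) N+3<3D

  discriminant : QuadraticDiscr d
  discriminant = ((λ d≡0 → ℕₚ.<⇒≢ (ℕₚ.<-trans (ℕ.s≤s ℕ.z≤n) 1<3D) (sym (ℤₚ.+-injective d≡0))) , 3D-squarefree) ,
    λ d≡1 → ℕₚ.<⇒≢ 1<3D (sym (ℤₚ.+-injective d≡1))
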